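{- Let $n\ge 2$, $r\ge 1$, and let $\underline a=(a_1,\dots,a_r)$ be a tuple of integers with $a_i\ge 2$ for all $i$ and $\sum_{i=1}^r (a_i-1)=n-1$. Let $b_i=\sum_{j=1}^i (a_j-1)$. Then $$\sum_{(z_1,\dots,z_r)\in\mathcal{M}(\underline a)} \mathrm{wt}(z_1\cdots z_r)=\prod_{i=1}^{r-1}\big(b_iX_i+n-b_i\big),$$ where $\mathcal{M}(\underline a)$ is the set of minimal factorizations of the long cycle $c=(1,2,\dots,n)$ of type $\underline a$ and $\mathrm{wt}$ is the weight (a monomial in the variables $X_1,\dots,X_{r-1}$) defined in the context.
   Context: $\mathfrak{S}_n$ is the symmetric group on $\{1,\dots,n\}$, with products composed as functions (right to left). $c=(1,2,\dots,n)$ is the long cycle $1\mapsto 2\mapsto\cdots\mapsto n\mapsto 1$. $\mathcal{M}(\underline a)$ is the set of tuples $(z_1,\dots,z_r)$ of elements of $\mathfrak{S}_n$ such that $z_i$ is a cycle of length $a_i$ for each $i$ and $z_1z_2\cdots z_r=c$ (minimality is the condition $\sum_i(a_i-1)=n-1$). A set partition of a finite totally ordered set $T$ is noncrossing if there are no $i<j<k<\ell$ in $T$ with $i,k$ in one block and $j,\ell$ in another block. An interval partition of $T$ is a set partition whose blocks are intervals $[a,b]=\{t\in T: a\le t\le b\}$. A near interval partition of $T$ is a partition obtained from an interval partition of $T$ with at least three blocks by merging its smallest (leftmost) block with its largest (rightmost) block. $\hat 0$ is the partition into singletons and $\hat 1$ the partition with one block. For a noncrossing partition $\pi$ of $\{1,\dots,n\}$,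 $\sigma_\pi\in\mathfrak{S}_n$ is the permutation whose orbits are the blocks of $\pi$ and which satisfies, for each block $\{i_1<\dots<i_s\}$, $\sigma_\pi(i_k)=i_{k+1}$ for $k<s$ and $\sigma_\pi(i_s)=i_1$. $\mathcal{N}(\underline a)$ is the set of $(r+1)$-tuples $(\pi_0,\dots,\pi_r)$ of noncrossing partitions of $\{1,\dots,n\}$ such that $\pi_0=\hat 0$, $\pi_r=\hat 1$, and for each $i$, $\pi_{i-1}$ is obtained from $\pi_i$ by splitting one block $B$ of $\pi_i$ into $a_i$ blocks $B_1,\dots,B_{a_i}$ which form either an interval partition or a near interval partition of $B$ (with the induced order). We write $\pi_{i-1}\sqsubset\pi_i$ when $B_1,\dots,B_{a_i}$ form an interval partition of $B$. The weight of $\Pi=(\pi_0,\dots,\pi_r)\in\mathcal{N}(\underline a)$ is $$\mathrm{wt}(\Pi)=\prod_{\substack{1\le i\le r-1\\ \pi_i\not\sqsubset\pi_{i+1}}}X_i .$$ The map $(\pi_0,\dots,\pi_r)\mapsto(\sigma_{\pi_0}^{ -1}\sigma_{\pi_1},\dots,\sigma_{\pi_{r-1}}^{ -1}\sigma_{\pi_r})$ is a bijection from $\mathcal{N}(\underline a)$ to $\mathcal{M}(\underline a)$. The weight of $(z_1,\dots,z_r)\in\mathcal{M}(\underline a)$, denoted $\mathrm{wt}(z_1\cdots z_r)$, is $\mathrm{wt}(\Pi)$ for the corresponding $\Pi$; that is, $\pi_i$ is the noncrossing partition with $\sigma_{\pi_i}=z_1\cdots z_i$. -}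

module Defs where

open import Level using (0ℓ)
open import Algebra.Bundles using (CommutativeRing)
open import Data.Nat.Base as ℕ using (ℕ; zero; suc; _∸_)
import Data.Nat.Properties as ℕ
import Data.Nat.ListAction as ℕ
open import Data.Nat.DivMod using (_mod_)
open import Data.Fin.Base using (Fin; zero; suc; toℕ; fromℕ; inject₁; _<_; _≤_)
open import Data.Fin.Properties using (_≟_; _<?_; _≤?_; any?; all?)
open import Data.Fin.Permutation as Perm using (Permutation′; _⟨$⟩ʳ_; _∘ₚ_)
open import Data.List.Base as List using (List; []; _∷_; allFin; cartesianProductWith)
open import Data.Maybe.Base using (fromMaybe)
open import Data.Product.Base using (Σ; ∃; ∃₂; _×_; _,_)
open import Data.Sum.Base using (_⊎_)
open import Data.Vec.Base as Vec using (Vec; []; _∷_; lookup; toList)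
open import Function.Base using (_∘_)
open import Relation.Binary.PropositionalEquality.Core using (_≡_)
open import Relation.Nullary.Decidable
  using (Dec; yes; no; map′; ¬?; _×-dec_; _⊎-dec_; _→-dec_; recompute)
open import Relation.Nullary.Negation using (¬_)
open import Relation.Unary using (Pred; Decidable)

private
  variable
    n r : ℕ

-- The ground set {1,…,n} is Fin n, the element i being represented by i − 1.

Searchable : Set → Set₁
Searchable A = {P : Pred A 0ℓ} → Decidable P → Dec (∃ P)

searchVec : {A : Set} → Searchable A → ∀ k → Searchable (Vec A k)
searchVec s zero    P? = map′ ([] ,_) (λ { ([] , p) → p }) (P? [])
searchVec s (suc k) P? =
  map′ (λ { (x , v , p) → x ∷ v , p }) (λ { (x ∷ v , p) → x , v , p })
       (s (λ x → searchVec s k (λ v → P? (x ∷ v))))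

-- The cyclic successor: 0 ↦ 1 ↦ ⋯ ↦ n − 1 ↦ 0, that is, the long cycle c.
next : Fin n → Fin n
next {suc n} i = suc (toℕ i) mod suc n

infixr 9 _·_

-- Right-to-left composition; the library's _∘ₚ_ composes left to right.
_·_ : Permutation′ n → Permutation′ n → Permutation′ n
z · w = w ∘ₚ z

-- product z k is z₁ z₂ ⋯ z_k.
product : Vec (Permutation′ n) r → ℕ → Permutation′ n
product z k = List.foldr _·_ Perm.id (List.take k (toList z))

IsCycle : ℕ → Permutation′ n → Set
IsCycle {n} a z = ∃ λ (x : Vec (Fin n) a) →
  (∀ k l → lookup x k ≡ lookup x l → k ≡ l) ×
  (∀ k → z ⟨$⟩ʳ lookup x k ≡ lookup x (next k)) ×
  (∀ t → ¬ (∃ λ k → lookup x k ≡ t) → z ⟨$⟩ʳ t ≡ t)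

isCycle? : ∀ a (z : Permutation′ n) → Dec (IsCycle a z)
isCycle? a z = searchVec any? a λ x →
  all? (λ k → all? λ l → (lookup x k ≟ lookup x l) →-dec (k ≟ l)) ×-dec
  all? (λ k → z ⟨$⟩ʳ lookup x k ≟ lookup x (next k)) ×-dec
  all? (λ t → ¬? (any? λ k → lookup x k ≟ t) →-dec (z ⟨$⟩ʳ t ≟ t))

IsFactorization : Vec ℕ r → Vec (Permutation′ n) r → Set
IsFactorization {r} a z =
  (∀ i → IsCycle (lookup a i) (lookup z i)) ×
  (∀ t → product z r ⟨$⟩ʳ t ≡ next t)

isFactorization? : (a : Vec ℕ r) → Decidable (IsFactorization {n = n} a)
isFactorization? {r} a z =
  all? (λ i → isCycle? (lookup a i) (lookup z i)) ×-dec
  all? (λ t → product z r ⟨$⟩ʳ t ≟ next t)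

-- Each permutation occurs exactly once up to pointwise equality: it is
-- determined by the image of zero and by the induced bijection between the
-- remaining elements.
permutations : ∀ n → List (Permutation′ n)
permutations zero    = Perm.id ∷ []
permutations (suc n) =
  cartesianProductWith (Perm.insert zero) (allFin (suc n)) (permutations n)

vectors : {A : Set} → List A → ∀ k → List (Vec A k)
vectors xs zero    = [] ∷ []
vectors xs (suc k) = cartesianProductWith _∷_ xs (vectors xs k)

𝓜 : ∀ n → Vec ℕ r → List (Vec (Permutation′ n) r)
𝓜 {r} n a = List.filter (isFactorization? a) (vectors (permutations n) r)

-- A set partition is given by the map sending each element to the least
-- element of its block. The proofs are irrelevant, so equal partitions are
-- propositionally equal.
record SetPartition (n : ℕ) : Set where
  constructor partition
  field
    leasts  : Vec (Fin n) n
    .below  : ∀ i → lookup leasts i ≤ i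
    .isRoot : ∀ i → lookup leasts (lookup leasts i) ≡ lookup leasts i

  least : Fin n → Fin n
  least = lookup leasts

open SetPartition public using (least)

searchPartition : Searchable (SetPartition n)
searchPartition {n} {P} P? =
  map′ (λ { (v , b , i , p) → partition v b i , p })
       (λ { (partition v b i , p) → v , relevant v b i p })
       (searchVec any? n valid?)
  where
  Valid : Vec (Fin n) n → Set
  Valid v =
    Σ (∀ i → lookup v i ≤ i) λ b →
    Σ (∀ i → lookup v (lookup v i) ≡ lookup v i) λ i →
    P (partition v b i)

  below? : ∀ v → Dec (∀ i → lookup v i ≤ i)
  below? v = all? λ i → lookup v i ≤? i

  isRoot? : ∀ v → Dec (∀ i → lookup v (lookup v i) ≡ lookup v i)
  isRoot? v = all? λ i → lookup v (lookup v i) ≟ lookup v i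

  valid? : Decidable Valid
  valid? v with below? v | isRoot? v
  ... | no ¬b | _     = no λ (b , _) → ¬b b
  ... | yes _ | no ¬i = no λ (_ , i , _) → ¬i i
  ... | yes b | yes i = map′ (λ p → b , i , p) (λ (_ , _ , p) → p) (P? (partition v b i))

  relevant : ∀ v .b .i → P (partition v b i) → Valid v
  relevant v b i p =
    recompute (below? v) b ,
    recompute (isRoot? v) i , p

infix 4 _∼[_]_ _∼[_]?_

_∼[_]_ : Fin n → SetPartition n → Fin n → Set
i ∼[ π ] j = least π i ≡ least π j

_∼[_]?_ : (i : Fin n) (π : SetPartition n) (j : Fin n) → Dec (i ∼[ π ] j)
i ∼[ π ]? j = least π i ≟ least π j

Noncrossing : SetPartition n → Set
Noncrossing π = ∀ i j k l → i < j → j < k → k < l →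
  i ∼[ π ] k → j ∼[ π ] l → i ∼[ π ] j

noncrossing? : Decidable (Noncrossing {n})
noncrossing? π = all? λ i → all? λ j → all? λ k → all? λ l →
  (i <? j) →-dec (j <? k) →-dec (k <? l) →-dec
  (i ∼[ π ]? k) →-dec (j ∼[ π ]? l) →-dec (i ∼[ π ]? j)

-- The permutation σ_π: the next larger element of the block if there is one
-- (allFin is increasing), and the least element of the block otherwise.
σ : SetPartition n → Fin n → Fin n
σ {n} π i = fromMaybe (least π i)
  (List.head (List.filter (λ j → (i <? j) ×-dec (i ∼[ π ]? j)) (allFin n)))

-- A partition π of Fin n stands here for the partition it induces on T.

-- Blocks are counted by their least elements in T.
blockCount : {T : Pred (Fin n) 0ℓ} → Decidable T → SetPartition n → ℕ
blockCount {n} T? π = List.length (List.filter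
  (λ t → T? t ×-dec all? λ s → T? s →-dec (s ∼[ π ]? t) →-dec (t ≤? s))
  (allFin n))

IsInterval : Pred (Fin n) 0ℓ → SetPartition n → Set
IsInterval T π = ∀ x → T x → ∃₂ λ p q → T p × T q ×
  (∀ t → T t → (t ∼[ π ] x → p ≤ t × t ≤ q) × (p ≤ t × t ≤ q → t ∼[ π ] x))

isInterval? : {T : Pred (Fin n) 0ℓ} → Decidable T → Decidable (IsInterval T)
isInterval? T? π = all? λ x → T? x →-dec any? λ p → any? λ q → T? p ×-dec T? q ×-dec
  all? λ t → T? t →-dec
    ((t ∼[ π ]? x) →-dec ((p ≤? t) ×-dec (t ≤? q))) ×-dec
    (((p ≤? t) ×-dec (t ≤? q)) →-dec (t ∼[ π ]? x))

-- ρ is an interval partition of T with at least three blocks, p = min T and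
-- q = max T, so the blocks of p and q are the leftmost and rightmost ones.
IsNearInterval : {T : Pred (Fin n) 0ℓ} → Decidable T → SetPartition n → Set
IsNearInterval {n} {T} T? π = ∃ λ (ρ : SetPartition n) →
  IsInterval T ρ × 3 ℕ.≤ blockCount T? ρ ×
  ∃₂ λ p q → T p × T q × (∀ t → T t → p ≤ t × t ≤ q) ×
  (∀ s t → T s → T t →
    let Merged = s ∼[ ρ ] t ⊎ (s ∼[ ρ ] p × t ∼[ ρ ] q) ⊎ (s ∼[ ρ ] q × t ∼[ ρ ] p)
    in (s ∼[ π ] t → Merged) × (Merged → s ∼[ π ] t))

isNearInterval? : {T : Pred (Fin n) 0ℓ} (T? : Decidable T) → Decidable (IsNearInterval T?)
isNearInterval? T? π = searchPartition λ ρ →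
  isInterval? T? ρ ×-dec (3 ℕ.≤? blockCount T? ρ) ×-dec
  any? λ p → any? λ q → T? p ×-dec T? q ×-dec
  (all? λ t → T? t →-dec ((p ≤? t) ×-dec (t ≤? q))) ×-dec
  (all? λ s → all? λ t → T? s →-dec T? t →-dec
    let merged? = (s ∼[ ρ ]? t) ⊎-dec
                  ((s ∼[ ρ ]? p) ×-dec (t ∼[ ρ ]? q)) ⊎-dec
                  ((s ∼[ ρ ]? q) ×-dec (t ∼[ ρ ]? p))
    in ((s ∼[ π ]? t) →-dec merged?) ×-dec (merged? →-dec (s ∼[ π ]? t)))

Block : SetPartition n → Fin n → Pred (Fin n) 0ℓ
Block π x t = t ∼[ π ] x

block? : (π : SetPartition n) (x : Fin n) → Decidable (Block π x)
block? π x t = t ∼[ π ]? x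

-- π is obtained from π′ by splitting the block of x into a blocks.
Splits : ℕ → Fin n → SetPartition n → SetPartition n → Set
Splits a x π π′ =
  (∀ s t → s ∼[ π ] t → s ∼[ π′ ] t) ×
  (∀ s t → ¬ Block π′ x s → s ∼[ π′ ] t → s ∼[ π ] t) ×
  blockCount (block? π′ x) π ≡ a

splits? : ∀ a x (π π′ : SetPartition n) → Dec (Splits a x π π′)
splits? a x π π′ =
  (all? λ s → all? λ t → (s ∼[ π ]? t) →-dec (s ∼[ π′ ]? t)) ×-dec
  (all? λ s → all? λ t → ¬? (block? π′ x s) →-dec (s ∼[ π′ ]? t) →-dec (s ∼[ π ]? t)) ×-dec
  (blockCount (block? π′ x) π ℕ.≟ a)

infix 4 _⊏[_]_ _⊏[_]?_ _⊏̃[_]_ _⊏̃[_]?_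

_⊏[_]_ : SetPartition n → ℕ → SetPartition n → Set
π ⊏[ a ] π′ = ∃ λ x → Splits a x π π′ × IsInterval (Block π′ x) π

_⊏[_]?_ : ∀ (π : SetPartition n) a π′ → Dec (π ⊏[ a ] π′)
π ⊏[ a ]? π′ = any? λ x → splits? a x π π′ ×-dec isInterval? (block? π′ x) π

_⊏̃[_]_ : SetPartition n → ℕ → SetPartition n → Set
π ⊏̃[ a ] π′ = ∃ λ x → Splits a x π π′ ×
  (IsInterval (Block π′ x) π ⊎ IsNearInterval (block? π′ x) π)

_⊏̃[_]?_ : ∀ (π : SetPartition n) a π′ → Dec (π ⊏̃[ a ] π′)
π ⊏̃[ a ]? π′ = any? λ x → splits? a x π π′ ×-dec
  (isInterval? (block? π′ x) π ⊎-dec isNearInterval? (block? π′ x) π)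

IsChain : Vec ℕ r → Vec (SetPartition n) (suc r) → Set
IsChain {r} a Π =
  (∀ i → Noncrossing (lookup Π i)) ×
  (∀ s t → s ∼[ lookup Π zero ] t → s ≡ t) ×
  (∀ s t → s ∼[ lookup Π (fromℕ r) ] t) ×
  (∀ i → lookup Π (inject₁ i) ⊏̃[ lookup a i ] lookup Π (suc i))

isChain? : (a : Vec ℕ r) → Decidable (IsChain {n = n} a)
isChain? {r} a Π =
  all? (λ i → noncrossing? (lookup Π i)) ×-dec
  all? (λ s → all? λ t → (s ∼[ lookup Π zero ]? t) →-dec (s ≟ t)) ×-dec
  all? (λ s → all? λ t → s ∼[ lookup Π (fromℕ r) ]? t) ×-dec
  all? (λ i → lookup Π (inject₁ i) ⊏̃[ lookup a i ]? lookup Π (suc i))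

-- σ_{π_i} = z₁ ⋯ z_i for 0 ≤ i ≤ r; equivalently π₀ = 0̂ and
-- z_i = σ_{π_{i−1}}⁻¹ σ_{π_i} for 1 ≤ i ≤ r.
Corresponds : Vec (SetPartition n) (suc r) → Vec (Permutation′ n) r → Set
Corresponds Π z = ∀ i t → σ (lookup Π i) t ≡ product z (toℕ i) ⟨$⟩ʳ t

corresponds? : (Π : Vec (SetPartition n) (suc r)) (z : Vec (Permutation′ n) r) →
               Dec (Corresponds Π z)
corresponds? Π z = all? λ i → all? λ t → σ (lookup Π i) t ≟ product z (toℕ i) ⟨$⟩ʳ t

chainOf? : (a : Vec ℕ r) (z : Vec (Permutation′ n) r) →
           Dec (∃ λ Π → Corresponds Π z × IsChain a Π)
chainOf? {r} a z = searchVec searchPartition (suc r) λ Π →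
  corresponds? Π z ×-dec isChain? a Π

-- b a i = (a₁ − 1) + ⋯ + (a_i − 1)
b : Vec ℕ r → ℕ → ℕ
b a i = ℕ.sum (List.map (_∸ 1) (List.take i (toList a)))

-- An identity between polynomials in X₁,…,X_m with integer coefficients is
-- an identity between their values at all points of all commutative rings
-- (one of which is the polynomial ring itself, with the variables as point).
-- For r = suc m, the entry X j stands for X_{j+1}.
module Weights {c ℓ} (R : CommutativeRing c ℓ) where

  open CommutativeRing R public
    using (Carrier; _≈_; _+_; _*_; _-_; 0#; 1#)
  open CommutativeRing R using (+-monoid; *-commutativeMonoid)

  open import Algebra.Properties.Monoid.Mult +-monoid public
    using () renaming (_×_ to _×ᵣ_)
  open import Algebra.Properties.CommutativeMonoid.Sum *-commutativeMonoid public
    using () renaming (sum to ∏)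

  ∑ : {A : Set} → List A → (A → Carrier) → Carrier
  ∑ xs f = List.foldr _+_ 0# (List.map f xs)

  wtChain : ∀ {m} → Vec ℕ (suc m) → (Fin m → Carrier) →
            Vec (SetPartition n) (suc (suc m)) → Carrier
  wtChain a X Π = ∏ λ j → factor j
    where
    factor : ∀ j → Carrier
    factor j with lookup Π (suc (inject₁ j)) ⊏[ lookup a (suc j) ]? lookup Π (suc (suc j))
    ... | yes _ = 1#
    ... | no  _ = X j

  -- Chains and minimal factorizations correspond bijectively, so for z in
  -- 𝓜 n a the chain found is the only one and the second case does not occur.
  wt : ∀ {m} → Vec ℕ (suc m) → (Fin m → Carrier) → Vec (Permutation′ n) (suc m) → Carrier
  wt a X z with chainOf? a z
  ... | yes (Π , _) = wtChain a X Π
  ... | no  _       = 0#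

{-# OPTIONS --safe #-}

-- Peel off the last factor. If w = σ_π has as many cycles as the lengths of
-- the factors permit, the support of the last cycle z lies in one block B of π
-- and cuts B, in its linear order, into consecutive pieces ending at the
-- elements of the support, followed by a tail which w z⁻¹ joins to the first
-- piece; the step is an interval step exactly when the tail is empty. The
-- weighted number of factorizations of w therefore depends only on the sizes
-- of the blocks, and it is the convolution, over the distributions of the
-- factors among the blocks, of the numbers for single cycles. For these the
-- recursion is solved by multivariate Abel polynomials, by means of the
-- identity G_x ⊛ G_y = G_{x+y}.

module Submission where

open import Defs
open import Algebra.Bundles using (CommutativeRing)

module Combinatorics where

  open import Data.Empty using (⊥)
  open import Data.Fin.Base as Fin using (Fin; zero; suc; fromℕ; inject₁; _<_; _≤_; punchIn; punchOut)
  open import Data.Fin.Induction using (>-wellFounded)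
  open import Data.Fin.Permutation as Perm
    using (Permutation′; _⟨$⟩ʳ_; _⟨$⟩ˡ_; inverseˡ; inverseʳ)
  import Data.Fin.Permutation.Components as Components
  open import Data.Fin.Properties as Fin
    using (_≟_; _<?_; _≤?_; all?; any?; injective⇒≤; punchInᵢ≢i; punchOut-cong; punchOut-punchIn)
  open import Data.Fin.Relation.Unary.Top using (view; ‵fromℕ; ‵inj₁)
  open import Data.List.Base as List using (List; []; _∷_; length; map; filter; _++_; concat; allFin)
  open import Data.List.Membership.DecPropositional using () renaming (_∈?_ to mem?)
  open import Data.List.Membership.Propositional using (_∈_; _∉_)
  open import Data.List.Membership.Propositional.Properties
    using (∈-++⁺ˡ; ∈-++⁺ʳ; ∈-++⁻; ∈-map⁺; ∈-map⁻; ∈-filter⁺; ∈-filter⁻; ∈-concat⁺′; ∈-concat⁻′; ∈-allFin; ∈-∃++; ∈-lookup)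
  open import Data.List.Properties
    using (++-assoc; ++-identityʳ; concat-++; length-++; length-map; map-++; map-∘; map-cong; ∷-injectiveʳ)
  open import Data.List.Relation.Binary.Disjoint.Propositional using (Disjoint)
  open import Data.List.Relation.Binary.Permutation.Propositional
    using (_↭_; ↭-sym; ↭-trans; ↭-reflexive; ↭⇒↭ₛ; prep)
  open import Data.List.Relation.Binary.Permutation.Propositional.Properties
    using (∈-resp-↭; ++⁺ˡ; ++⁺ʳ; ++-comm)
  import Data.List.Relation.Binary.Permutation.Setoid.Properties as Permₛ
  open import Data.List.Relation.Binary.Sublist.Propositional as Sublist
    using (_⊆_; []; _∷_; ⊆-refl)
  import Data.List.Relation.Binary.Sublist.Propositional.Properties as Sublist
  open import Data.List.Relation.Unary.All as All using (All; []; _∷_)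
  import Data.List.Relation.Unary.All.Properties as All
  open import Data.List.Relation.Unary.AllPairs as AllPairs using (AllPairs; []; _∷_)
  import Data.List.Relation.Unary.AllPairs.Properties as AllPairs
  open import Data.List.Relation.Unary.Any as Any using (here; there)
  open import Data.List.Relation.Unary.Any.Properties using (lookup-index)
  open import Data.List.Relation.Unary.Unique.Propositional using (Unique)
  import Data.List.Relation.Unary.Unique.Propositional.Properties as Unique
  open import Data.Maybe.Base using (just; fromMaybe)
  open import Data.Nat.Base as ℕ using (ℕ; zero; suc; _+_)
  open import Data.Nat.DivMod using (m<n⇒m%n≡m; n%n≡0)
  open import Data.Nat.ListAction using (sum)
  import Data.Nat.Properties as ℕ
  open import Data.Product.Base using (∃; ∃₂; _×_; _,_; proj₁; proj₂)
  open import Data.Sum.Base using (_⊎_; inj₁; inj₂)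
  open import Data.Unit.Base using (⊤; tt)
  open import Data.Vec.Base as Vec using (Vec; []; _∷_; _∷ʳ_; lookup)
  open import Data.Vec.Properties using (foldl-∷ʳ; lookup-map; lookup∘tabulate; tabulate∘lookup; tabulate-cong)
  open import Function.Base using (_∘_; id; case_of_)
  open import Induction.WellFounded using (Acc; acc)
  open import Level using (Level)
  open import Relation.Binary.PropositionalEquality
  open import Relation.Nullary.Decidable using (Dec; yes; no; _×-dec_; _→-dec_; recompute)
  open import Relation.Nullary.Negation using (¬_; contradiction)
  open import Relation.Unary using (Decidable)

  private
    variable
      ℓ : Level
      k n r N : ℕ
      A : Set
      X : Set ℓ

  -- A piece is given by its last element and the elements before it; a cut
  -- consists of consecutive pieces and a possibly empty tail.
  Piece Cut : Set → Set
  Piece A = List A × A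
  Cut A = List (Piece A) × List A

  newPiece extend : {A : Set} → A → Cut A → Cut A
  newPiece x (ps , t) = ([] , x) ∷ ps , t
  extend x ([] , t)             = [] , t
  extend x ((is , e) ∷ ps , t) = (x ∷ is , e) ∷ ps , t

  cuts : {A : Set} → ℕ → List A → List (Cut A)
  cuts zero    xs       = ([] , xs) ∷ []
  cuts (suc k) []       = []
  cuts (suc k) (x ∷ xs) = map (newPiece x) (cuts k xs) ++ map (extend x) (cuts (suc k) xs)

  pieceBlock : {A : Set} → Piece A → List A
  pieceBlock (is , e) = is ++ e ∷ []

  -- The tail is merged with the first piece, so these blocks form an interval
  -- partition if it is empty and a near interval partition otherwise.
  cutBlocks : {A : Set} → Cut A → List (List A)
  cutBlocks ([] , t)            = []
  cutBlocks ((is , e) ∷ ps , t) = (is ++ e ∷ t) ∷ map pieceBlock ps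

  AllPairs-⊆ : ∀ {R : A → A → Set} {xs ys} → xs ⊆ ys → AllPairs R ys → AllPairs R xs
  AllPairs-⊆ []          []       = []
  AllPairs-⊆ (_ Sublist.∷ʳ s)    (_ ∷ ps) = AllPairs-⊆ s ps
  AllPairs-⊆ (refl ∷ s)  (p ∷ ps) = Sublist.All-resp-⊆ s p ∷ AllPairs-⊆ s ps

  Sorted : List (Fin n) → Set
  Sorted = AllPairs _<_

  sorted⇒unique : ∀ {xs : List (Fin n)} → Sorted xs → Unique xs
  sorted⇒unique = AllPairs.map Fin.<⇒≢

  sorted-≡ : ∀ {xs ys : List (Fin n)} → Sorted xs → Sorted ys →
             (∀ {t} → t ∈ xs → t ∈ ys) → (∀ {t} → t ∈ ys → t ∈ xs) → xs ≡ ys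
  sorted-≡ []       []       _ _ = refl
  sorted-≡ []       (_ ∷ _)  _ g = case g (here refl) of λ ()
  sorted-≡ (_ ∷ _)  []       f _ = case f (here refl) of λ ()
  sorted-≡ {xs = x ∷ xs} {y ∷ ys} (p ∷ ps) (q ∷ qs) f g =
    cong₂ _∷_ x≡y (sorted-≡ ps qs (tail p x≡y f) (tail q (sym x≡y) g))
    where
    head : ∀ {a b as bs} → All (a <_) as → b ∈ a ∷ as → a ∈ b ∷ bs → All (b <_) bs → a ≡ b
    head p (here refl) _          q = refl
    head p (there b∈)  (here a≡b) q = a≡b
    head p (there b∈)  (there a∈) q = contradiction (All.lookup q a∈) (Fin.<-asym (All.lookup p b∈))

    x≡y : x ≡ y
    x≡y = head p (g (here refl)) (f (here refl)) q

    tail : ∀ {a b as bs} → All (a <_) as → a ≡ b → (∀ {t} → t ∈ a ∷ as → t ∈ b ∷ bs) → ∀ {t} → t ∈ as → t ∈ bs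
    tail p refl f t∈ with f (there t∈)
    ... | here refl = contradiction refl (Fin.<⇒≢ (All.lookup p t∈))
    ... | there t∈′ = t∈′

  unique-∉ : ∀ {x} {xs : List A} → All (x ≢_) xs → x ∉ xs
  unique-∉ ps x∈ = All.lookup ps x∈ refl

  ∉-unique : ∀ {x} {xs : List A} → x ∉ xs → All (x ≢_) xs
  ∉-unique x∉ = All.tabulate λ y∈ → λ { refl → x∉ y∈ }

  unique-resp-↭ : ∀ {xs ys : List A} → xs ↭ ys → Unique xs → Unique ys
  unique-resp-↭ {A} p = Permₛ.Unique-resp-↭ (setoid A) (↭⇒↭ₛ p)

  headOr : A → List A → A
  headOr y []      = y
  headOr y (x ∷ _) = x

  Run : (Fin n → Fin n) → List (Fin n) → Fin n → Set
  Run w []       y = ⊤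
  Run w (x ∷ xs) y = w x ≡ headOr y xs × Run w xs y

  Cyclic : (Fin n → Fin n) → List (Fin n) → Set
  Cyclic w []       = ⊥
  Cyclic w (x ∷ xs) = Run w (x ∷ xs) x

  run-cong : ∀ {w w′ : Fin n → Fin n} xs {y} → (∀ {t} → t ∈ xs → w t ≡ w′ t) → Run w xs y → Run w′ xs y
  run-cong []       eq _       = tt
  run-cong (x ∷ xs) eq (p , r) = trans (sym (eq (here refl))) p , run-cong xs (eq ∘ there) r

  cyclic-cong : ∀ {w w′ : Fin n → Fin n} xs → (∀ {t} → t ∈ xs → w t ≡ w′ t) → Cyclic w xs → Cyclic w′ xs
  cyclic-cong (x ∷ xs) = run-cong (x ∷ xs)

  run-determines : ∀ {w w′ : Fin n → Fin n} {xs y} → Run w xs y → Run w′ xs y → ∀ {t} → t ∈ xs → w t ≡ w′ t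
  run-determines (p , r) (q , s) (here refl) = trans p (sym q)
  run-determines (p , r) (q , s) (there t∈)  = run-determines r s t∈

  run-fixed-last : ∀ {w : Fin n → Fin n} {xs y} → Unique xs → Run w xs y → ∀ {t} → t ∈ xs → w t ≡ t → t ≡ y
  run-fixed-last {xs = x ∷ []}      _             (p , _) (here refl) eq = trans (sym eq) p
  run-fixed-last {xs = x ∷ x′ ∷ xs} ((x≢ ∷ _) ∷ _) (p , _) (here refl) eq =
    contradiction (trans (sym eq) p) x≢
  run-fixed-last {xs = x ∷ xs}      (_ ∷ u)       (_ , r) (there t∈)  eq = run-fixed-last u r t∈ eq

  cyclic-moves : ∀ {w : Fin n → Fin n} {xs} → 2 ℕ.≤ length xs → Unique xs → Cyclic w xs → ∀ {t} → t ∈ xs → w t ≢ t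
  cyclic-moves {xs = x ∷ y ∷ xs} _ u@((x≢y ∷ _) ∷ _) c@(p , _) t∈ eq with run-fixed-last u c t∈ eq
  ... | refl = x≢y (trans (sym eq) p)
  cyclic-moves {xs = x ∷ []} (ℕ.s≤s ()) _ _ _ _

  run-suffix : ∀ {w : Fin n → Fin n} xs {ys y} → Run w (xs ++ ys) y → Run w ys y
  run-suffix []       r       = r
  run-suffix (x ∷ xs) (_ , r) = run-suffix xs r

  transpose-left : ∀ (i j : Fin n) → Components.transpose i j i ≡ j
  transpose-left i j with i ≟ i
  ... | yes _  = refl
  ... | no i≢i = contradiction refl i≢i

  transpose-right : ∀ (i j : Fin n) → Components.transpose i j j ≡ i
  transpose-right i j with j ≟ i
  ... | yes j≡i = j≡i
  ... | no _ with j ≟ j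
  ...   | yes _  = refl
  ...   | no j≢j = contradiction refl j≢j

  transpose-other : ∀ (i j : Fin n) {t} → t ≢ i → t ≢ j → Components.transpose i j t ≡ t
  transpose-other i j {t} t≢i t≢j with t ≟ i
  ... | yes t≡i = contradiction t≡i t≢i
  ... | no _ with t ≟ j
  ...   | yes t≡j = contradiction t≡j t≢j
  ...   | no _    = refl

  -- The cycle (x₁ x₂ ⋯ x_k) = (x₁ x₂)(x₂ x₃)⋯(x_{k−1} x_k).
  cycle : List (Fin n) → Permutation′ n
  cycle []           = Perm.id
  cycle (x ∷ [])     = Perm.id
  cycle (x ∷ y ∷ xs) = Perm.transpose x y · cycle (y ∷ xs)

  cycle-fixes : ∀ (xs : List (Fin n)) {t} → t ∉ xs → cycle xs ⟨$⟩ʳ t ≡ t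
  cycle-fixes []           t∉ = refl
  cycle-fixes (x ∷ [])     t∉ = refl
  cycle-fixes (x ∷ y ∷ xs) t∉ rewrite cycle-fixes (y ∷ xs) (t∉ ∘ there) =
    transpose-other x y (t∉ ∘ here) (t∉ ∘ there ∘ here)

  cycle-cyclic : ∀ (x : Fin n) xs → Unique (x ∷ xs) → Cyclic (cycle (x ∷ xs) ⟨$⟩ʳ_) (x ∷ xs)
  cycle-cyclic x []       _          = refl , tt
  cycle-cyclic x (y ∷ xs) (x≢ ∷ u@(y≢ ∷ _)) =
    trans (cong (Components.transpose x y) (cycle-fixes (y ∷ xs) (unique-∉ x≢))) (transpose-left x y) ,
    go (y ∷ xs) (cycle-cyclic y xs u) x≢ (y≢)
    where
    go : ∀ zs → Run (cycle (y ∷ xs) ⟨$⟩ʳ_) zs y → All (x ≢_) zs → All (y ≢_) (List.drop 1 zs) →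
         Run (cycle (x ∷ y ∷ xs) ⟨$⟩ʳ_) zs x
    go []            _       _         _        = tt
    go (z ∷ [])      (p , _) _         _        = trans (cong (Components.transpose x y) p) (transpose-right x y) , tt
    go (z ∷ z′ ∷ zs) (p , r) (_ ∷ x≢s@(x≢z′ ∷ _)) (y≢z′ ∷ y≢s) =
      trans (cong (Components.transpose x y) p) (transpose-other x y (x≢z′ ∘ sym) (y≢z′ ∘ sym)) ,
      go (z′ ∷ zs) r x≢s y≢s

  cyclic⇒cycle : ∀ {z : Fin n → Fin n} {xs} → Unique xs → Cyclic z xs → (∀ {t} → t ∉ xs → z t ≡ t) →
                 ∀ t → z t ≡ cycle xs ⟨$⟩ʳ t
  cyclic⇒cycle {xs = x ∷ xs} u c fix t with Any.any? (t ≟_) (x ∷ xs)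
  ... | yes t∈ = run-determines c (cycle-cyclic x xs u) t∈
  ... | no t∉  = trans (fix t∉) (sym (cycle-fixes (x ∷ xs) t∉))

  cycle-moves : ∀ {xs : List (Fin n)} → 2 ℕ.≤ length xs → Unique xs → ∀ {t} → t ∈ xs → cycle xs ⟨$⟩ʳ t ≢ t
  cycle-moves {xs = x ∷ xs} 2≤ u = cyclic-moves 2≤ u (cycle-cyclic x xs u)

  cycle-support : ∀ {xs ys : List (Fin n)} → 2 ℕ.≤ length xs → Unique xs →
                  (∀ t → cycle xs ⟨$⟩ʳ t ≡ cycle ys ⟨$⟩ʳ t) → ∀ {t} → t ∈ xs → t ∈ ys
  cycle-support {ys = ys} 2≤ u eq {t} t∈ with Any.any? (t ≟_) ys
  ... | yes t∈′ = t∈′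
  ... | no t∉   = contradiction (trans (eq t) (cycle-fixes ys t∉)) (cycle-moves 2≤ u t∈)

  cycle-injective : ∀ {xs ys : List (Fin n)} → 2 ℕ.≤ length xs → 2 ℕ.≤ length ys → Sorted xs → Sorted ys →
                    (∀ t → cycle xs ⟨$⟩ʳ t ≡ cycle ys ⟨$⟩ʳ t) → xs ≡ ys
  cycle-injective 2≤xs 2≤ys sx sy eq = sorted-≡ sx sy
    (cycle-support 2≤xs (sorted⇒unique sx) eq)
    (cycle-support 2≤ys (sorted⇒unique sy) (sym ∘ eq))

  ends : Cut A → List A
  ends (as , t) = map proj₂ as

  flatten : List (Piece A) → List A → List A
  flatten []              t = t
  flatten ((is , e) ∷ as) t = is ++ e ∷ flatten as t

  cuts-suc : ∀ k x (xs : List A) {cut} → cut ∈ cuts (suc k) (x ∷ xs) →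
             (∃ λ cut′ → cut′ ∈ cuts k xs × cut ≡ newPiece x cut′) ⊎
             (∃ λ cut′ → cut′ ∈ cuts (suc k) xs × cut ≡ extend x cut′)
  cuts-suc k x xs cut∈ with ∈-++⁻ (map (newPiece x) (cuts k xs)) cut∈
  ... | inj₁ p = inj₁ (∈-map⁻ _ p)
  ... | inj₂ p = inj₂ (∈-map⁻ _ p)

  cuts-length : ∀ k (xs : List A) {as t} → (as , t) ∈ cuts k xs → length as ≡ k
  cuts-length zero    xs       (here refl) = refl
  cuts-length (suc k) (x ∷ xs) cut∈ with cuts-suc k x xs cut∈
  ... | inj₁ (_ , p , refl)         = cong suc (cuts-length k xs p)
  ... | inj₂ ((_ ∷ _ , _) , p , refl) = cuts-length (suc k) xs p
  ... | inj₂ (([] , _) , p , refl)    = cuts-length (suc k) xs p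

  cuts-flatten : ∀ k (xs : List A) {as t} → (as , t) ∈ cuts k xs → flatten as t ≡ xs
  cuts-flatten zero    xs       (here refl) = refl
  cuts-flatten (suc k) (x ∷ xs) cut∈ with cuts-suc k x xs cut∈
  ... | inj₁ (_ , p , refl)         = cong (x ∷_) (cuts-flatten k xs p)
  ... | inj₂ ((_ ∷ _ , _) , p , refl) = cong (x ∷_) (cuts-flatten (suc k) xs p)
  ... | inj₂ (([] , _) , p , refl) with () ← cuts-length (suc k) xs p

  flatten-tail : ∀ (as : List (Piece A)) {t} → t ⊆ flatten as t
  flatten-tail []              = ⊆-refl
  flatten-tail ((is , e) ∷ as) = Sublist.++⁺ˡ is (e Sublist.∷ʳ flatten-tail as)

  flatten-ends : ∀ (as : List (Piece A)) {t} → map proj₂ as ⊆ flatten as t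
  flatten-ends []              = Sublist.minimum _
  flatten-ends ((is , e) ∷ as) = Sublist.++⁺ˡ is (refl ∷ flatten-ends as)

  ends-⊆ : ∀ k (xs : List A) {cut} → cut ∈ cuts k xs → ends cut ⊆ xs
  ends-⊆ k xs {as , t} cut∈ = subst (_ ⊆_) (cuts-flatten k xs cut∈) (flatten-ends as)

  ends-extend : ∀ (x : A) cut → ends (extend x cut) ≡ ends cut
  ends-extend x ([] , _)    = refl
  ends-extend x (_ ∷ _ , _) = refl

  ends-length : ∀ k (xs : List A) {cut} → cut ∈ cuts k xs → length (ends cut) ≡ k
  ends-length k xs {as , _} cut∈ = trans (length-map proj₂ as) (cuts-length k xs cut∈)

  ends-unique : ∀ k {xs : List A} → Unique xs → Unique (map ends (cuts k xs))
  ends-unique zero    u = [] ∷ []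
  ends-unique (suc k) {[]}     u = []
  ends-unique (suc k) {x ∷ xs} (x≢ ∷ u) = subst Unique (sym (map-++ ends (map (newPiece x) (cuts k xs)) _))
    (Unique.++⁺
      (subst Unique (trans (sym (map-∘ (cuts k xs))) (map-∘ (cuts k xs)))
        (Unique.map⁺ (∷-injectiveʳ {x = x}) (ends-unique k u)))
      (subst Unique (trans (map-cong (sym ∘ ends-extend x) (cuts (suc k) xs)) (map-∘ (cuts (suc k) xs)))
        (ends-unique (suc k) u))
      disjoint)
    where
    disjoint : Disjoint (map ends (map (newPiece x) (cuts k xs))) (map ends (map (extend x) (cuts (suc k) xs)))
    disjoint (p , q) with ∈-map⁻ ends p | ∈-map⁻ ends q
    ... | _ , p₁ , refl | _ , q₁ , eq with ∈-map⁻ _ p₁ | ∈-map⁻ _ q₁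
    ...   | _ , _ , refl | cut , q₂ , refl = unique-∉ x≢ (Sublist.lookup
              (ends-⊆ (suc k) xs q₂) (subst (x ∈_) (trans eq (ends-extend x cut)) (here refl)))

  cuts-filter : ∀ {P : A → Set} (P? : Decidable P) xs →
                ∃ λ cut → cut ∈ cuts (length (filter P? xs)) xs × ends cut ≡ filter P? xs
  cuts-filter P? []       = _ , here refl , refl
  cuts-filter P? (x ∷ xs) with cuts-filter P? xs | P? x
  ... | cut , cut∈ , eq | yes px =
    newPiece x cut , ∈-++⁺ˡ (∈-map⁺ (newPiece x) cut∈) , cong (x ∷_) eq
  ... | cut , cut∈ , eq | no ¬px with filter P? xs
  ...   | []     = _ , here refl , refl
  ...   | y ∷ ys = extend x cut ,
    ∈-++⁺ʳ (map (newPiece x) (cuts (length ys) xs)) (∈-map⁺ (extend x) cut∈) , trans (ends-extend x cut) eq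

  unique-++-disjoint : ∀ (xs : List A) {ys} → Unique (xs ++ ys) → ∀ {t} → t ∈ xs → t ∉ ys
  unique-++-disjoint (x ∷ xs) (x≢ ∷ u) (here refl) t∈ = unique-∉ x≢ (∈-++⁺ʳ xs t∈)
  unique-++-disjoint (x ∷ xs) (x≢ ∷ u) (there t∈)  t∈′ = unique-++-disjoint xs u t∈ t∈′

  unique-++ʳ : ∀ (xs : List A) {ys} → Unique (xs ++ ys) → Unique ys
  unique-++ʳ xs = AllPairs-⊆ (Sublist.++⁺ˡ xs ⊆-refl)

  unique-++ˡ : ∀ (xs : List A) {ys} → Unique (xs ++ ys) → Unique xs
  unique-++ˡ xs = AllPairs-⊆ (Sublist.++⁺ʳ _ ⊆-refl)

  Fixed : (A → A) → A → Set
  Fixed z t = z t ≡ t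

  module _ {u z w : Fin n → Fin n} (uz≗w : ∀ t → u (z t) ≡ w t) where

    fixed-step : ∀ {t s} → Fixed z t → w t ≡ s → u t ≡ s
    fixed-step fix eq = trans (cong u (sym fix)) (trans (uz≗w _) eq)

    run-fixed : ∀ xs {y} → All (Fixed z) xs → Run w xs y → Run u xs y
    run-fixed []       _         _       = tt
    run-fixed (x ∷ xs) (fx ∷ fs) (p , r) = fixed-step fx p , run-fixed xs fs r

    cyclic-fixed : ∀ xs → All (Fixed z) xs → Cyclic w xs → Cyclic u xs
    cyclic-fixed (x ∷ xs) = run-fixed (x ∷ xs)

    run-rejoin : ∀ is {e rest y ys h} → All (Fixed z) is → Run w (is ++ e ∷ rest) y →
                 Run u (e ∷ ys) h → Run u (is ++ e ∷ ys) h
    run-rejoin []            _         _       r′ = r′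
    run-rejoin (i ∷ [])      (fi ∷ _)  (p , r) r′ = fixed-step fi p , r′
    run-rejoin (i ∷ i′ ∷ is) (fi ∷ fs) (p , r) r′ = fixed-step fi p , run-rejoin (i′ ∷ is) fs r r′

    pieces-cyclic : ∀ as {t e f y} → Run w (flatten as t) y → w e ≡ headOr y (flatten as t) →
      z e ≡ headOr f (map proj₂ as) → Run z (map proj₂ as) f →
      All (All (Fixed z) ∘ proj₁) as → All (Fixed z) t →
      All (Cyclic u) (map pieceBlock as) × Run u t y × u f ≡ headOr y t
    pieces-cyclic [] {t} r eq ze≡f _ _ ft = [] , run-fixed t ft r , trans (cong u (sym ze≡f)) (trans (uz≗w _) eq)
    pieces-cyclic ((is , e′) ∷ as) {t} {e} {y = y} r eq ze≡e′ (p , rz) (fi ∷ fs) ft =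
      let c , rest = pieces-cyclic as (proj₂ (run-suffix is r)) (proj₁ (run-suffix is r)) p rz fs ft
      in piece is refl ∷ c , rest
      where
      ue′ : u e′ ≡ headOr y (is ++ e′ ∷ flatten as t)
      ue′ = trans (cong u (sym ze≡e′)) (trans (uz≗w e) eq)

      piece : ∀ js → js ≡ is → Cyclic u (js ++ e′ ∷ [])
      piece []       refl = ue′ , tt
      piece (j ∷ js) refl = run-rejoin (j ∷ js) fi r (ue′ , tt)

    cutBlocks-cyclic : ∀ as t → Cyclic w (flatten as t) → Cyclic z (map proj₂ as) →
      All (All (Fixed z) ∘ proj₁) as → All (Fixed z) t → All (Cyclic u) (cutBlocks (as , t))
    cutBlocks-cyclic []              t _ _        _         _  = []
    cutBlocks-cyclic ((is , e) ∷ as) t c (p , rz) (fi ∷ fs) ft = first is refl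
      where
      first : ∀ js → js ≡ is → All (Cyclic u) (cutBlocks ((js , e) ∷ as , t))
      first [] refl =
        let c′ , rt , eq = pieces-cyclic as (proj₂ c) (proj₁ c) p rz fs ft in (eq , rt) ∷ c′
      first (j ∷ js) refl =
        let c′ , rt , eq = pieces-cyclic as (proj₂ (run-suffix (j ∷ js) c)) (proj₁ (run-suffix (j ∷ js) c)) p rz fs ft
        in run-rejoin (j ∷ js) fi c (eq , rt) ∷ c′

  inner-fixed : ∀ {z : A → A} as {t} → Unique (flatten as t) →
    (∀ {s} → s ∈ flatten as t → s ∉ map proj₂ as → Fixed z s) →
    All (All (Fixed z) ∘ proj₁) as × All (Fixed z) t
  inner-fixed {z = z} []              u fix = [] , All.tabulate λ s∈ → fix s∈ λ ()
  inner-fixed {z = z} ((is , e) ∷ as) {t} u fix =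
    let fs , ft = inner-fixed as (AllPairs.tail (unique-++ʳ is u)) rest in first ∷ fs , ft
    where
    first : All (Fixed z) is
    first = All.tabulate λ s∈ → fix (∈-++⁺ˡ s∈) λ where
      (here refl) → unique-++-disjoint is u s∈ (here refl)
      (there s∈′) → unique-++-disjoint is u s∈ (there (Sublist.lookup (flatten-ends as) s∈′))

    rest : ∀ {s} → s ∈ flatten as t → s ∉ map proj₂ as → Fixed z s
    rest s∈ s∉ = fix (∈-++⁺ʳ is (there s∈)) λ where
      (here refl) → unique-∉ (AllPairs.head (unique-++ʳ is u)) s∈
      (there s∈′) → s∉ s∈′

  moves : ℕ → List (List A) → List (Cut A × List (List A))
  moves k []       = []
  moves k (b ∷ bs) =
    map (λ cut → cut , cutBlocks cut ++ bs) (cuts k b) ++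
    map (λ (cut , bs′) → cut , b ∷ bs′) (moves k bs)

  moves⁻ : ∀ k (bs : List (List A)) {cut bs′} → (cut , bs′) ∈ moves k bs →
           ∃ λ pre → ∃₂ λ b post →
           bs ≡ pre ++ b ∷ post × bs′ ≡ pre ++ cutBlocks cut ++ post × cut ∈ cuts k b
  moves⁻ k (b ∷ bs) mv∈ with ∈-++⁻ (map _ (cuts k b)) mv∈
  ... | inj₁ p with ∈-map⁻ _ p
  ...   | cut , cut∈ , refl = [] , b , bs , refl , refl , cut∈
  moves⁻ k (b ∷ bs) mv∈ | inj₂ p with ∈-map⁻ _ p
  ... | _ , mv∈′ , refl with moves⁻ k bs mv∈′
  ...   | pre , b′ , post , refl , refl , cut∈ = b ∷ pre , b′ , post , refl , refl , cut∈

  moves⁺ : ∀ k pre (b : List A) post {cut} → cut ∈ cuts k b →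
           (cut , pre ++ cutBlocks cut ++ post) ∈ moves k (pre ++ b ∷ post)
  moves⁺ k []        b post cut∈ = ∈-++⁺ˡ (∈-map⁺ _ cut∈)
  moves⁺ k (c ∷ pre) b post cut∈ = ∈-++⁺ʳ (map _ (cuts k c)) (∈-map⁺ _ (moves⁺ k pre b post cut∈))

  ends-inhabited : ∀ k (b : List A) {cut} → cut ∈ cuts (suc k) b → ∃ λ e → e ∈ ends cut
  ends-inhabited k b {cut} cut∈ with ends cut | ends-length (suc k) b {cut} cut∈
  ... | e ∷ _ | _ = e , here refl

  moves-ends-unique : ∀ k (bs : List (List A)) → Unique (concat bs) →
                      Unique (map (ends ∘ proj₁) (moves (suc k) bs))
  moves-ends-unique k []       u = []
  moves-ends-unique k (b ∷ bs) u =
    subst Unique (sym (map-++ (ends ∘ proj₁) (map (λ cut → cut , cutBlocks cut ++ bs) (cuts (suc k) b)) _))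
      (Unique.++⁺ (subst Unique (map-∘ (cuts (suc k) b)) (ends-unique (suc k) (unique-++ˡ b u)))
        (subst Unique (map-∘ (moves (suc k) bs)) (moves-ends-unique k bs (unique-++ʳ b u)))
        disjoint)
    where
    disjoint : Disjoint (map (ends ∘ proj₁) (map (λ cut → cut , cutBlocks cut ++ bs) (cuts (suc k) b)))
                        (map (ends ∘ proj₁) (map (λ (cut , bs′) → cut , b ∷ bs′) (moves (suc k) bs)))
    disjoint (p , q) with ∈-map⁻ _ p | ∈-map⁻ _ q
    ... | _ , p₁ , refl | _ , q₁ , eq with ∈-map⁻ _ p₁ | ∈-map⁻ _ q₁
    ...   | cut , cut∈ , refl | (cut′ , _) , mv∈ , refl with moves⁻ (suc k) bs mv∈ | ends-inhabited k b cut∈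
    ...     | pre , b′ , post , refl , _ , cut∈′ | e , e∈ = unique-++-disjoint b u
      (Sublist.lookup (ends-⊆ (suc k) b cut∈) e∈)
      (∈-concat⁺′ (Sublist.lookup (ends-⊆ (suc k) b′ cut∈′) (subst (e ∈_) eq e∈))
                  (∈-++⁺ʳ pre (here refl)))

  record Decomposition (w : Fin n → Fin n) (bs : List (List (Fin n))) : Set where
    field
      cover  : concat bs ↭ allFin n
      sorted : All Sorted bs
      cyclic : All (Cyclic w) bs

    unique : Unique (concat bs)
    unique = unique-resp-↭ (↭-sym cover) (Unique.allFin⁺ n)

  pieces-⊆ : ∀ (as : List (Piece A)) {t b} → b ∈ map pieceBlock as → b ⊆ flatten as t
  pieces-⊆ ((is , e) ∷ as) (here refl) = Sublist.++⁺ ⊆-refl (refl ∷ Sublist.minimum _)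
  pieces-⊆ ((is , e) ∷ as) (there b∈)  = Sublist.++⁺ˡ is (e Sublist.∷ʳ pieces-⊆ as b∈)

  cutBlocks-⊆ : ∀ (as : List (Piece A)) {t b} → b ∈ cutBlocks (as , t) → b ⊆ flatten as t
  cutBlocks-⊆ ((is , e) ∷ as) (here refl) = Sublist.++⁺ ⊆-refl (refl ∷ flatten-tail as)
  cutBlocks-⊆ ((is , e) ∷ as) (there b∈)  = Sublist.++⁺ˡ is (e Sublist.∷ʳ pieces-⊆ as b∈)

  flatten-pieces : ∀ (as : List (Piece A)) {t} → concat (map pieceBlock as) ++ t ≡ flatten as t
  flatten-pieces []              = refl
  flatten-pieces ((is , e) ∷ as) {t} =
    trans (cong (_++ t) (++-assoc is (e ∷ []) (concat (map pieceBlock as))))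
      (trans (++-assoc is _ t) (cong (λ xs → is ++ e ∷ xs) (flatten-pieces as)))

  cutBlocks-↭ : ∀ (p : Piece A) as {t} → concat (cutBlocks (p ∷ as , t)) ↭ flatten (p ∷ as) t
  cutBlocks-↭ (is , e) as {t} =
    ↭-trans (↭-reflexive (++-assoc is (e ∷ t) _))
      (++⁺ˡ is (prep e (↭-trans (++-comm t _) (↭-reflexive (flatten-pieces as)))))

  concat-split : ∀ (pre : List (List A)) b post → concat (pre ++ b ∷ post) ≡ concat pre ++ b ++ concat post
  concat-split pre b post = sym (concat-++ pre (b ∷ post))

  refine : ∀ {u w : Fin n → Fin n} {z : Permutation′ n} k {bs cut bs′} → Decomposition w bs →
           (cut , bs′) ∈ moves (suc k) bs → (∀ t → u (z ⟨$⟩ʳ t) ≡ w t) →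
           (∀ t → z ⟨$⟩ʳ t ≡ cycle (ends cut) ⟨$⟩ʳ t) →
           Decomposition u bs′ × length bs′ ≡ k ℕ.+ length bs
  refine {u = u} {w} {z} k {bs} {cut} D mv∈ uz≗w z≗ with moves⁻ (suc k) bs mv∈
  ... | pre , b , post , refl , refl , cut∈ with cut | cuts-flatten (suc k) b cut∈ | cuts-length (suc k) b cut∈ | ends-⊆ (suc k) b cut∈
  ...   | p ∷ as , t | refl | refl | ends⊆b = record
    { cover  = ↭-trans (↭-reflexive (trans (sym (concat-++ pre (cutBlocks (p ∷ as , t) ++ post)))
                   (cong (concat pre ++_) (sym (concat-++ (cutBlocks (p ∷ as , t)) post)))))
                 (↭-trans (++⁺ˡ (concat pre) (++⁺ʳ (concat post) (cutBlocks-↭ p as)))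
                   (↭-trans (↭-reflexive (concat-++ pre (b ∷ post))) D.cover))
    ; sorted = All.++⁺ (All.++⁻ˡ pre D.sorted) (All.++⁺
                 (All.tabulate λ c∈ → AllPairs-⊆ (cutBlocks-⊆ (p ∷ as) c∈) (All.lookup D.sorted b∈))
                 (All.tail (All.++⁻ʳ pre D.sorted)))
    ; cyclic = All.++⁺ (All.tabulate λ c∈ → others (∈-++⁺ˡ c∈) (λ s∈ → unique-++-disjoint (concat pre) uniq (∈-concat⁺′ s∈ c∈) ∘ ∈-++⁺ˡ))
        (All.++⁺ (cutBlocks-cyclic {u = u} {z = z ⟨$⟩ʳ_} {w = w} uz≗w (p ∷ as) t (All.lookup D.cyclic b∈)
                   (cyclic-cong (ends (p ∷ as , t)) (λ {s} _ → sym (z≗ s))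
                     (cycle-cyclic (proj₂ p) (map proj₂ as) (AllPairs-⊆ ends⊆b unique-b)))
                   (proj₁ inner) (proj₂ inner))
                 (All.tabulate λ c∈ → others (∈-++⁺ʳ pre (there c∈))
                   (λ s∈ s∈b → unique-++-disjoint b (unique-++ʳ (concat pre) uniq) s∈b (∈-concat⁺′ s∈ c∈))))
    } , (begin
      length (pre ++ cutBlocks (p ∷ as , t) ++ post)
        ≡⟨ trans (length-++ pre) (cong (length pre ℕ.+_) (length-++ (cutBlocks (p ∷ as , t)))) ⟩
      length pre ℕ.+ (suc (length (map pieceBlock as)) ℕ.+ length post)
        ≡⟨ cong (λ l → length pre ℕ.+ (suc l ℕ.+ length post)) (length-map pieceBlock as) ⟩
      length pre ℕ.+ (suc (length as) ℕ.+ length post)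
        ≡⟨ x∙yz≈y∙xz (length pre) (suc (length as)) (length post) ⟩
      suc (length as) ℕ.+ (length pre ℕ.+ length post)
        ≡⟨ ℕ.+-suc (length as) _ ⟨
      length as ℕ.+ suc (length pre ℕ.+ length post)
        ≡⟨ cong (length as ℕ.+_) (ℕ.+-suc (length pre) (length post)) ⟨
      length as ℕ.+ (length pre ℕ.+ suc (length post))
        ≡⟨ cong (length as ℕ.+_) (length-++ pre) ⟨
      length as ℕ.+ length (pre ++ b ∷ post) ∎)
    where
    open ≡-Reasoning
    module D = Decomposition D
    open import Algebra.Properties.CommutativeSemigroup ℕ.+-commutativeSemigroup using (x∙yz≈y∙xz)

    b∈ : b ∈ pre ++ b ∷ post
    b∈ = ∈-++⁺ʳ pre (here refl)

    uniq : Unique (concat pre ++ b ++ concat post)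
    uniq = subst Unique (concat-split pre b post) D.unique

    unique-b : Unique b
    unique-b = unique-++ˡ b (unique-++ʳ (concat pre) uniq)

    fixes : ∀ {s} → s ∉ ends (p ∷ as , t) → z ⟨$⟩ʳ s ≡ s
    fixes {s} s∉ = trans (z≗ s) (cycle-fixes (ends (p ∷ as , t)) s∉)

    inner : All (All (Fixed (z ⟨$⟩ʳ_)) ∘ proj₁) (p ∷ as) × All (Fixed (z ⟨$⟩ʳ_)) t
    inner = inner-fixed (p ∷ as) unique-b (λ _ → fixes)

    others : ∀ {c} → c ∈ pre ++ b ∷ post → (∀ {s} → s ∈ c → s ∉ b) → Cyclic u c
    others c∈ disj = cyclic-fixed {u = u} {z = z ⟨$⟩ʳ_} {w = w} uz≗w _
      (All.tabulate λ s∈ → fixes (disj s∈ ∘ Sublist.lookup ends⊆b)) (All.lookup D.cyclic c∈)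

  data Product {n} : List ℕ → (Fin n → Fin n) → Set where
    nil  : ∀ {w} → (∀ t → w t ≡ t) → Product [] w
    cons : ∀ {k ks u w} (z : Permutation′ n) → IsCycle (suc k) z → Product ks u →
           (∀ t → u (z ⟨$⟩ʳ t) ≡ w t) → Product (k ∷ ks) w

  module _ {M} {x y : Fin (suc M)} (x≢y : x ≢ y) where

    collapse : Fin (suc M) → Fin M
    collapse t with y ≟ t
    ... | yes _  = punchOut {i = y} {x} (x≢y ∘ sym)
    ... | no y≢t = punchOut y≢t

    collapse-≡ : collapse y ≡ collapse x
    collapse-≡ with y ≟ y | y ≟ x
    ... | yes _  | yes y≡x = contradiction (sym y≡x) x≢y
    ... | yes _  | no _    = punchOut-cong y refl
    ... | no y≢y | _       = contradiction refl y≢y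

    collapse-onto : ∀ j → ∃ λ i → collapse i ≡ j
    collapse-onto j = punchIn y j , eq
      where
      eq : collapse (punchIn y j) ≡ j
      eq with y ≟ punchIn y j
      ... | yes p = contradiction (sym p) (punchInᵢ≢i y j)
      ... | no _  = trans (punchOut-cong y refl) (punchOut-punchIn y)

  -- Identifying the elements of a list lowers the number of classes by at most
  -- the length of the tail, with equality only if the elements are distinct.
  merge : ∀ (x : Fin N) (ys : Vec (Fin N) k) → ∃ λ N′ → ∃ λ (q : Fin N → Fin N′) →
    (∀ j → ∃ λ i → q i ≡ j) × (∀ i → q (lookup (x ∷ ys) i) ≡ q x) × N ℕ.≤ N′ + k ×
    (N′ + k ℕ.≤ N → ∀ i j → lookup (x ∷ ys) i ≡ lookup (x ∷ ys) j → i ≡ j)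
  merge {N} x [] = N , id , (λ j → j , refl) , (λ { zero → refl }) , ℕ.m≤m+n N 0 , λ { _ zero zero _ → refl }
  merge {N} {suc k} x (y ∷ ys) with x ≟ y
  ... | yes refl =
    let N′ , q , onto , same , N≤ , _ = merge x ys
        N< = subst (suc N ℕ.≤_) (sym (ℕ.+-suc N′ k)) (ℕ.s≤s N≤)
    in N′ , q , onto , (λ { zero → refl ; (suc i) → same i }) , ℕ.<⇒≤ N< ,
       λ ≤N → contradiction ≤N (ℕ.<⇒≱ N<)
  merge {suc M} {suc k} x (y ∷ ys) | no x≢y =
    let c = collapse x≢y
        N′ , q , onto , same , M≤ , inj = merge (c x) (Vec.map c ys)
    in N′ , q ∘ c ,
       (λ j → let i , qi = onto j ; i′ , ci = collapse-onto x≢y i in i′ , trans (cong q ci) qi) ,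
       (λ { zero → refl
          ; (suc zero) → cong q (collapse-≡ x≢y)
          ; (suc (suc i)) → trans (cong q (sym (lookup-map i c ys))) (same (suc i)) }) ,
       subst (suc M ℕ.≤_) (sym (ℕ.+-suc N′ k)) (ℕ.s≤s M≤) ,
       λ ≤N → distinct (inj (ℕ.≤-pred (subst (ℕ._≤ suc M) (ℕ.+-suc N′ k) ≤N)))
    where
    distinct : let c = collapse x≢y in
      (∀ i j → lookup (c x ∷ Vec.map c ys) i ≡ lookup (c x ∷ Vec.map c ys) j → i ≡ j) →
      ∀ i j → lookup (x ∷ y ∷ ys) i ≡ lookup (x ∷ y ∷ ys) j → i ≡ j
    distinct inj = go
      where
      c = collapse x≢y

      ≢-tail : ∀ v → c v ≡ c x → ∀ j → v ≢ lookup ys j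
      ≢-tail v cv j v≡ with () ← inj zero (suc j)
        (trans (sym cv) (trans (cong c v≡) (sym (lookup-map j c ys))))

      go : ∀ i j → lookup (x ∷ y ∷ ys) i ≡ lookup (x ∷ y ∷ ys) j → i ≡ j
      go zero          zero          _  = refl
      go zero          (suc zero)    eq = contradiction eq x≢y
      go zero          (suc (suc j)) eq = contradiction eq (≢-tail x refl j)
      go (suc zero)    zero          eq = contradiction (sym eq) x≢y
      go (suc zero)    (suc zero)    _  = refl
      go (suc zero)    (suc (suc j)) eq = contradiction eq (≢-tail y (collapse-≡ x≢y) j)
      go (suc (suc i)) zero          eq = contradiction (sym eq) (≢-tail x refl i)
      go (suc (suc i)) (suc zero)    eq = contradiction (sym eq) (≢-tail y (collapse-≡ x≢y) i)
      go (suc (suc i)) (suc (suc j)) eq = cong suc (inj (suc i) (suc j)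
        (trans (lookup-map i c ys) (trans (cong c eq) (sym (lookup-map j c ys)))))

  record Classes (u : Fin n → Fin n) (N : ℕ) : Set where
    field
      class     : Fin n → Fin N
      onto      : ∀ j → ∃ λ i → class i ≡ j
      invariant : ∀ t → class (u t) ≡ class t

  module _ {u w : Fin n → Fin n} {N} (C : Classes u N) (z : Permutation′ n)
           (cyc : IsCycle (suc k) z) (uz≗w : ∀ t → u (z ⟨$⟩ʳ t) ≡ w t) where

    open Classes C

    private
      x = proj₁ cyc

      merged = merge (class (lookup x zero)) (Vec.map class (Vec.tail x))

      lookup-x : ∀ i → lookup (class (lookup x zero) ∷ Vec.map class (Vec.tail x)) i ≡ class (lookup x i)
      lookup-x i with proj₁ cyc | i
      ... | y ∷ ys | zero   = refl
      ... | y ∷ ys | suc i′ = lookup-map i′ class ys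

    mergedCount : ℕ
    mergedCount = proj₁ merged

    mergedCount-≥ : N ℕ.≤ mergedCount + k
    mergedCount-≥ = proj₁ (proj₂ (proj₂ (proj₂ (proj₂ merged))))

    mergedClasses : Classes w mergedCount
    mergedClasses = record
      { class     = q ∘ class
      ; onto      = λ j → let i , qi = proj₁ (proj₂ (proj₂ merged)) j ; t , ct = onto i in t , trans (cong q ct) qi
      ; invariant = λ t → trans (cong (q ∘ class) (sym (uz≗w t))) (trans (cong q (invariant _)) (z-invariant t))
      }
      where
      q = proj₁ (proj₂ merged)

      z-invariant : ∀ t → q (class (z ⟨$⟩ʳ t)) ≡ q (class t)
      z-invariant t with any? (λ i → lookup x i ≟ t)
      ... | no t∉          = cong (q ∘ class) (proj₂ (proj₂ (proj₂ cyc)) t t∉)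
      ... | yes (i , refl) = trans (cong (q ∘ class) (proj₁ (proj₂ (proj₂ cyc)) i)) (trans (same (next i)) (sym (same i)))
        where
        same : ∀ i → q (class (lookup x i)) ≡ q (class (lookup x zero))
        same i = trans (cong q (sym (lookup-x i))) (proj₁ (proj₂ (proj₂ (proj₂ merged))) i)

    merged-same : ∀ i j → Classes.class mergedClasses (lookup x i) ≡ Classes.class mergedClasses (lookup x j)
    merged-same i j = trans (same i) (sym (same j))
      where
      q = proj₁ (proj₂ merged)
      same : ∀ i → q (class (lookup x i)) ≡ q (class (lookup x zero))
      same i = trans (cong q (sym (lookup-x i))) (proj₁ (proj₂ (proj₂ (proj₂ merged))) i)

    merged-distinct : mergedCount + k ℕ.≤ N → ∀ i j → class (lookup x i) ≡ class (lookup x j) → i ≡ j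
    merged-distinct ≤N i j eq = proj₂ (proj₂ (proj₂ (proj₂ (proj₂ merged)))) ≤N i j
      (trans (lookup-x i) (trans eq (sym (lookup-x j))))

  product-classes : ∀ {ks} {u : Fin n → Fin n} → Product ks u → ∃ λ N → Classes u N × n ℕ.≤ N + sum ks
  product-classes {n} (nil eq) = n , record { class = id ; onto = λ j → j , refl ; invariant = eq } , ℕ.m≤m+n n 0
  product-classes {n} (cons {k} {ks} z cyc p uz≗w) =
    let N , C , n≤ = product-classes p
        N′ = mergedCount C z cyc uz≗w
    in N′ , mergedClasses C z cyc uz≗w ,
       ℕ.≤-trans n≤ (subst (N + sum ks ℕ.≤_) (ℕ.+-assoc N′ k (sum ks)) (ℕ.+-monoˡ-≤ (sum ks) (mergedCount-≥ C z cyc uz≗w)))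

  run-class : ∀ {w : Fin n → Fin n} {f : Fin n → A} → (∀ t → f (w t) ≡ f t) →
              ∀ xs {y} → Run w xs y → f (headOr y xs) ≡ f y × (∀ {t} → t ∈ xs → f t ≡ f y)
  run-class inv []       _       = refl , λ ()
  run-class {f = f} inv (x ∷ xs) (p , r) =
    let eq , eqs = run-class inv xs r
        fx = trans (sym (inv x)) (trans (cong f p) eq)
    in fx , λ { (here refl) → fx ; (there t∈) → eqs t∈ }

  cyclic-class : ∀ {w : Fin n → Fin n} {f : Fin n → A} → (∀ t → f (w t) ≡ f t) →
                 ∀ {xs d} → Cyclic w xs → ∀ {t} → t ∈ xs → f t ≡ f (headOr d xs)
  cyclic-class inv {x ∷ xs} c = proj₂ (run-class inv (x ∷ xs) c)

  cover-≤ : ∀ (vs : List (Fin N)) → (∀ j → j ∈ vs) → N ℕ.≤ length vs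
  cover-≤ vs cover = injective⇒≤ {f = Any.index ∘ cover} λ {i} {j} eq →
    trans (lookup-index (cover i)) (trans (cong (List.lookup vs) eq) (sym (lookup-index (cover j))))

  cover-unique : ∀ (us vs : List (Fin N)) → (∀ j → j ∈ us ++ vs) → length (us ++ vs) ℕ.≤ N → Unique vs
  cover-unique us []       cover ≤N = []
  cover-unique {N} us (v ∷ vs) cover ≤N =
    ∉-unique v∉ ∷ cover-unique (v ∷ us) vs cover′ (subst (ℕ._≤ N) shorter ≤N)
    where
    shorter : length (us ++ v ∷ vs) ≡ suc (length (us ++ vs))
    shorter = trans (length-++ us) (trans (ℕ.+-suc (length us) (length vs)) (cong suc (sym (length-++ us))))

    cover′ : ∀ j → j ∈ v ∷ us ++ vs
    cover′ j with ∈-++⁻ us (cover j)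
    ... | inj₁ j∈         = there (∈-++⁺ˡ j∈)
    ... | inj₂ (here eq)  = here eq
    ... | inj₂ (there j∈) = there (∈-++⁺ʳ us j∈)

    v∉ : v ∉ vs
    v∉ v∈ = ℕ.<⇒≱ (subst (ℕ._≤ N) shorter ≤N) (cover-≤ (us ++ vs) λ j → drop j (cover′ j))
      where
      drop : ∀ j → j ∈ v ∷ us ++ vs → j ∈ us ++ vs
      drop j (here refl) = ∈-++⁺ʳ us v∈
      drop j (there j∈)  = j∈

  unique-lookup : ∀ {xs : List A} → Unique xs → ∀ i j → List.lookup xs i ≡ List.lookup xs j → i ≡ j
  unique-lookup {xs = x ∷ xs} u zero zero _ = refl
  unique-lookup {xs = x ∷ xs} (x≢ ∷ u) zero (suc j) eq = contradiction eq (All.lookup x≢ (∈-lookup j))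
  unique-lookup {xs = x ∷ xs} (x≢ ∷ u) (suc i) zero eq = contradiction (sym eq) (All.lookup x≢ (∈-lookup i))
  unique-lookup {xs = x ∷ xs} (_ ∷ u) (suc i) (suc j) eq = cong suc (unique-lookup u i j eq)

  enumeration-length : ∀ (f : Fin k → A) {xs} → (∀ i j → f i ≡ f j → i ≡ j) → Unique xs →
                       (∀ i → f i ∈ xs) → (∀ {t} → t ∈ xs → ∃ λ i → f i ≡ t) → length xs ≡ k
  enumeration-length f {xs} inj u f∈ onto = ℕ.≤-antisym
    (injective⇒≤ {f = λ i → proj₁ (onto (∈-lookup {xs = xs} i))} λ {i} {j} eq →
      unique-lookup u i j (trans (sym (proj₂ (onto (∈-lookup i)))) (trans (cong f eq) (proj₂ (onto (∈-lookup j))))))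
    (injective⇒≤ {f = Any.index ∘ f∈} λ {i} {j} eq →
      inj i j (trans (lookup-index (f∈ i)) (trans (cong (List.lookup xs) eq) (sym (lookup-index (f∈ j))))))

  -- If the classes separate the elements moved by z, then w = u z determines z
  -- on a cycle of w: following u from z t leads to the next such element.
  module _ {u z w : Fin n → Fin n} {S : Fin n → Set} {class : Fin n → A}
           (uz≗w : ∀ t → u (z t) ≡ w t) (invariant : ∀ t → class (u t) ≡ class t)
           (z-closed : ∀ {t} → S t → S (z t)) (separates : ∀ {s t} → S s → S t → class s ≡ class t → s ≡ t) where

    class-step : ∀ {s t} → Fixed z s → w s ≡ t → class s ≡ class t
    class-step fix eq = trans (sym (invariant _)) (cong class (fixed-step {u = u} {z = z} {w = w} uz≗w fix eq))

    class-inner : ∀ is {e rest y} → Run w (is ++ e ∷ rest) y → All (Fixed z) is →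
                  class (headOr y (is ++ e ∷ rest)) ≡ class e
    class-inner []       _       _        = refl
    class-inner (i ∷ is) (p , r) (f ∷ fs) = trans (class-step f p) (class-inner is r fs)

    class-tail : ∀ t {y} → Run w t y → All (Fixed z) t → class (headOr y t) ≡ class y
    class-tail []      _       _        = refl
    class-tail (i ∷ t) (p , r) (f ∷ fs) = trans (class-step f p) (class-tail t r fs)

    ends-run : ∀ as {t e f y} → Run w (flatten as t) y → w e ≡ headOr y (flatten as t) →
      S e → S f → class f ≡ class y → All S (map proj₂ as) → All (All (Fixed z) ∘ proj₁) as → All (Fixed z) t →
      z e ≡ headOr f (map proj₂ as) × Run z (map proj₂ as) f
    ends-run [] {t} {e} r eq Se Sf f~y _ _ ft = separates (z-closed Se) Sf
      (trans (sym (invariant (z e))) (trans (cong class (trans (uz≗w e) eq)) (trans (class-tail t r ft) (sym f~y)))) , _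
    ends-run ((is , e′) ∷ as) {e = e} r eq Se Sf f~y (Se′ ∷ Sas) (fi ∷ fs) ft =
      separates (z-closed Se) Se′
        (trans (sym (invariant (z e))) (trans (cong class (trans (uz≗w e) eq)) (class-inner is r fi))) ,
      ends-run as (proj₂ (run-suffix is r)) (proj₁ (run-suffix is r)) Se′ Sf f~y Sas fs ft

    ends-cyclic : ∀ a as {t} → Cyclic w (flatten (a ∷ as) t) → All S (map proj₂ (a ∷ as)) →
      All (All (Fixed z) ∘ proj₁) (a ∷ as) → All (Fixed z) t → Cyclic z (map proj₂ (a ∷ as))
    ends-cyclic ([] , e) as (p , r) (Se ∷ Sas) (_ ∷ fs) ft = ends-run as r p Se Se refl Sas fs ft
    ends-cyclic (i ∷ is , e) as c (Se ∷ Sas) (fi ∷ fs) ft =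
      ends-run as (proj₂ (run-suffix (i ∷ is) c)) (proj₁ (run-suffix (i ∷ is) c)) Se Se
        (sym (class-inner (i ∷ is) c fi)) Sas fs ft

  module _ {w : Fin n → Fin n} {bs : List (List (Fin n))} (D : Decomposition w bs) where
    open Decomposition D

    blockOf : ∀ t → ∃ λ b → t ∈ b × b ∈ bs
    blockOf t = ∈-concat⁻′ bs (∈-resp-↭ (↭-sym cover) (∈-allFin t))

  -- The factors of u generate at least l + k classes, where l is the number of
  -- cycles of w, while together with z they generate at most l. Hence z joins
  -- k + 1 different classes, all inside one cycle of w.
  minimal-cycle : ∀ {w u : Fin n → Fin n} {z : Permutation′ n} {ks bs} → Decomposition w bs →
    IsCycle (suc k) z → Product ks u → (∀ t → u (z ⟨$⟩ʳ t) ≡ w t) → k + sum ks + length bs ≡ n →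
    ∃ λ mv → mv ∈ moves (suc k) bs × (∀ t → z ⟨$⟩ʳ t ≡ cycle (ends (proj₁ mv)) ⟨$⟩ʳ t)
  minimal-cycle {n} {k} {w} {u} {z} {ks} {bs} D cyc@(x , x-inj , zx , z-fix) p uz≗w rank
    with N , C , n≤ ← product-classes p
    with b₀ , x₀∈ , b₀∈ ← blockOf D (lookup x zero)
    with pre , post , refl ← ∈-∃++ b₀∈ =
    let cut , cut∈ , eq = cuts-filter S? b₀
        cut∈′ = subst (λ l → cut ∈ cuts l b₀) count cut∈
    in _ , moves⁺ (suc k) pre b₀ post cut∈′ ,
       cyclic⇒cycle (AllPairs-⊆ (ends-⊆ (suc k) b₀ cut∈′) unique-b₀) (cyclic-ends cut cut∈′ eq)
         (λ t∉ → fixes λ St → t∉ (subst (_ ∈_) (sym eq) (∈-filter⁺ S? (S⊆b₀ St) St)))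
    where
    open Decomposition D
    open Classes C using (class; invariant)
    module C′ = Classes (mergedClasses C z cyc uz≗w)
    N′ = mergedCount C z cyc uz≗w
    l = length (pre ++ b₀ ∷ post)

    S : Fin n → Set
    S t = ∃ λ i → lookup x i ≡ t

    S? : ∀ t → Dec (S t)
    S? t = any? λ i → lookup x i ≟ t

    fixes : ∀ {t} → ¬ S t → z ⟨$⟩ʳ t ≡ t
    fixes = z-fix _

    blockClass : List (Fin n) → Fin N′
    blockClass b = C′.class (headOr (lookup x zero) b)

    blockClass-≡ : ∀ {b} → b ∈ pre ++ b₀ ∷ post → ∀ {t} → t ∈ b → C′.class t ≡ blockClass b
    blockClass-≡ b∈ = cyclic-class C′.invariant (All.lookup cyclic b∈)

    cover′ : ∀ j → j ∈ map blockClass (pre ++ b₀ ∷ post)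
    cover′ j with t , refl ← C′.onto j with b , t∈ , b∈ ← blockOf D t =
      subst (_∈ map blockClass (pre ++ b₀ ∷ post)) (sym (blockClass-≡ b∈ t∈)) (∈-map⁺ blockClass b∈)

    N′≤l : N′ ℕ.≤ l
    N′≤l = subst (N′ ℕ.≤_) (length-map blockClass (pre ++ b₀ ∷ post)) (cover-≤ _ cover′)

    l+k≤N : l + k ℕ.≤ N
    l+k≤N = ℕ.+-cancelʳ-≤ (sum ks) _ _ (subst (ℕ._≤ N + sum ks) (sym rearrange) n≤)
      where
      rearrange : l + k + sum ks ≡ n
      rearrange = trans (ℕ.+-assoc l k (sum ks)) (trans (ℕ.+-comm l _) rank)

    separates : ∀ i j → class (lookup x i) ≡ class (lookup x j) → i ≡ j
    separates = merged-distinct C z cyc uz≗w (ℕ.≤-trans (ℕ.+-monoˡ-≤ k N′≤l) l+k≤N)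

    l≤N′ : l ℕ.≤ N′
    l≤N′ = ℕ.+-cancelʳ-≤ k l N′ (ℕ.≤-trans l+k≤N (mergedCount-≥ C z cyc uz≗w))

    blockClasses-unique : Unique (map blockClass pre ++ blockClass b₀ ∷ map blockClass post)
    blockClasses-unique = subst Unique (map-++ blockClass pre (b₀ ∷ post))
      (cover-unique [] _ cover′ (subst (ℕ._≤ N′) (sym (length-map blockClass (pre ++ b₀ ∷ post))) l≤N′))

    S⊆b₀ : ∀ {t} → S t → t ∈ b₀
    S⊆b₀ (i , refl) with b , t∈ , b∈ ← blockOf D (lookup x i) = find (∈-++⁻ pre b∈)
      where
      same : blockClass b ≡ blockClass b₀
      same = trans (sym (blockClass-≡ b∈ t∈)) (trans (merged-same C z cyc uz≗w i zero) (blockClass-≡ b₀∈ x₀∈))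

      find : b ∈ pre ⊎ b ∈ b₀ ∷ post → lookup x i ∈ b₀
      find (inj₁ b∈pre)          = contradiction (here same)
        (unique-++-disjoint (map blockClass pre) blockClasses-unique (∈-map⁺ blockClass b∈pre))
      find (inj₂ (here refl))    = t∈
      find (inj₂ (there b∈post)) = contradiction
        (subst (_∈ map blockClass post) same (∈-map⁺ blockClass b∈post))
        (unique-∉ (AllPairs.head (unique-++ʳ (map blockClass pre) blockClasses-unique)))

    unique-b₀ : Unique b₀
    unique-b₀ = sorted⇒unique (All.lookup sorted b₀∈)

    count : length (filter S? b₀) ≡ suc k
    count = enumeration-length (lookup x) x-inj (AllPairs.filter⁺ S? unique-b₀)
      (λ i → ∈-filter⁺ S? (S⊆b₀ (i , refl)) (i , refl)) (proj₂ ∘ ∈-filter⁻ S? {xs = b₀})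

    cyclic-ends : ∀ cut → cut ∈ cuts (suc k) b₀ → ends cut ≡ filter S? b₀ → Cyclic (z ⟨$⟩ʳ_) (ends cut)
    cyclic-ends ([] , t) cut∈ eq with () ← cuts-length (suc k) b₀ cut∈
    cyclic-ends (a ∷ as , t) cut∈ eq = ends-cyclic {S = S} {class = class} uz≗w invariant
      (λ { (i , refl) → next i , sym (zx i) })
      (λ { (i , refl) (j , refl) eq → cong (lookup x) (separates i j eq) })
      a as (subst (Cyclic w) (sym flat) (All.lookup cyclic b₀∈))
      (All.tabulate λ e∈ → proj₂ (∈-filter⁻ S? {xs = b₀} (subst (_ ∈_) eq e∈)))
      (proj₁ inner) (proj₂ inner)
      where
      flat = cuts-flatten (suc k) b₀ cut∈

      inner = inner-fixed (a ∷ as) (subst Unique (sym flat) unique-b₀)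
        (λ s∈ s∉ → fixes λ Ss → s∉ (subst (_ ∈_) (sym eq) (∈-filter⁺ S? (subst (_ ∈_) flat s∈) Ss)))

  sorted-++ : ∀ (xs : List (Fin n)) {ys} → Sorted (xs ++ ys) → ∀ {s t} → s ∈ xs → t ∈ ys → s < t
  sorted-++ (x ∷ xs) (p ∷ _)  (here refl) t∈ = All.lookup p (∈-++⁺ʳ xs t∈)
  sorted-++ (x ∷ xs) (_ ∷ ps) (there s∈)  t∈ = sorted-++ xs ps s∈ t∈

  head-≤ : ∀ {xs : List (Fin n)} {d t} → Sorted xs → t ∈ xs → headOr d xs ≤ t
  head-≤ {xs = x ∷ xs} _       (here refl) = Fin.≤-refl {x = x}
  head-≤ {xs = x ∷ xs} (p ∷ _) (there t∈)  = ℕ.<⇒≤ (All.lookup p t∈)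

  headOr-∈ : ∀ {xs : List A} {d t} → t ∈ xs → headOr d xs ∈ xs
  headOr-∈ {xs = _ ∷ _} _ = here refl

  headOr-irrelevant : ∀ {xs : List A} {d d′ t} → t ∈ xs → headOr d xs ≡ headOr d′ xs
  headOr-irrelevant {xs = _ ∷ _} _ = refl

  σ-dichotomy : ∀ (π : SetPartition n) i →
                (i < σ π i × i ∼[ π ] σ π i) ⊎ (σ π i ≡ least π i × (∀ j → i < j → ¬ i ∼[ π ] j))
  σ-dichotomy {n} π i = go (filter P? (allFin n)) refl
    where
    P? : Decidable (λ j → i < j × i ∼[ π ] j)
    P? j = (i <? j) ×-dec (i ∼[ π ]? j)

    go : ∀ L → L ≡ filter P? (allFin n) →
         (i < fromMaybe (least π i) (List.head L) × i ∼[ π ] fromMaybe (least π i) (List.head L)) ⊎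
         (fromMaybe (least π i) (List.head L) ≡ least π i × (∀ j → i < j → ¬ i ∼[ π ] j))
    go []      eq = inj₂ (refl , λ j i<j i∼j → case-[] (subst (j ∈_) (sym eq) (∈-filter⁺ P? (∈-allFin j) (i<j , i∼j))))
      where
      case-[] : ∀ {j : Fin n} → ¬ j ∈ []
      case-[] ()
    go (j ∷ L) eq = inj₁ (proj₂ (∈-filter⁻ P? {xs = allFin n} (subst (j ∈_) eq (here refl))))

  least-≤ : ∀ (π : SetPartition n) i → least π i ≤ i
  least-≤ (partition v below _) i = recompute (lookup v i ≤? i) (below i)

  σ-injective : ∀ {π π′ : SetPartition n} → (∀ t → σ π t ≡ σ π′ t) → π ≡ π′
  σ-injective {π = π@(partition v _ _)} {π′@(partition v′ _ _)} eq = go v v′ vectors-≡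
    where
    least-≡ : ∀ i → Acc Fin._>_ i → least π i ≡ least π′ i
    least-≡ i (acc rec) with σ-dichotomy π i | σ-dichotomy π′ i
    ... | inj₁ (i<σ , i∼σ) | inj₁ (_ , i∼′σ) =
      trans i∼σ (trans (least-≡ _ (rec i<σ)) (trans (cong (least π′) (eq i)) (sym i∼′σ)))
    ... | inj₁ (i<σ , _) | inj₂ (σ≡ , _) = contradiction (least-≤ π′ i)
      (ℕ.<⇒≱ (subst (i <_) (trans (eq i) σ≡) i<σ))
    ... | inj₂ (σ≡ , _) | inj₁ (i<σ , _) = contradiction (least-≤ π i)
      (ℕ.<⇒≱ (subst (i <_) (trans (sym (eq i)) σ≡) i<σ))
    ... | inj₂ (p , _) | inj₂ (q , _) = trans (sym p) (trans (eq i) q)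

    vectors-≡ : v ≡ v′
    vectors-≡ = trans (sym (tabulate∘lookup v))
      (trans (tabulate-cong λ i → least-≡ i (>-wellFounded i)) (tabulate∘lookup v′))

    go : ∀ v v′ .{p} .{q} .{p′} .{q′} → v ≡ v′ → partition v p q ≡ partition v′ p′ q′
    go v .v refl = refl

  head-filter : ∀ {P : Fin n → Set} (P? : Decidable P) {xs y} → Sorted xs → y ∈ xs → P y →
                (∀ {t} → t ∈ xs → P t → y ≤ t) → List.head (filter P? xs) ≡ just y
  head-filter P? {x ∷ xs} (p ∷ ps) y∈ Py min with P? x
  ... | yes Px = cong just (Fin.≤-antisym (x≤ y∈) (min (here refl) Px))
    where
    x≤ : ∀ {y} → y ∈ x ∷ xs → x ≤ y
    x≤ (here refl) = Fin.≤-refl {x = x}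
    x≤ (there y∈)  = ℕ.<⇒≤ (All.lookup p y∈)
  ... | no ¬Px with y∈
  ...   | here refl = contradiction Py ¬Px
  ...   | there y∈′ = head-filter P? ps y∈′ Py (min ∘ there)

  block-≡ : ∀ {bs : List (List A)} → Unique (concat bs) → ∀ {b b′ t} →
            b ∈ bs → b′ ∈ bs → t ∈ b → t ∈ b′ → b ≡ b′
  block-≡ u (here refl) (here refl) _ _ = refl
  block-≡ {bs = b ∷ _} u (here refl) (there b′∈) t∈ t∈′ = contradiction (∈-concat⁺′ t∈′ b′∈) (unique-++-disjoint b u t∈)
  block-≡ {bs = b ∷ _} u (there b∈) (here refl) t∈ t∈′ = contradiction (∈-concat⁺′ t∈ b∈) (unique-++-disjoint b u t∈′)
  block-≡ {bs = b ∷ _} u (there b∈) (there b′∈) = block-≡ (unique-++ʳ b u) b∈ b′∈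

  headIn : List (List (Fin n)) → Fin n → Fin n
  headIn []       i = i
  headIn (b ∷ bs) i with mem? _≟_ i b
  ... | yes _ = headOr i b
  ... | no  _ = headIn bs i

  headIn-≡ : ∀ {bs : List (List (Fin n))} → Unique (concat bs) → ∀ {b i} → b ∈ bs → i ∈ b → headIn bs i ≡ headOr i b
  headIn-≡ {bs = c ∷ bs} u {b} {i} b∈ i∈ with mem? _≟_ i c
  ... | yes i∈c = cong (headOr i) (block-≡ {bs = c ∷ bs} u (here refl) b∈ i∈c i∈)
  ... | no i∉c with b∈
  ...   | here refl = contradiction i∈ i∉c
  ...   | there b∈′ = headIn-≡ (unique-++ʳ c u) b∈′ i∈

  record Blocks (bs : List (List (Fin n))) : Set where
    field
      cover  : concat bs ↭ allFin n
      sorted : All Sorted bs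

    unique : Unique (concat bs)
    unique = unique-resp-↭ (↭-sym cover) (Unique.allFin⁺ n)

    block : ∀ t → ∃ λ b → t ∈ b × b ∈ bs
    block t = ∈-concat⁻′ bs (∈-resp-↭ (↭-sym cover) (∈-allFin t))

  module _ {bs : List (List (Fin n))} (B : Blocks bs) where
    open Blocks B

    private
      leastVec = Vec.tabulate (headIn bs)

      leastVec-≡ : ∀ {b i} → b ∈ bs → i ∈ b → lookup leastVec i ≡ headOr i b
      leastVec-≡ b∈ i∈ = trans (lookup∘tabulate (headIn bs) _) (headIn-≡ unique b∈ i∈)

    toPartition : SetPartition n
    toPartition = partition leastVec
      (λ i → let b , i∈ , b∈ = block i in
        subst (_≤ i) (sym (leastVec-≡ b∈ i∈)) (head-≤ (All.lookup sorted b∈) i∈))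
      (λ i → let b , i∈ , b∈ = block i in
        trans (cong (lookup leastVec) (leastVec-≡ b∈ i∈))
          (trans (leastVec-≡ b∈ (headOr-∈ i∈)) (trans (headOr-irrelevant i∈) (sym (leastVec-≡ b∈ i∈)))))

    ∼⁺ : ∀ {b s t} → b ∈ bs → s ∈ b → t ∈ b → s ∼[ toPartition ] t
    ∼⁺ b∈ s∈ t∈ = trans (leastVec-≡ b∈ s∈) (trans (headOr-irrelevant s∈) (sym (leastVec-≡ b∈ t∈)))

    ∼⁻ : ∀ {b s t} → s ∼[ toPartition ] t → b ∈ bs → s ∈ b → t ∈ b
    ∼⁻ {b} {s} {t} s∼t b∈ s∈ with b′ , t∈ , b′∈ ← block t =
      subst (t ∈_) (block-≡ unique b′∈ b∈ (headOr-∈ t∈)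
        (subst (_∈ b) (trans (sym (leastVec-≡ b∈ s∈)) (trans s∼t (leastVec-≡ b′∈ t∈))) (headOr-∈ s∈))) t∈

    σ-toPartition : ∀ {w : Fin n → Fin n} → All (Cyclic w) bs → ∀ i → σ toPartition i ≡ w i
    σ-toPartition {w} cyc i with b , i∈ , b∈ ← block i with xs , ys , refl ← ∈-∃++ i∈ =
      trans (go ys refl) (sym w-i)
      where
      b-sorted : Sorted (xs ++ i ∷ ys)
      b-sorted = All.lookup sorted b∈

      run : ∀ zs → zs ≡ xs ++ i ∷ ys → Cyclic w zs → Run w zs (headOr i zs)
      run (z ∷ zs) _ c = c

      w-i : w i ≡ headOr (headOr i (xs ++ i ∷ ys)) ys
      w-i = proj₁ (run-suffix xs (run _ refl (All.lookup cyc b∈)))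

      P? : Decidable (λ j → i < j × i ∼[ toPartition ] j)
      P? j = (i <? j) ×-dec (i ∼[ toPartition ]? j)

      above : ∀ {j} → i < j → i ∼[ toPartition ] j → j ∈ ys
      above i<j i∼j with ∈-++⁻ xs (∼⁻ i∼j b∈ i∈)
      ... | inj₁ j∈xs         = contradiction i<j (Fin.<-asym (sorted-++ xs b-sorted j∈xs (here refl)))
      ... | inj₂ (here refl)  = contradiction refl (Fin.<⇒≢ i<j)
      ... | inj₂ (there j∈ys) = j∈ys

      go : ∀ zs → zs ≡ ys → σ toPartition i ≡ headOr (headOr i (xs ++ i ∷ ys)) zs
      go [] refl with σ-dichotomy toPartition i
      ... | inj₁ (i<σ , i∼σ) with () ← above i<σ i∼σ
      ... | inj₂ (eq , _) = trans eq (leastVec-≡ b∈ i∈)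
      go (y ∷ zs) refl = cong (fromMaybe (least toPartition i)) (head-filter P? (AllPairs.tabulate⁺-< id) (∈-allFin y)
        (sorted-++ (xs ++ i ∷ []) (subst Sorted (sym (++-assoc xs (i ∷ []) _)) b-sorted) (∈-++⁺ʳ xs (here refl)) (here refl) ,
         ∼⁺ b∈ i∈ (∈-++⁺ʳ xs (there (here refl))))
        (λ _ (i<j , i∼j) → head-≤ {d = i} (AllPairs.tail (AllPairs-⊆ (Sublist.++⁺ˡ xs ⊆-refl) b-sorted)) (above i<j i∼j)))

  maximum : ∀ {xs : List (Fin n)} {t} → t ∈ xs → ∃ λ q → q ∈ xs × (∀ {s} → s ∈ xs → s ≤ q)
  maximum {xs = x ∷ []}     _ = x , here refl , λ { (here refl) → Fin.≤-refl {x = x} }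
  maximum {xs = x ∷ y ∷ xs} _ with q , q∈ , max ← maximum {xs = y ∷ xs} (here refl) with Fin.≤-total x q
  ... | inj₁ x≤q = q , there q∈ , λ { (here refl) → x≤q ; (there s∈) → max s∈ }
  ... | inj₂ q≤x = x , here refl , λ { (here refl) → Fin.≤-refl {x = x} ; (there s∈) → Fin.≤-trans {i = _} (max s∈) q≤x }

  lookup-blocks : ∀ (cs : List (List A)) → Unique (concat cs) → ∀ i j {t} →
                  t ∈ List.lookup cs i → t ∈ List.lookup cs j → i ≡ j
  lookup-blocks (c ∷ cs) u zero    zero    _  _   = refl
  lookup-blocks (c ∷ cs) u zero    (suc j) t∈ t∈′ = contradiction (∈-concat⁺′ t∈′ (∈-lookup {xs = cs} j)) (unique-++-disjoint c u t∈)
  lookup-blocks (c ∷ cs) u (suc i) zero    t∈ t∈′ = contradiction (∈-concat⁺′ t∈ (∈-lookup {xs = cs} i)) (unique-++-disjoint c u t∈′)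
  lookup-blocks (c ∷ cs) u (suc i) (suc j) t∈ t∈′ = cong suc (lookup-blocks cs (unique-++ʳ c u) i j t∈ t∈′)

  module Refinement {pre post cs : List (List (Fin n))} {b}
    (B′ : Blocks (pre ++ b ∷ post)) (B : Blocks (pre ++ cs ++ post)) (cs↭b : concat cs ↭ b) where

    private
      module B  = Blocks B
      module B′ = Blocks B′

    coarse fine : SetPartition n
    coarse = toPartition B′
    fine   = toPartition B

    b∈ : b ∈ pre ++ b ∷ post
    b∈ = ∈-++⁺ʳ pre (here refl)

    piece∈ : ∀ {c} → c ∈ cs → c ∈ pre ++ cs ++ post
    piece∈ c∈ = ∈-++⁺ʳ pre (∈-++⁺ˡ c∈)

    piece⊆ : ∀ {c t} → c ∈ cs → t ∈ c → t ∈ b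
    piece⊆ c∈ t∈ = ∈-resp-↭ cs↭b (∈-concat⁺′ t∈ c∈)

    pieceOf : ∀ {t} → t ∈ b → ∃ λ c → t ∈ c × c ∈ cs
    pieceOf t∈ = ∈-concat⁻′ cs (∈-resp-↭ (↭-sym cs↭b) t∈)

    module _ {x} (x∈ : x ∈ b) where

      block⁺ : ∀ {t} → t ∈ b → Block coarse x t
      block⁺ t∈ = ∼⁺ B′ b∈ t∈ x∈

      block⁻ : ∀ {t} → Block coarse x t → t ∈ b
      block⁻ t∼x = ∼⁻ B′ (sym t∼x) b∈ x∈

      refines : ∀ s t → s ∼[ fine ] t → s ∼[ coarse ] t
      refines s t s∼t with c , s∈ , c∈ ← B.block s with ∈-++⁻ pre c∈
      ... | inj₁ c∈pre = ∼⁺ B′ (∈-++⁺ˡ c∈pre) s∈ (∼⁻ B s∼t c∈ s∈)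
      ... | inj₂ c∈′ with ∈-++⁻ cs c∈′
      ...   | inj₁ c∈cs   = ∼⁺ B′ b∈ (piece⊆ c∈cs s∈) (piece⊆ c∈cs (∼⁻ B s∼t c∈ s∈))
      ...   | inj₂ c∈post = ∼⁺ B′ (∈-++⁺ʳ pre (there c∈post)) s∈ (∼⁻ B s∼t c∈ s∈)

      outside : ∀ s t → ¬ Block coarse x s → s ∼[ coarse ] t → s ∼[ fine ] t
      outside s t ¬s s∼t with c , s∈ , c∈ ← B′.block s with ∈-++⁻ pre c∈
      ... | inj₁ c∈pre          = ∼⁺ B (∈-++⁺ˡ c∈pre) s∈ (∼⁻ B′ s∼t c∈ s∈)
      ... | inj₂ (here refl)    = contradiction (block⁺ s∈) ¬s
      ... | inj₂ (there c∈post) = ∼⁺ B (∈-++⁺ʳ pre (∈-++⁺ʳ cs c∈post)) s∈ (∼⁻ B′ s∼t c∈ s∈)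

      count : All (λ c → ∃ λ t → t ∈ c) cs → blockCount (block? coarse x) fine ≡ length cs
      count nonempty = enumeration-length heads heads-injective
        (Unique.filter⁺ L? (Unique.allFin⁺ n)) (λ i → ∈-filter⁺ L? (∈-allFin _) (heads-least i)) onto
        where
        L? : Decidable (λ t → Block coarse x t × (∀ s → Block coarse x s → s ∼[ fine ] t → t ≤ s))
        L? t = block? coarse x t ×-dec all? λ s → block? coarse x s →-dec (s ∼[ fine ]? t) →-dec (t ≤? s)

        heads : Fin (length cs) → Fin n
        heads i = headOr x (List.lookup cs i)

        heads-∈ : ∀ i → heads i ∈ List.lookup cs i
        heads-∈ i = headOr-∈ (proj₂ (All.lookup nonempty (∈-lookup i)))

        heads-injective : ∀ i j → heads i ≡ heads j → i ≡ j
        heads-injective i j eq = lookup-blocks cs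
          (unique-++ˡ (concat cs) (subst Unique (sym (concat-++ cs post)) (unique-++ʳ (concat pre)
            (subst Unique (sym (concat-++ pre (cs ++ post))) B.unique)))) i j
          (heads-∈ i) (subst (_∈ List.lookup cs j) (sym eq) (heads-∈ j))

        piece-sorted : ∀ {c} → c ∈ cs → Sorted c
        piece-sorted c∈ = All.lookup B.sorted (piece∈ c∈)

        heads-least : ∀ i → Block coarse x (heads i) × (∀ s → Block coarse x s → s ∼[ fine ] heads i → heads i ≤ s)
        heads-least i = block⁺ (piece⊆ (∈-lookup i) (heads-∈ i)) , λ s _ s∼ →
          head-≤ (piece-sorted (∈-lookup i)) (∼⁻ B (sym s∼) (piece∈ (∈-lookup i)) (heads-∈ i))

        onto : ∀ {t} → t ∈ filter L? (allFin n) → ∃ λ i → heads i ≡ t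
        onto {t} t∈L with _ , t∼x , least ← ∈-filter⁻ L? {xs = allFin n} t∈L with c , t∈ , c∈ ← pieceOf (block⁻ t∼x) =
          Any.index c∈ , trans (cong (headOr x) (sym (lookup-index c∈)))
            (Fin.≤-antisym (head-≤ (piece-sorted c∈) t∈)
              (least _ (block⁺ (piece⊆ c∈ (headOr-∈ t∈))) (∼⁺ B (piece∈ c∈) (headOr-∈ t∈) t∈)))

      splits : All (λ c → ∃ λ t → t ∈ c) cs → Splits (length cs) x fine coarse
      splits nonempty = refines , outside , count nonempty

      isInterval : concat cs ≡ b → IsInterval (Block coarse x) fine
      isInterval cs≡b y y∼x with c , y∈ , c∈ ← pieceOf (block⁻ y∼x)
        with q , q∈ , max ← maximum y∈ with cs₁ , cs₂ , refl ← ∈-∃++ c∈ =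
        p , q , block⁺ (piece⊆ c∈ p∈) , block⁺ (piece⊆ c∈ q∈) , λ t t∼x →
          (λ t∼y → let t∈ = ∼⁻ B (sym t∼y) (piece∈ c∈) y∈ in head-≤ (All.lookup B.sorted (piece∈ c∈)) t∈ , max t∈) ,
          (λ (p≤t , t≤q) → ∼⁺ B (piece∈ c∈) (between p≤t t≤q (subst (t ∈_) b≡ (block⁻ t∼x))) y∈)
        where
        p = headOr y c
        p∈ = headOr-∈ {d = y} y∈

        b≡ : b ≡ concat cs₁ ++ c ++ concat cs₂
        b≡ = trans (sym cs≡b) (concat-split cs₁ c cs₂)

        b-sorted : Sorted (concat cs₁ ++ c ++ concat cs₂)
        b-sorted = subst Sorted b≡ (All.lookup B′.sorted b∈)

        between : ∀ {t} → p ≤ t → t ≤ q → t ∈ concat cs₁ ++ c ++ concat cs₂ → t ∈ c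
        between p≤t t≤q t∈ with ∈-++⁻ (concat cs₁) t∈
        ... | inj₁ t∈₁ = contradiction p≤t (ℕ.<⇒≱ (sorted-++ (concat cs₁) b-sorted t∈₁ (∈-++⁺ˡ p∈)))
        ... | inj₂ t∈′ with ∈-++⁻ c t∈′
        ...   | inj₁ t∈c = t∈c
        ...   | inj₂ t∈₂ = contradiction t≤q (ℕ.<⇒≱ (sorted-++ (concat cs₁ ++ c)
                  (subst Sorted (sym (++-assoc (concat cs₁) c _)) b-sorted) (∈-++⁺ʳ (concat cs₁) q∈) t∈₂))

  splits-noncrossing : ∀ {π π′ : SetPartition n} {a x} → Splits a x π π′ →
    IsInterval (Block π′ x) π ⊎ IsNearInterval (block? π′ x) π → Noncrossing π′ → Noncrossing π
  splits-noncrossing {π = π} {π′} {x = x} (refines , outside , _) I nc i j k l i<j j<k k<l i∼k j∼l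
    with block? π′ x i
  ... | no ¬i = outside i j ¬i (nc i j k l i<j j<k k<l (refines i k i∼k) (refines j l j∼l))
  ... | yes i∼x = inside I
    where
    i∼′j : i ∼[ π′ ] j
    i∼′j = nc i j k l i<j j<k k<l (refines i k i∼k) (refines j l j∼l)

    j∼x : Block π′ x j
    j∼x = trans (sym i∼′j) i∼x

    k∼x : Block π′ x k
    k∼x = trans (sym (refines i k i∼k)) i∼x

    l∼x : Block π′ x l
    l∼x = trans (sym (refines j l j∼l)) j∼x

    convex : ∀ (ρ : SetPartition _) → IsInterval (Block π′ x) ρ → ∀ {s t v} →
             Block π′ x s → Block π′ x t → Block π′ x v → s ≤ t → t ≤ v → s ∼[ ρ ] v → t ∼[ ρ ] s
    convex ρ I {s} {t} {v} Ts Tt Tv s≤t t≤v s∼v with p , q , _ , _ , char ← I s Ts =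
      proj₂ (char t Tt) (ℕ.≤-trans (proj₁ (proj₁ (char s Ts) refl)) s≤t ,
                         ℕ.≤-trans t≤v (proj₂ (proj₁ (char v Tv) (sym s∼v))))

    inside : IsInterval (Block π′ x) π ⊎ IsNearInterval (block? π′ x) π → i ∼[ π ] j
    inside (inj₁ I) = sym (convex π I i∼x j∼x k∼x (ℕ.<⇒≤ i<j) (ℕ.<⇒≤ j<k) i∼k)
    inside (inj₂ (ρ , I , _ , p , q , Tp , Tq , bounds , merged)) = cases (proj₁ (merged i k i∼x k∼x) i∼k)
      where
      direct : i ∼[ ρ ] k → i ∼[ π ] j
      direct i∼k = proj₂ (merged i j i∼x j∼x)
        (inj₁ (sym (convex ρ I i∼x j∼x k∼x (ℕ.<⇒≤ i<j) (ℕ.<⇒≤ j<k) i∼k)))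

      cases : i ∼[ ρ ] k ⊎ (i ∼[ ρ ] p × k ∼[ ρ ] q) ⊎ (i ∼[ ρ ] q × k ∼[ ρ ] p) → i ∼[ π ] j
      cases (inj₁ i∼k) = direct i∼k
      cases (inj₂ (inj₁ (i∼p , k∼q))) = second (proj₁ (merged j l j∼x l∼x) j∼l)
        where
        l∼q : l ∼[ ρ ] q
        l∼q = trans (convex ρ I k∼x l∼x Tq (ℕ.<⇒≤ k<l) (proj₂ (bounds l l∼x)) k∼q) k∼q

        outer : j ∼[ ρ ] q → i ∼[ π ] j
        outer j∼q = proj₂ (merged i j i∼x j∼x) (inj₂ (inj₁ (i∼p , j∼q)))

        second : j ∼[ ρ ] l ⊎ (j ∼[ ρ ] p × l ∼[ ρ ] q) ⊎ (j ∼[ ρ ] q × l ∼[ ρ ] p) → i ∼[ π ] j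
        second (inj₁ j∼l)              = outer (trans j∼l l∼q)
        second (inj₂ (inj₁ (j∼p , _))) = proj₂ (merged i j i∼x j∼x) (inj₁ (trans i∼p (sym j∼p)))
        second (inj₂ (inj₂ (j∼q , _))) = outer j∼q
      cases (inj₂ (inj₂ (i∼q , k∼p))) = direct
        (trans (convex ρ I Tp i∼x k∼x (proj₁ (bounds i i∼x)) (ℕ.<⇒≤ (ℕ.<-trans i<j j<k)) (sym k∼p)) (sym k∼p))

  concat-pieces : ∀ (as : List (Piece A)) → concat (map pieceBlock as) ≡ flatten as []
  concat-pieces as = trans (sym (++-identityʳ _)) (flatten-pieces as)

  pieces-nonempty : ∀ (as : List (Piece A)) → All (λ c → ∃ λ t → t ∈ c) (map pieceBlock as)
  pieces-nonempty []              = []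
  pieces-nonempty ((is , e) ∷ as) = (e , ∈-++⁺ʳ is (here refl)) ∷ pieces-nonempty as

  cutBlocks-nonempty : ∀ (as : List (Piece A)) t → All (λ c → ∃ λ s → s ∈ c) (cutBlocks (as , t))
  cutBlocks-nonempty []              t = []
  cutBlocks-nonempty ((is , e) ∷ as) t = (e , ∈-++⁺ʳ is (here refl)) ∷ pieces-nonempty as

  module CutStep {pre post : List (List (Fin n))} (is : List (Fin n)) (e : Fin n) (a : Piece (Fin n)) (as : List (Piece (Fin n)))
    (t : List (Fin n)) (B′ : Blocks (pre ++ flatten ((is , e) ∷ a ∷ as) t ∷ post))
    (B : Blocks (pre ++ cutBlocks ((is , e) ∷ a ∷ as , t) ++ post)) where

    private
      whole : List (Fin n)
      whole = flatten ((is , e) ∷ a ∷ as) t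
      cs : List (List (Fin n))
      cs = cutBlocks ((is , e) ∷ a ∷ as , t)

    open Refinement B′ B (cutBlocks-↭ (is , e) (a ∷ as)) public

    e∈ : e ∈ whole
    e∈ = ∈-++⁺ʳ is (here refl)

    length-cs : length cs ≡ 2 + length as
    length-cs = cong suc (length-map pieceBlock (a ∷ as))

    cut-splits : Splits (2 + length as) e fine coarse
    cut-splits = subst (λ l → Splits l e fine coarse) length-cs
      (splits e∈ (cutBlocks-nonempty ((is , e) ∷ a ∷ as) t))

    cut-interval : t ≡ [] → IsInterval (Block coarse e) fine
    cut-interval refl = isInterval e∈ (trans (++-assoc is (e ∷ []) _) (cong (λ r → is ++ e ∷ r) (concat-pieces (a ∷ as))))

    module Near {g t′} (t≡ : t ≡ g ∷ t′) where

      middle ρs : List (List (Fin n))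
      middle = map pieceBlock (a ∷ as)
      ρs = (is ++ e ∷ []) ∷ middle ++ t ∷ []

      ρs-concat : concat ρs ≡ whole
      ρs-concat = trans (++-assoc is (e ∷ []) _) (cong (λ r → is ++ e ∷ r)
        (trans (sym (concat-++ middle (t ∷ []))) (trans (cong (concat middle ++_) (++-identityʳ t)) (flatten-pieces (a ∷ as)))))

      b-sorted : Sorted whole
      b-sorted = All.lookup (Blocks.sorted B′) b∈

      ρs-⊆ : ∀ {c} → c ∈ ρs → Sorted c
      ρs-⊆ c∈ = concat-sorted ρs (subst Sorted (sym ρs-concat) b-sorted) c∈
        where
        concat-sorted : ∀ (cs : List (List (Fin n))) → Sorted (concat cs) → ∀ {c} → c ∈ cs → Sorted c
        concat-sorted (c ∷ cs) s (here refl) = AllPairs-⊆ (Sublist.++⁺ʳ _ ⊆-refl) s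
        concat-sorted (c ∷ cs) s (there c∈)  = concat-sorted cs (AllPairs-⊆ (Sublist.++⁺ˡ c ⊆-refl) s) c∈

      Bρ : Blocks (pre ++ ρs ++ post)
      Bρ = record
        { cover  = ↭-trans (↭-reflexive (trans (sym (concat-++ pre (ρs ++ post)))
                     (trans (cong (concat pre ++_) (trans (sym (concat-++ ρs post)) (cong (_++ concat post) ρs-concat)))
                       (sym (concat-split pre whole post))))) (Blocks.cover B′)
        ; sorted = All.++⁺ (All.++⁻ˡ pre (Blocks.sorted B′)) (All.++⁺ (All.tabulate ρs-⊆)
                     (All.tail (All.++⁻ʳ pre (Blocks.sorted B′))))
        }

      module ρ = Refinement {pre = pre} {post} {ρs} {whole} B′ Bρ (↭-reflexive ρs-concat)

      first∈ : is ++ e ∷ t ∈ pre ++ cs ++ post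
      first∈ = piece∈ (here refl)

      first∈ρ : is ++ e ∷ [] ∈ pre ++ ρs ++ post
      first∈ρ = ρ.piece∈ (here refl)

      t∈ρ : t ∈ pre ++ ρs ++ post
      t∈ρ = ρ.piece∈ (there (∈-++⁺ʳ middle (here refl)))

      g∈ : g ∈ t
      g∈ = subst (g ∈_) (sym t≡) (here refl)

      p = headOr e whole

      p∈ : p ∈ is ++ e ∷ []
      p∈ = go is
        where
        go : ∀ js {rest} → headOr e (js ++ e ∷ rest) ∈ js ++ e ∷ []
        go []       = here refl
        go (j ∷ js) = here refl

      q = proj₁ (maximum g∈)

      q∈ : q ∈ t
      q∈ = proj₁ (proj₂ (maximum g∈))

      b≡ : whole ≡ concat ((is ++ e ∷ []) ∷ middle) ++ t
      b≡ = trans (sym (++-assoc is (e ∷ []) _)) (trans (cong ((is ++ e ∷ []) ++_) (sym (flatten-pieces (a ∷ as))))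
        (sym (++-assoc (is ++ e ∷ []) (concat middle) t)))

      p∈b : p ∈ whole
      p∈b = headOr-∈ e∈

      q∈b : q ∈ whole
      q∈b = subst (q ∈_) (sym b≡) (∈-++⁺ʳ (concat ((is ++ e ∷ []) ∷ middle)) q∈)

      bounds : ∀ s → Block coarse e s → p ≤ s × s ≤ q
      bounds s s∼e = head-≤ b-sorted s∈ , upper (∈-++⁻ (concat ((is ++ e ∷ []) ∷ middle)) (subst (s ∈_) b≡ s∈))
        where
        s∈ = block⁻ e∈ s∼e

        upper : s ∈ concat ((is ++ e ∷ []) ∷ middle) ⊎ s ∈ t → s ≤ q
        upper (inj₁ s∈₁) = ℕ.<⇒≤ (sorted-++ (concat ((is ++ e ∷ []) ∷ middle)) (subst Sorted b≡ b-sorted) s∈₁ q∈)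
        upper (inj₂ s∈t) = proj₂ (proj₂ (maximum g∈)) s∈t

      left : ∀ {s} → s ∈ is ++ e ∷ [] → s ∈ is ++ e ∷ t
      left s∈ with ∈-++⁻ is s∈
      ... | inj₁ s∈is        = ∈-++⁺ˡ s∈is
      ... | inj₂ (here refl) = ∈-++⁺ʳ is (here refl)

      right : ∀ {s} → s ∈ t → s ∈ is ++ e ∷ t
      right s∈ = ∈-++⁺ʳ is (there s∈)

      sides : ∀ {s} → s ∈ is ++ e ∷ t → s ∈ is ++ e ∷ [] ⊎ s ∈ t
      sides s∈ with ∈-++⁻ is s∈
      ... | inj₁ s∈is         = inj₁ (∈-++⁺ˡ s∈is)
      ... | inj₂ (here refl)  = inj₁ (∈-++⁺ʳ is (here refl))
      ... | inj₂ (there s∈t)  = inj₂ s∈t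

      merged⁺ : ∀ s s′ → Block coarse e s → s ∼[ fine ] s′ →
        s ∼[ ρ.fine ] s′ ⊎ (s ∼[ ρ.fine ] p × s′ ∼[ ρ.fine ] q) ⊎ (s ∼[ ρ.fine ] q × s′ ∼[ ρ.fine ] p)
      merged⁺ s s′ s∼e s∼s′ with pieceOf (block⁻ e∈ s∼e)
      ... | c , s∈ , there c∈ = inj₁ (∼⁺ Bρ (ρ.piece∈ (there (∈-++⁺ˡ c∈))) s∈ (∼⁻ B s∼s′ (piece∈ (there c∈)) s∈))
      ... | c , s∈ , here refl with sides s∈ | sides (∼⁻ B s∼s′ first∈ s∈)
      ...   | inj₁ x | inj₁ y = inj₁ (∼⁺ Bρ first∈ρ x y)
      ...   | inj₁ x | inj₂ y = inj₂ (inj₁ (∼⁺ Bρ first∈ρ x p∈ , ∼⁺ Bρ t∈ρ y q∈))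
      ...   | inj₂ x | inj₁ y = inj₂ (inj₂ (∼⁺ Bρ t∈ρ x q∈ , ∼⁺ Bρ first∈ρ y p∈))
      ...   | inj₂ x | inj₂ y = inj₁ (∼⁺ Bρ t∈ρ x y)

      merged⁻ : ∀ s s′ → Block coarse e s →
        s ∼[ ρ.fine ] s′ ⊎ (s ∼[ ρ.fine ] p × s′ ∼[ ρ.fine ] q) ⊎ (s ∼[ ρ.fine ] q × s′ ∼[ ρ.fine ] p) → s ∼[ fine ] s′
      merged⁻ s s′ s∼e (inj₁ s∼s′) with ρ.pieceOf (block⁻ e∈ s∼e)
      ... | c , s∈ , here refl = ∼⁺ B first∈ (left s∈) (left (∼⁻ Bρ s∼s′ first∈ρ s∈))
      ... | c , s∈ , there c∈ with ∈-++⁻ middle c∈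
      ...   | inj₁ c∈′         = ∼⁺ B (piece∈ (there c∈′)) s∈ (∼⁻ Bρ s∼s′ (ρ.piece∈ (there c∈)) s∈)
      ...   | inj₂ (here refl) = ∼⁺ B first∈ (right s∈) (right (∼⁻ Bρ s∼s′ t∈ρ s∈))
      merged⁻ s s′ _ (inj₂ (inj₁ (s∼p , s′∼q))) =
        ∼⁺ B first∈ (left (∼⁻ Bρ (sym s∼p) first∈ρ p∈)) (right (∼⁻ Bρ (sym s′∼q) t∈ρ q∈))
      merged⁻ s s′ _ (inj₂ (inj₂ (s∼q , s′∼p))) =
        ∼⁺ B first∈ (right (∼⁻ Bρ (sym s∼q) t∈ρ q∈)) (left (∼⁻ Bρ (sym s′∼p) first∈ρ p∈))

      nonempty : All (λ c → ∃ λ s → s ∈ c) ρs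
      nonempty = (e , ∈-++⁺ʳ is (here refl)) ∷ All.++⁺ (pieces-nonempty (a ∷ as)) ((g , g∈) ∷ [])

      three : 3 ℕ.≤ length ρs
      three = ℕ.s≤s (ℕ.s≤s (subst (1 ℕ.≤_) (sym (trans (length-++ (map pieceBlock as)) (ℕ.+-comm _ 1))) (ℕ.s≤s ℕ.z≤n)))

      near : IsNearInterval (block? coarse e) fine
      near = ρ.fine , ρ.isInterval e∈ ρs-concat , subst (3 ℕ.≤_) (sym (ρ.count e∈ nonempty)) three ,
        p , q , block⁺ e∈ p∈b , block⁺ e∈ q∈b , bounds , λ s s′ Ts Ts′ → merged⁺ s s′ Ts , merged⁻ s s′ Ts

      private
        f = proj₂ a

        f∈₁ : f ∈ concat middle
        f∈₁ = ∈-++⁺ˡ (∈-++⁺ʳ (proj₁ a) (here refl))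

        f∈ : f ∈ whole
        f∈ = ∈-++⁺ʳ is (there (∈-++⁺ʳ (proj₁ a) (here refl)))

        e<f : e < f
        e<f = sorted-++ (is ++ e ∷ []) (subst Sorted (sym (++-assoc is (e ∷ []) _)) b-sorted)
          (∈-++⁺ʳ is (here refl)) (∈-++⁺ʳ (proj₁ a) (here refl))

        f<g : f < g
        f<g = sorted-++ (concat ((is ++ e ∷ []) ∷ middle)) (subst Sorted b≡ b-sorted)
          (∈-++⁺ʳ (is ++ e ∷ []) f∈₁) g∈

        e≁f : ¬ e ∼[ fine ] f
        e≁f e∼f = unique-++-disjoint (is ++ e ∷ t) (unique-++ˡ _ (subst Unique (sym (concat-++ cs post))
            (unique-++ʳ (concat pre) (subst Unique (sym (concat-++ pre (cs ++ post))) (Blocks.unique B)))))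
          (∼⁻ B e∼f first∈ (∈-++⁺ʳ is (here refl))) f∈₁

      not-⊏ : ¬ (fine ⊏[ 2 + length as ] coarse)
      not-⊏ (x , (_ , outside′ , _) , I) with block? coarse x e
      ... | no ¬e = e≁f (outside′ e f ¬e (∼⁺ B′ b∈ e∈ f∈))
      ... | yes e∼x with p′ , q′ , _ , _ , char ← I e e∼x = e≁f (sym (proj₂ (char f (trans (∼⁺ B′ b∈ f∈ e∈) e∼x))
        ( ℕ.≤-trans (proj₁ (proj₁ (char e e∼x) refl)) (ℕ.<⇒≤ e<f)
        , ℕ.≤-trans (ℕ.<⇒≤ f<g) (proj₂ (proj₁ (char g (trans (∼⁺ B′ b∈ g∈b e∈) e∼x))
            (∼⁺ B first∈ (right g∈) (∈-++⁺ʳ is (here refl))))))))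

        where
        g∈b : g ∈ whole
        g∈b = subst (g ∈_) (sym b≡) (∈-++⁺ʳ (concat ((is ++ e ∷ []) ∷ middle)) g∈)

  decomposition-blocks : ∀ {w : Fin n → Fin n} {bs} → Decomposition w bs → Blocks bs
  decomposition-blocks D = record { cover = Decomposition.cover D ; sorted = Decomposition.sorted D }

  record MoveFacts (k : ℕ) (tail : List (Fin n)) (fine coarse : SetPartition n) : Set where
    field
      point        : Fin n
      splits       : Splits (2 + k) point fine coarse
      shape        : IsInterval (Block coarse point) fine ⊎ IsNearInterval (block? coarse point) fine
      interval     : tail ≡ [] → fine ⊏[ 2 + k ] coarse
      not-interval : ∀ {g t} → tail ≡ g ∷ t → ¬ fine ⊏[ 2 + k ] coarse

  moveFacts : ∀ k {bs bs′ : List (List (Fin n))} {cut} (B : Blocks bs) (B′ : Blocks bs′) →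
              (cut , bs′) ∈ moves (2 + k) bs → MoveFacts k (proj₂ cut) (toPartition B′) (toPartition B)
  moveFacts k {bs} {cut = cut} B B′ mv∈ with moves⁻ (2 + k) bs mv∈
  ... | pre , b , post , refl , refl , cut∈ with cut | cuts-length (2 + k) b cut∈ | cuts-flatten (2 + k) b cut∈
  ...   | (is , e) ∷ a ∷ as , t | refl | refl = record
    { point        = e
    ; splits       = Step.cut-splits
    ; shape        = shape t refl
    ; interval     = λ t≡[] → e , Step.cut-splits , Step.cut-interval t≡[]
    ; not-interval = Step.Near.not-⊏
    }
    where
    module Step = CutStep {pre = pre} {post} is e a as t B B′

    shape : ∀ t′ → t ≡ t′ → IsInterval (Block Step.coarse e) Step.fine ⊎ IsNearInterval (block? Step.coarse e) Step.fine
    shape []      t≡ = inj₁ (Step.cut-interval t≡)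
    shape (g ∷ _) t≡ = inj₂ (Step.Near.near t≡)

  IntervalStep : ℕ → (Fin n → Fin n) → (Fin n → Fin n) → Set
  IntervalStep a u w = ∃₂ λ π π′ → (∀ t → σ π t ≡ u t) × (∀ t → σ π′ t ≡ w t) × π ⊏[ a ] π′

  abstract
    intervalStep? : ∀ a (u w : Fin n → Fin n) → Dec (IntervalStep a u w)
    intervalStep? a u w = searchPartition λ π → searchPartition λ π′ →
      all? (λ t → σ π t ≟ u t) ×-dec all? (λ t → σ π′ t ≟ w t) ×-dec (π ⊏[ a ]? π′)

  intervalStep-⊏ : ∀ {a} {u w : Fin n → Fin n} {π π′} → (∀ t → σ π t ≡ u t) → (∀ t → σ π′ t ≡ w t) →
                   IntervalStep a u w → π ⊏[ a ] π′
  intervalStep-⊏ {a = a} {π = π} {π′} πu π′w (ρ , ρ′ , ρu , ρ′w , step) =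
    subst₂ (λ π π′ → π ⊏[ a ] π′) {x = ρ} {y = π} {u = ρ′} {v = π′} (σ-injective {π = ρ} λ t → trans (ρu t) (sym (πu t)))
      (σ-injective {π = ρ′} λ t → trans (ρ′w t) (sym (π′w t))) step

  intervalStep-cong : ∀ {a} {u u′ w w′ : Fin n → Fin n} → (∀ t → u t ≡ u′ t) → (∀ t → w t ≡ w′ t) →
                      IntervalStep a u w → IntervalStep a u′ w′
  intervalStep-cong u≗ w≗ (π , π′ , πu , π′w , step) =
    π , π′ , (λ t → trans (πu t) (u≗ t)) , (λ t → trans (π′w t) (w≗ t)) , step

  lookup-∷ʳ-inject₁ : ∀ (xs : Vec X r) x i → lookup (xs ∷ʳ x) (inject₁ i) ≡ lookup xs i
  lookup-∷ʳ-inject₁ (y ∷ ys) x zero    = refl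
  lookup-∷ʳ-inject₁ (y ∷ ys) x (suc i) = lookup-∷ʳ-inject₁ ys x i

  lookup-∷ʳ-fromℕ : ∀ (xs : Vec X r) x → lookup (xs ∷ʳ x) (fromℕ r) ≡ x
  lookup-∷ʳ-fromℕ []       x = refl
  lookup-∷ʳ-fromℕ (y ∷ ys) x = lookup-∷ʳ-fromℕ ys x

  fin-snoc : ∀ {P : Fin (suc r) → Set ℓ} → (∀ i → P (inject₁ i)) → P (fromℕ r) → ∀ i → P i
  fin-snoc init last i with view i
  ... | ‵fromℕ         = last
  ... | ‵inj₁ {i = j} _ = init j

  fromLast : Vec X r → List X
  fromLast {X = X} = Vec.foldl (λ _ → List X) (λ xs x → x ∷ xs) []

  fromLast-∷ʳ : ∀ (xs : Vec X r) x → fromLast (xs ∷ʳ x) ≡ x ∷ fromLast xs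
  fromLast-∷ʳ xs x = foldl-∷ʳ (λ _ → List _) (λ xs x → x ∷ xs) [] x xs

  product-∷ʳ : ∀ (zs : Vec (Permutation′ n) r) z {i} → i ℕ.≤ r → product (zs ∷ʳ z) i ≡ product zs i
  product-∷ʳ zs        z ℕ.z≤n     = refl
  product-∷ʳ (z′ ∷ zs) z (ℕ.s≤s p) = cong (z′ ·_) (product-∷ʳ zs z p)

  product-∷ʳ-last : ∀ (zs : Vec (Permutation′ n) r) z t →
                    product (zs ∷ʳ z) (suc r) ⟨$⟩ʳ t ≡ product zs r ⟨$⟩ʳ (z ⟨$⟩ʳ t)
  product-∷ʳ-last []        z t = refl
  product-∷ʳ-last (z′ ∷ zs) z t = cong (z′ ⟨$⟩ʳ_) (product-∷ʳ-last zs z t)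

  -- The cycle lengths are the entries of d increased by one.
  Factors : Vec ℕ r → Vec (Permutation′ n) r → (Fin n → Fin n) → Set
  Factors {r} d zs w = (∀ i → IsCycle (suc (lookup d i)) (lookup zs i)) × (∀ t → product zs r ⟨$⟩ʳ t ≡ w t)

  factors-∷ʳ⁻ : ∀ (d : Vec ℕ r) {k} (zs : Vec (Permutation′ n) r) z {w} → Factors (d ∷ʳ k) (zs ∷ʳ z) w →
    IsCycle (suc k) z × (∀ {u} → (∀ t → u (z ⟨$⟩ʳ t) ≡ w t) → Factors d zs u)
  factors-∷ʳ⁻ {r} {n} d {k} zs z {w} (cycles , prod) =
    subst₂ (λ l z → IsCycle (suc l) z) (lookup-∷ʳ-fromℕ d k) (lookup-∷ʳ-fromℕ zs z) (cycles (fromℕ r)) ,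
    λ {u} uz≗w →
      (λ i → subst₂ (λ l z → IsCycle (suc l) z) (lookup-∷ʳ-inject₁ d k i) (lookup-∷ʳ-inject₁ zs z i) (cycles (inject₁ i))) ,
      λ t → subst (λ t → product zs r ⟨$⟩ʳ t ≡ u t) (inverseʳ z)
        (trans (sym (product-∷ʳ-last zs z _)) (trans (prod _) (sym (uz≗w _))))

  factors-init : ∀ (d : Vec ℕ r) {k} (zs : Vec (Permutation′ n) r) z {w} → Factors (d ∷ʳ k) (zs ∷ʳ z) w →
    Factors d zs (product zs r ⟨$⟩ʳ_) × (∀ t → product zs r ⟨$⟩ʳ (z ⟨$⟩ʳ t) ≡ w t)
  factors-init {r} d zs z {w} fs = proj₂ (factors-∷ʳ⁻ d zs z fs) {product zs r ⟨$⟩ʳ_} uz≗w , uz≗w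
    where
    uz≗w : ∀ t → product zs r ⟨$⟩ʳ (z ⟨$⟩ʳ t) ≡ w t
    uz≗w t = trans (sym (product-∷ʳ-last zs z t)) (proj₂ fs t)

  factors-∷ʳ⁺ : ∀ (d : Vec ℕ r) {k} (zs : Vec (Permutation′ n) r) z {u w} → IsCycle (suc k) z → Factors d zs u →
    (∀ t → u (z ⟨$⟩ʳ t) ≡ w t) → Factors (d ∷ʳ k) (zs ∷ʳ z) w
  factors-∷ʳ⁺ d {k} zs z cyc (cycles , prod) uz≗w =
    fin-snoc
      (λ i → subst₂ (λ l z → IsCycle (suc l) z) (sym (lookup-∷ʳ-inject₁ d k i)) (sym (lookup-∷ʳ-inject₁ zs z i)) (cycles i))
      (subst₂ (λ l z → IsCycle (suc l) z) (sym (lookup-∷ʳ-fromℕ d k)) (sym (lookup-∷ʳ-fromℕ zs z)) cyc) ,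
    λ t → trans (product-∷ʳ-last zs z t) (trans (prod _) (uz≗w t))

  factors⇒product : ∀ (d : Vec ℕ r) (zs : Vec (Permutation′ n) r) {w} → Factors d zs w → Product (fromLast d) w
  factors⇒product {zero}  []  []  (_ , prod) = nil (λ t → sym (prod t))
  factors⇒product {suc r} d zs {w} fs with Vec.initLast d | Vec.initLast zs
  ... | d′ , k , refl | zs′ , z , refl =
    let cyc , rest = factors-∷ʳ⁻ d′ zs′ z fs
        wz⁻¹ = λ t → w (z ⟨$⟩ˡ t)
        eq = λ t → cong w (inverseˡ z)
    in subst (λ ks → Product ks w) (sym (fromLast-∷ʳ d′ k))
         (cons z cyc (factors⇒product d′ zs′ (rest {wz⁻¹} eq)) eq)

  identity-discrete : ∀ {w : Fin n → Fin n} {bs} (D : Decomposition w bs) → (∀ t → w t ≡ t) →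
                      ∀ s t → s ∼[ toPartition (decomposition-blocks D) ] t → s ≡ t
  identity-discrete {w = w} {bs} D w≗id s t s∼t with b , s∈ , b∈ ← blockOf D s =
    singleton b b∈ s∈ (∼⁻ (decomposition-blocks D) s∼t b∈ s∈)
    where
    open Decomposition D
    singleton : ∀ b → b ∈ bs → s ∈ b → t ∈ b → s ≡ t
    singleton (x ∷ xs) b∈ s∈ t∈ = trans (last s∈) (sym (last t∈))
      where
      last : ∀ {t} → t ∈ x ∷ xs → t ≡ x
      last t∈ = run-fixed-last (sorted⇒unique (All.lookup sorted b∈)) (All.lookup cyclic b∈) t∈ (w≗id _)

  record ChainTo (d : Vec ℕ r) (zs : Vec (Permutation′ n) r) (π : SetPartition n) : Set where
    field
      chain       : Vec (SetPartition n) (suc r)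
      noncrossing : ∀ i → Noncrossing (lookup chain i)
      bottom      : ∀ s t → s ∼[ lookup chain zero ] t → s ≡ t
      top         : lookup chain (fromℕ r) ≡ π
      steps       : ∀ i → lookup chain (inject₁ i) ⊏̃[ suc (lookup d i) ] lookup chain (suc i)
      corresponds : Corresponds chain zs

  chain-snoc : ∀ (d : Vec ℕ r) (zs : Vec (Permutation′ n) r) {k z x} (π′ π : SetPartition n) → ChainTo d zs π′ →
    Splits (2 + k) x π′ π → IsInterval (Block π x) π′ ⊎ IsNearInterval (block? π x) π′ → Noncrossing π →
    (∀ t → σ π t ≡ product (zs ∷ʳ z) (suc r) ⟨$⟩ʳ t) → ChainTo (d ∷ʳ suc k) (zs ∷ʳ z) π
  chain-snoc {r} d zs {k} {z} {x} π′ π previous splits shape nc σπ = record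
    { chain       = C.chain ∷ʳ π
    ; noncrossing = fin-snoc
        (λ i → subst Noncrossing (sym (lookup-∷ʳ-inject₁ C.chain π i)) (C.noncrossing i))
        (subst Noncrossing (sym (lookup-∷ʳ-fromℕ C.chain π)) nc)
    ; bottom      = subst (λ ρ → ∀ s t → s ∼[ ρ ] t → s ≡ t) (sym (lookup-∷ʳ-inject₁ C.chain π zero)) C.bottom
    ; top         = lookup-∷ʳ-fromℕ C.chain π
    ; steps       = fin-snoc
        (λ i → step (sym (lookup-∷ʳ-inject₁ C.chain π (inject₁ i))) (sym (lookup-∷ʳ-inject₁ d (suc k) i))
          (sym (lookup-∷ʳ-inject₁ C.chain π (suc i))) (C.steps i))
        (step (trans (sym C.top) (sym (lookup-∷ʳ-inject₁ C.chain π (fromℕ r)))) (sym (lookup-∷ʳ-fromℕ d (suc k)))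
          (sym (lookup-∷ʳ-fromℕ C.chain π)) (x , splits , shape))
    ; corresponds = fin-snoc
        (λ i t → trans (cong (λ ρ → σ ρ t) (lookup-∷ʳ-inject₁ C.chain π i)) (trans (C.corresponds i t)
          (cong (_⟨$⟩ʳ t) (trans (cong (product zs) (sym (Fin.toℕ-inject₁ i)))
            (sym (product-∷ʳ zs z (ℕ.≤-pred (subst (ℕ._< suc r) (sym (Fin.toℕ-inject₁ i)) (Fin.toℕ<n i)))))))))
        (λ t → trans (cong (λ ρ → σ ρ t) (lookup-∷ʳ-fromℕ C.chain π))
          (trans (σπ t) (cong (λ i → product (zs ∷ʳ z) i ⟨$⟩ʳ t) (sym (Fin.toℕ-fromℕ (suc r))))))
    }
    where
    module C = ChainTo previous

    step : ∀ {ρ₁ ρ₂ ρ₁′ ρ₂′ : SetPartition _} {l l′} → ρ₁ ≡ ρ₂ → l ≡ l′ → ρ₁′ ≡ ρ₂′ →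
           ρ₁ ⊏̃[ suc l ] ρ₁′ → ρ₂ ⊏̃[ suc l′ ] ρ₂′
    step refl refl refl p = p

  chain-exists : ∀ (d : Vec ℕ r) (zs : Vec (Permutation′ n) r) {w bs} (D : Decomposition w bs) →
    (∀ i → 1 ℕ.≤ lookup d i) → Factors d zs w → sum (fromLast d) + length bs ≡ n →
    Noncrossing (toPartition (decomposition-blocks D)) → ChainTo d zs (toPartition (decomposition-blocks D))
  chain-exists {zero} [] [] D 1≤ (_ , prod) rank nc = record
    { chain       = toPartition (decomposition-blocks D) ∷ []
    ; noncrossing = λ { zero → nc }
    ; bottom      = identity-discrete D (λ t → sym (prod t))
    ; top         = refl
    ; steps       = λ ()
    ; corresponds = λ { zero t → trans (σ-toPartition (decomposition-blocks D) (Decomposition.cyclic D) t) (sym (prod t)) }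
    }
  chain-exists {suc r} {n} d zs {w} {bs} D 1≤ fs rank nc with Vec.initLast d | Vec.initLast zs
  ... | d′ , zero , refl | _ = contradiction (subst (1 ℕ.≤_) (lookup-∷ʳ-fromℕ d′ 0) (1≤ (fromℕ r))) λ ()
  ... | d′ , suc k , refl | zs′ , z , refl
    with minimal-cycle {z = z} {bs = bs} D (proj₁ (factors-∷ʳ⁻ d′ zs′ z fs))
           (factors⇒product d′ zs′ (proj₁ (factors-init d′ zs′ z fs))) (proj₂ (factors-init d′ zs′ z fs))
           (trans (cong (λ ks → sum ks + length bs) (sym (fromLast-∷ʳ d′ (suc k)))) rank)
  ... | (cut , bs′) , mv∈ , z≗ with refine {z = z} (suc k) D mv∈ (proj₂ (factors-init d′ zs′ z fs)) z≗
  ... | D′ , length≡ =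
    chain-snoc d′ zs′ (toPartition (decomposition-blocks D′)) (toPartition (decomposition-blocks D))
      (chain-exists d′ zs′ D′
        (λ i → subst (1 ℕ.≤_) (lookup-∷ʳ-inject₁ d′ (suc k) i) (1≤ (inject₁ i)))
        (proj₁ (factors-init d′ zs′ z fs)) rank′
        (splits-noncrossing {π = toPartition (decomposition-blocks D′)} {toPartition (decomposition-blocks D)}
          (MoveFacts.splits facts) (MoveFacts.shape facts) nc))
      (MoveFacts.splits facts) (MoveFacts.shape facts) nc
      (λ t → trans (σ-toPartition (decomposition-blocks D) (Decomposition.cyclic D) t) (sym (proj₂ fs t)))
    where
    facts = moveFacts k (decomposition-blocks D) (decomposition-blocks D′) mv∈

    rank′ : sum (fromLast d′) + length bs′ ≡ n
    rank′ = begin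
      sum (fromLast d′) + length bs′               ≡⟨ cong (sum (fromLast d′) +_) length≡ ⟩
      sum (fromLast d′) + (suc k + length bs)      ≡⟨ ℕ.+-assoc (sum (fromLast d′)) (suc k) (length bs) ⟨
      sum (fromLast d′) + suc k + length bs        ≡⟨ cong (_+ length bs) (ℕ.+-comm (sum (fromLast d′)) (suc k)) ⟩
      sum (suc k ∷ fromLast d′) + length bs        ≡⟨ cong (λ ks → sum ks + length bs) (fromLast-∷ʳ d′ (suc k)) ⟨
      sum (fromLast (d′ ∷ʳ suc k)) + length bs     ≡⟨ rank ⟩
      n ∎
      where open ≡-Reasoning

  next-inject₁ : ∀ (i : Fin k) → next (inject₁ i) ≡ suc i
  next-inject₁ {k} i = Fin.toℕ-injective (trans (Fin.toℕ-fromℕ< _)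
    (trans (cong (λ j → suc j ℕ.% suc k) (Fin.toℕ-inject₁ i)) (m<n⇒m%n≡m (ℕ.s≤s (Fin.toℕ<n i)))))

  next-fromℕ : ∀ k → next (fromℕ k) ≡ zero
  next-fromℕ k = Fin.toℕ-injective (trans (Fin.toℕ-fromℕ< _)
    (trans (cong (λ j → suc j ℕ.% suc k) (Fin.toℕ-fromℕ k)) (n%n≡0 (suc k))))

  run-lookup : ∀ {z : Fin n → Fin n} {x} xs {y} → Run z (x ∷ xs) y →
    (∀ i → z (List.lookup (x ∷ xs) (inject₁ i)) ≡ List.lookup (x ∷ xs) (suc i)) ×
    z (List.lookup (x ∷ xs) (fromℕ (length xs))) ≡ y
  run-lookup []        (p , _) = (λ ()) , p
  run-lookup (x′ ∷ xs) (p , r) =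
    let init , last = run-lookup xs r in (λ { zero → p ; (suc i) → init i }) , last

  run-tabulate : ∀ {w : Fin n → Fin n} k (f : Fin (suc k) → Fin n) {y} →
    (∀ i → w (f (inject₁ i)) ≡ f (suc i)) → w (f (fromℕ k)) ≡ y → Run w (List.tabulate f) y
  run-tabulate zero    f init last = last , _
  run-tabulate (suc k) f init last = init zero , run-tabulate k (f ∘ suc) (init ∘ suc) last

  cycle-isCycle : ∀ (xs : List (Fin n)) → length xs ≡ suc k → Unique xs → IsCycle (suc k) (cycle xs)
  cycle-isCycle {n} (x ∷ xs) refl u = Vec.tabulate (List.lookup (x ∷ xs)) , injective , follows , fixes
    where
    lookup≡ : ∀ i → lookup (Vec.tabulate (List.lookup (x ∷ xs))) i ≡ List.lookup (x ∷ xs) i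
    lookup≡ = lookup∘tabulate (List.lookup (x ∷ xs))

    injective : ∀ i j → lookup (Vec.tabulate (List.lookup (x ∷ xs))) i ≡ lookup (Vec.tabulate (List.lookup (x ∷ xs))) j → i ≡ j
    injective i j eq = unique-lookup u i j (trans (sym (lookup≡ i)) (trans eq (lookup≡ j)))

    z = cycle (x ∷ xs) ⟨$⟩ʳ_

    links = run-lookup xs (cycle-cyclic x xs u)

    around : ∀ i → z (List.lookup (x ∷ xs) i) ≡ List.lookup (x ∷ xs) (next i)
    around = fin-snoc
      (λ i → trans (proj₁ links i) (cong (List.lookup (x ∷ xs)) (sym (next-inject₁ i))))
      (trans (proj₂ links) (cong (List.lookup (x ∷ xs)) (sym (next-fromℕ (length xs)))))

    follows : ∀ i → z (lookup (Vec.tabulate (List.lookup (x ∷ xs))) i) ≡ lookup (Vec.tabulate (List.lookup (x ∷ xs))) (next i)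
    follows i = trans (cong z (lookup≡ i)) (trans (around i) (sym (lookup≡ (next i))))

    fixes : ∀ t → ¬ (∃ λ i → lookup (Vec.tabulate (List.lookup (x ∷ xs))) i ≡ t) → z t ≡ t
    fixes t t∉ = cycle-fixes (x ∷ xs) λ t∈ → t∉ (Any.index t∈ , trans (lookup≡ (Any.index t∈)) (sym (lookup-index t∈)))

  isCycle-cong : ∀ {a} {z z′ : Permutation′ n} → (∀ t → z ⟨$⟩ʳ t ≡ z′ ⟨$⟩ʳ t) → IsCycle a z → IsCycle a z′
  isCycle-cong eq (x , inj , follows , fixes) =
    x , inj , (λ i → trans (sym (eq _)) (follows i)) , λ t t∉ → trans (sym (eq t)) (fixes t t∉)

  next-decomposition : ∀ n → Decomposition (next {suc n}) (allFin (suc n) ∷ [])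
  next-decomposition n = record
    { cover  = ↭-reflexive (++-identityʳ (allFin (suc n)))
    ; sorted = AllPairs.tabulate⁺-< id ∷ []
    ; cyclic = run-tabulate n id next-inject₁ (next-fromℕ n) ∷ []
    }

  one-block-noncrossing : ∀ {w : Fin n → Fin n} (D : Decomposition w (allFin n ∷ [])) →
                          Noncrossing (toPartition (decomposition-blocks D))
  one-block-noncrossing D i j _ _ _ _ _ _ _ = ∼⁺ (decomposition-blocks D) (here refl) (∈-allFin i) (∈-allFin j)

  moves-lengths : ∀ {w : Fin n → Fin n} {bs cut bs′} → Decomposition w bs → (cut , bs′) ∈ moves (suc k) bs →
                  Sorted (ends cut) × length (ends cut) ≡ suc k
  moves-lengths {k = k} {bs = bs} {cut} D mv∈ with moves⁻ (suc k) bs mv∈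
  ... | pre , b′ , post , refl , _ , cut∈ =
    AllPairs-⊆ (ends-⊆ (suc k) b′ cut∈) (All.lookup (Decomposition.sorted D) (∈-++⁺ʳ pre (here refl))) ,
    ends-length (suc k) b′ {cut} cut∈

  sum-∷ʳ : ∀ (d : Vec ℕ r) k → Vec.sum (d ∷ʳ k) ≡ k + Vec.sum d
  sum-∷ʳ []      k = refl
  sum-∷ʳ (e ∷ d) k = trans (cong (e ℕ.+_) (sum-∷ʳ d k)) (x∙yz≈y∙xz e k (Vec.sum d))
    where open import Algebra.Properties.CommutativeSemigroup ℕ.+-commutativeSemigroup using (x∙yz≈y∙xz)

  sum-fromLast : ∀ (d : Vec ℕ r) → sum (fromLast d) ≡ Vec.sum d
  sum-fromLast {zero}  [] = refl
  sum-fromLast {suc r} d with Vec.initLast d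
  ... | d′ , k , refl = trans (cong sum (fromLast-∷ʳ d′ k))
    (trans (cong (k ℕ.+_) (sum-fromLast d′)) (sym (sum-∷ʳ d′ k)))

module Enumeration {c ℓ} (R : CommutativeRing c ℓ) where

  open import Data.Bool.Base using (if_then_else_)
  open import Data.Fin.Base as Fin using (Fin; zero; suc; toℕ; fromℕ; inject₁; punchIn)
  open import Data.Fin.Permutation as Perm
    using (Permutation′; _⟨$⟩ʳ_; _⟨$⟩ˡ_; inverseˡ; inverseʳ; insert; remove; punchIn-permute)
  open import Data.Fin.Properties as Fin using (_≟_; all?; punchIn-injective)
  open import Data.List.Base as List
    using (List; []; _∷_; length; map; foldr; filter; _++_; allFin; cartesianProductWith)
  open import Data.List.Membership.Propositional using (_∈_; find; lose)
  open import Data.List.Membership.Propositional.Properties using (∈-allFin; ∈-map⁺)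
  open import Data.List.Properties using (length-++; length-tabulate; map-id)
  open import Data.List.Relation.Ternary.Interleaving using ([])
  open import Data.List.Relation.Ternary.Interleaving.Propositional using (Interleaving; consˡ; consʳ)
  open import Data.List.Relation.Unary.All as All using (All; []; _∷_)
  open import Data.List.Relation.Unary.AllPairs using (_∷_)
  open import Data.List.Relation.Unary.Any as Any using (here; there)
  open import Data.List.Relation.Unary.Unique.Propositional using (Unique)
  import Data.List.Relation.Unary.Unique.Propositional.Properties as Unique
  open import Data.Nat.Base as ℕ using (ℕ; zero; suc)
  open import Data.Nat.ListAction using (sum)
  import Data.Nat.Properties as ℕ
  open import Data.Product.Base using (∃; _×_; _,_; proj₁; proj₂)
  open import Data.Vec.Base as Vec using (Vec; []; _∷_; _∷ʳ_; lookup; toList; zip)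
  open import Data.Vec.Properties using (lookup∘tabulate)
  open import Function.Base using (_∘_; id; flip)
  open import Relation.Binary.PropositionalEquality as ≡ using (_≡_; _≢_)
  open import Relation.Nullary.Decidable using (Dec; yes; no; does; _×-dec_)
  open import Relation.Nullary.Negation using (¬_; contradiction)
  open import Relation.Unary using (Decidable)
  open Combinatorics

  open CommutativeRing R hiding (zero)
  open Weights R using (_×ᵣ_; ∑; ∏; wt; wtChain)
  open import Algebra.Properties.CommutativeMonoid.Sum *-commutativeMonoid using (sum-cong-≋; sum-init-last)
  open import Algebra.Properties.Monoid.Mult +-monoid using (×-homo-+)
  open import Algebra.Solver.Ring.NaturalCoefficients.Default commutativeSemiring
    using (solve; _:=_; _:+_; _:*_; con)
  open import Relation.Binary.Reasoning.Setoid setoid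

  private
    variable
      n r : ℕ
      A B Hyp Hyp₁ Hyp₂ : Set

  -- A pair (d , Y) stands for a cycle of length suc d with variable Y; lists
  -- begin with the last factor.
  Item : Set c
  Item = ℕ × Carrier

  SetFun : Set c
  SetFun = List Item → Carrier

  ι : ℕ → Carrier
  ι k = k ×ᵣ 1#

  degree : List Item → ℕ
  degree []             = 0
  degree ((d , _) ∷ ps) = d ℕ.+ degree ps

  distribute : (List Item → List Item → Carrier) → SetFun
  distribute h []       = h [] []
  distribute h (p ∷ ps) = distribute (h ∘ (p ∷_)) ps + distribute (λ I J → h I (p ∷ J)) ps

  infixl 7 _⊛_

  _⊛_ : SetFun → SetFun → SetFun
  (f ⊛ g) = distribute λ I J → f I * g J

  unit : SetFun
  unit []      = 1#
  unit (_ ∷ _) = 0#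

  distribute-cong : ∀ {h h′} ps → (∀ {I J} → Interleaving I J ps → h I J ≈ h′ I J) →
                    distribute h ps ≈ distribute h′ ps
  distribute-cong []       eq = eq []
  distribute-cong (p ∷ ps) eq =
    +-cong (distribute-cong ps (eq ∘ consˡ)) (distribute-cong ps (eq ∘ consʳ))

  interchange : ∀ a b x y → (a + b) + (x + y) ≈ (a + x) + (b + y)
  interchange = solve 4 (λ a b x y → (a :+ b) :+ (x :+ y) := (a :+ x) :+ (b :+ y)) refl

  distribute-+ : ∀ h h′ ps →
    distribute (λ I J → h I J + h′ I J) ps ≈ distribute h ps + distribute h′ ps
  distribute-+ h h′ []       = refl
  distribute-+ h h′ (p ∷ ps) =
    trans (+-cong (distribute-+ _ _ ps) (distribute-+ _ _ ps)) (interchange _ _ _ _)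

  distribute-* : ∀ x h ps → distribute (λ I J → x * h I J) ps ≈ x * distribute h ps
  distribute-* x h []       = refl
  distribute-* x h (p ∷ ps) =
    trans (+-cong (distribute-* x _ ps) (distribute-* x _ ps)) (sym (distribˡ x _ _))

  distribute-0 : ∀ ps → distribute (λ _ _ → 0#) ps ≈ 0#
  distribute-0 []       = refl
  distribute-0 (p ∷ ps) = trans (+-cong (distribute-0 ps) (distribute-0 ps)) (+-identityˡ 0#)

  distribute-swap : ∀ h ps → distribute h ps ≈ distribute (λ I J → h J I) ps
  distribute-swap h []       = refl
  distribute-swap h (p ∷ ps) =
    trans (+-cong (distribute-swap _ ps) (distribute-swap _ ps)) (+-comm _ _)

  distribute-assoc : ∀ (h : List Item → List Item → List Item → Carrier) ps →
    distribute (λ K L → distribute (λ I J → h I J L) K) ps ≈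
    distribute (λ I K → distribute (λ J L → h I J L) K) ps
  distribute-assoc h []       = refl
  distribute-assoc h (p ∷ ps) = begin
    distribute (λ K L → distribute (λ I J → h (p ∷ I) J L) K + distribute (λ I J → h I (p ∷ J) L) K) ps
      + distribute (λ K L → distribute (λ I J → h I J (p ∷ L)) K) ps
      ≈⟨ +-congʳ (distribute-+ _ _ ps) ⟩
    (distribute (λ K L → distribute (λ I J → h (p ∷ I) J L) K) ps
      + distribute (λ K L → distribute (λ I J → h I (p ∷ J) L) K) ps)
      + distribute (λ K L → distribute (λ I J → h I J (p ∷ L)) K) ps
      ≈⟨ +-cong (+-cong (distribute-assoc (λ I → h (p ∷ I)) ps) (distribute-assoc (λ I J → h I (p ∷ J)) ps))
                (distribute-assoc (λ I J L → h I J (p ∷ L)) ps) ⟩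
    (distribute (λ I K → distribute (λ J L → h (p ∷ I) J L) K) ps
      + distribute (λ I K → distribute (λ J L → h I (p ∷ J) L) K) ps)
      + distribute (λ I K → distribute (λ J L → h I J (p ∷ L)) K) ps
      ≈⟨ +-assoc _ _ _ ⟩
    distribute (λ I K → distribute (λ J L → h (p ∷ I) J L) K) ps
      + (distribute (λ I K → distribute (λ J L → h I (p ∷ J) L) K) ps
      + distribute (λ I K → distribute (λ J L → h I J (p ∷ L)) K) ps)
      ≈⟨ +-congˡ (distribute-+ _ _ ps) ⟨
    distribute (λ I K → distribute (λ J L → h (p ∷ I) J L) K) ps
      + distribute (λ I K → distribute (λ J L → h I (p ∷ J) L) K + distribute (λ J L → h I J (p ∷ L)) K) ps ∎

  ⊛-cong : ∀ {f f′ g g′} → (∀ ps → f ps ≈ f′ ps) → (∀ ps → g ps ≈ g′ ps) →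
           ∀ ps → (f ⊛ g) ps ≈ (f′ ⊛ g′) ps
  ⊛-cong f≈ g≈ ps = distribute-cong ps λ _ → *-cong (f≈ _) (g≈ _)

  ⊛-comm : ∀ f g ps → (f ⊛ g) ps ≈ (g ⊛ f) ps
  ⊛-comm f g ps = trans (distribute-swap _ ps) (distribute-cong ps λ _ → *-comm _ _)

  ⊛-assoc : ∀ f g h ps → ((f ⊛ g) ⊛ h) ps ≈ (f ⊛ (g ⊛ h)) ps
  ⊛-assoc f g h ps = begin
    distribute (λ K L → distribute (λ I J → f I * g J) K * h L) ps
      ≈⟨ distribute-cong ps (λ {K} _ → trans (*-comm _ _) (trans (sym (distribute-* _ _ K))
           (distribute-cong K λ _ → trans (*-comm _ _) (*-assoc _ _ _)))) ⟩
    distribute (λ K L → distribute (λ I J → f I * (g J * h L)) K) ps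
      ≈⟨ distribute-assoc (λ I J L → f I * (g J * h L)) ps ⟩
    distribute (λ I K → distribute (λ J L → f I * (g J * h L)) K) ps
      ≈⟨ distribute-cong ps (λ {_} {K} _ → distribute-* _ _ K) ⟩
    distribute (λ I K → f I * distribute (λ J L → g J * h L) K) ps ∎

  ⊛-identityˡ : ∀ f ps → (unit ⊛ f) ps ≈ f ps
  ⊛-identityˡ f []       = *-identityˡ _
  ⊛-identityˡ f (p ∷ ps) = begin
    distribute (λ I J → 0# * f J) ps + (unit ⊛ (f ∘ (p ∷_))) ps
      ≈⟨ +-cong (trans (distribute-* _ _ ps) (zeroˡ _)) (⊛-identityˡ _ ps) ⟩
    0# + f (p ∷ ps) ≈⟨ +-identityˡ _ ⟩
    f (p ∷ ps) ∎

  ⊛-identityʳ : ∀ f ps → (f ⊛ unit) ps ≈ f ps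
  ⊛-identityʳ f ps = trans (⊛-comm f unit ps) (⊛-identityˡ f ps)

  degree-interleaving : ∀ {I J ps : List Item} → Interleaving I J ps → degree I ℕ.+ degree J ≡ degree ps
  degree-interleaving []                       = ≡.refl
  degree-interleaving {(d , _) ∷ I} {J} (consˡ i) =
    ≡.trans (ℕ.+-assoc d (degree I) (degree J)) (≡.cong (d ℕ.+_) (degree-interleaving i))
  degree-interleaving {I} {(d , _) ∷ J} (consʳ i) =
    ≡.trans (≡.sym (ℕ.+-assoc (degree I) d (degree J)))
      (≡.trans (≡.cong (ℕ._+ degree J) (ℕ.+-comm (degree I) d))
        (≡.trans (ℕ.+-assoc d (degree I) (degree J)) (≡.cong (d ℕ.+_) (degree-interleaving i))))

  length-interleaving : ∀ {I J ps : List Item} → Interleaving I J ps →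
                        length I ℕ.≤ length ps × length J ℕ.≤ length ps
  length-interleaving []        = ℕ.z≤n , ℕ.z≤n
  length-interleaving (consˡ i) = let a , b = length-interleaving i in ℕ.s≤s a , ℕ.m≤n⇒m≤1+n b
  length-interleaving (consʳ i) = let a , b = length-interleaving i in ℕ.m≤n⇒m≤1+n a , ℕ.s≤s b

  ι-+ : ∀ j k → ι (j ℕ.+ k) ≈ ι j + ι k
  ι-+ = ×-homo-+ 1#

  ∂ : SetFun → SetFun
  ∂ f I = ι (degree I) * f I

  ∂-⊛ : ∀ f g ps → ∂ (f ⊛ g) ps ≈ (∂ f ⊛ g) ps + (f ⊛ ∂ g) ps
  ∂-⊛ f g ps = begin
    ι (degree ps) * distribute (λ I J → f I * g J) ps
      ≈⟨ distribute-* _ _ ps ⟨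
    distribute (λ I J → ι (degree ps) * (f I * g J)) ps
      ≈⟨ distribute-cong ps (λ {I} {J} i → begin
           ι (degree ps) * (f I * g J)
             ≡⟨ ≡.cong (λ k → ι k * _) (degree-interleaving i) ⟨
           ι (degree I ℕ.+ degree J) * (f I * g J)
             ≈⟨ *-congʳ (ι-+ (degree I) (degree J)) ⟩
           (ι (degree I) + ι (degree J)) * (f I * g J)
             ≈⟨ solve 4 (λ x y f g → (x :+ y) :* (f :* g) := (x :* f) :* g :+ f :* (y :* g)) refl _ _ _ _ ⟩
           ∂ f I * g J + f I * ∂ g J ∎) ⟩
    distribute (λ I J → ∂ f I * g J + f I * ∂ g J) ps
      ≈⟨ distribute-+ _ _ ps ⟩
    (∂ f ⊛ g) ps + (f ⊛ ∂ g) ps ∎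

  ⊛-+ˡ : ∀ f f′ g ps → ((λ I → f I + f′ I) ⊛ g) ps ≈ (f ⊛ g) ps + (f′ ⊛ g) ps
  ⊛-+ˡ f f′ g ps = trans (distribute-cong ps λ _ → distribʳ _ _ _) (distribute-+ _ _ ps)

  ⊛-+ʳ : ∀ f g g′ ps → (f ⊛ (λ I → g I + g′ I)) ps ≈ (f ⊛ g) ps + (f ⊛ g′) ps
  ⊛-+ʳ f g g′ ps = trans (distribute-cong ps λ _ → distribˡ _ _ _) (distribute-+ _ _ ps)

  ⊛-*ˡ : ∀ x f g ps → ((λ I → x * f I) ⊛ g) ps ≈ x * (f ⊛ g) ps
  ⊛-*ˡ x f g ps = trans (distribute-cong ps λ _ → *-assoc _ _ _) (distribute-* _ _ ps)

  ⊛-*ʳ : ∀ x f g ps → (f ⊛ (λ I → x * g I)) ps ≈ x * (f ⊛ g) ps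
  ⊛-*ʳ x f g ps = trans (⊛-comm f _ ps) (trans (⊛-*ˡ x g f ps) (*-congˡ (⊛-comm g f ps)))

  -- P x is, up to the variables, the Abel polynomial divided by x. Its value
  -- at [] is never used: 1/x would be needed there, which is why the
  -- recursion goes through G = x P and E = ∂ P.
  P G E : Carrier → SetFun
  P x []             = 0#
  P x ((d , Y) ∷ ps) = G (x + ι d) ps + Y * E (x + ι d) ps
  G x []       = 1#
  G x (p ∷ ps) = x * P x (p ∷ ps)
  E x ps = ι (degree ps) * P x ps

  P-cong : ∀ {x y} ps → x ≈ y → P x ps ≈ P y ps
  G-cong : ∀ {x y} ps → x ≈ y → G x ps ≈ G y ps
  P-cong []             eq = refl
  P-cong ((d , Y) ∷ ps) eq =
    +-cong (G-cong ps (+-congʳ eq)) (*-congˡ (*-congˡ (P-cong ps (+-congʳ eq))))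
  G-cong []       eq = refl
  G-cong (p ∷ ps) eq = *-cong eq (P-cong (p ∷ ps) eq)

  E-cong : ∀ {x y} ps → x ≈ y → E x ps ≈ E y ps
  E-cong ps eq = *-congˡ (P-cong ps eq)

  ∂G : ∀ x ps → ∂ (G x) ps ≈ x * E x ps
  ∂G x []       = trans (zeroˡ _) (sym (trans (*-congˡ (zeroˡ _)) (zeroʳ _)))
  ∂G x (p ∷ ps) = solve 3 (λ i x y → i :* (x :* y) := x :* (i :* y)) refl _ _ _

  private
    module Step (k : ℕ)
      (GG : ∀ x y ps → length ps ℕ.≤ k → (G x ⊛ G y) ps ≈ G (x + y) ps)
      (EG : ∀ y ps → length ps ℕ.≤ k → (E 0# ⊛ G y) ps ≈ E y ps) where

      ⊛-cong-≤ : ∀ {f f′ g g′} → (∀ ps → length ps ℕ.≤ k → f ps ≈ f′ ps) →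
                 (∀ ps → length ps ℕ.≤ k → g ps ≈ g′ ps) →
                 ∀ ps → length ps ℕ.≤ k → (f ⊛ g) ps ≈ (f′ ⊛ g′) ps
      ⊛-cong-≤ f≈ g≈ ps l = distribute-cong ps λ i →
        *-cong (f≈ _ (ℕ.≤-trans (proj₁ (length-interleaving i)) l))
               (g≈ _ (ℕ.≤-trans (proj₂ (length-interleaving i)) l))

      EₓG : ∀ x y ps → length ps ℕ.≤ k → (E x ⊛ G y) ps ≈ E (x + y) ps
      EₓG x y ps l = begin
        (E x ⊛ G y) ps            ≈⟨ ⊛-cong-≤ (λ qs m → sym (EG x qs m)) (λ _ _ → refl) ps l ⟩
        ((E 0# ⊛ G x) ⊛ G y) ps   ≈⟨ ⊛-assoc (E 0#) (G x) (G y) ps ⟩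
        (E 0# ⊛ (G x ⊛ G y)) ps   ≈⟨ ⊛-cong-≤ (λ _ _ → refl) (GG x y) ps l ⟩
        (E 0# ⊛ G (x + y)) ps     ≈⟨ EG (x + y) ps l ⟩
        E (x + y) ps              ∎

      GEₓ : ∀ x y ps → length ps ℕ.≤ k → (G x ⊛ E y) ps ≈ E (x + y) ps
      GEₓ x y ps l = begin
        (G x ⊛ E y) ps  ≈⟨ ⊛-comm (G x) (E y) ps ⟩
        (E y ⊛ G x) ps  ≈⟨ EₓG y x ps l ⟩
        E (y + x) ps    ≈⟨ E-cong ps (+-comm y x) ⟩
        E (x + y) ps    ∎

      EₓE : ∀ x y ps → length ps ℕ.≤ k → (E x ⊛ E y) ps ≈ (E 0# ⊛ E (x + y)) ps
      EₓE x y ps l = begin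
        (E x ⊛ E y) ps            ≈⟨ ⊛-cong-≤ (λ qs m → sym (EG x qs m)) (λ _ _ → refl) ps l ⟩
        ((E 0# ⊛ G x) ⊛ E y) ps   ≈⟨ ⊛-assoc (E 0#) (G x) (E y) ps ⟩
        (E 0# ⊛ (G x ⊛ E y)) ps   ≈⟨ ⊛-cong-≤ (λ _ _ → refl) (GEₓ x y) ps l ⟩
        (E 0# ⊛ E (x + y)) ps     ∎

      swap-last : ∀ x y z → (x + y) + z ≈ (x + z) + y
      swap-last = solve 3 (λ x y z → (x :+ y) :+ z := (x :+ z) :+ y) refl

      GG-step : ∀ x y p ps → length ps ℕ.≤ k → (G x ⊛ G y) (p ∷ ps) ≈ G (x + y) (p ∷ ps)
      GG-step x y (d , Y) ps l = begin
        ((λ I → x * (G x′ I + Y * E x′ I)) ⊛ G y) ps + (G x ⊛ (λ J → y * (G y′ J + Y * E y′ J))) ps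
          ≈⟨ +-cong (⊛-*ˡ x _ (G y) ps) (⊛-*ʳ y (G x) _ ps) ⟩
        x * ((λ I → G x′ I + Y * E x′ I) ⊛ G y) ps + y * (G x ⊛ (λ J → G y′ J + Y * E y′ J)) ps
          ≈⟨ +-cong (*-congˡ (trans (⊛-+ˡ _ _ (G y) ps) (+-congˡ (⊛-*ˡ Y _ _ ps))))
                    (*-congˡ (trans (⊛-+ʳ (G x) _ _ ps) (+-congˡ (⊛-*ʳ Y _ _ ps)))) ⟩
        x * ((G x′ ⊛ G y) ps + Y * (E x′ ⊛ G y) ps) + y * ((G x ⊛ G y′) ps + Y * (G x ⊛ E y′) ps)
          ≈⟨ +-cong
               (*-congˡ (+-cong (trans (GG x′ y ps l) (G-cong ps (swap-last x _ y)))
                                (*-congˡ (trans (EₓG x′ y ps l) (E-cong ps (swap-last x _ y))))))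
               (*-congˡ (+-cong (trans (GG x y′ ps l) (G-cong ps (sym (+-assoc x y _))))
                                (*-congˡ (trans (GEₓ x y′ ps l) (E-cong ps (sym (+-assoc x y _))))))) ⟩
        x * (G t ps + Y * E t ps) + y * (G t ps + Y * E t ps)
          ≈⟨ distribʳ _ x y ⟨
        (x + y) * (G t ps + Y * E t ps) ∎
        where
        x′ = x + ι d
        y′ = y + ι d
        t  = (x + y) + ι d

      E-∷ : ∀ x d Y ps → E x ((d , Y) ∷ ps) ≈
            ι d * (G (x + ι d) ps + Y * E (x + ι d) ps) +
            ((x + ι d) * E (x + ι d) ps + Y * ∂ (E (x + ι d)) ps)
      E-∷ x d Y ps = begin
        ι (d ℕ.+ degree ps) * (g + Y * e)         ≈⟨ *-congʳ (ι-+ d (degree ps)) ⟩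
        (ι d + ι (degree ps)) * (g + Y * e)
          ≈⟨ solve 5 (λ a b g Y e → (a :+ b) :* (g :+ Y :* e) := a :* (g :+ Y :* e) :+ (b :* g :+ Y :* (b :* e)))
                     refl _ _ _ _ _ ⟩
        ι d * (g + Y * e) + (ι (degree ps) * g + Y * (ι (degree ps) * e))
          ≈⟨ +-congˡ (+-congʳ (∂G (x + ι d) ps)) ⟩
        ι d * (g + Y * e) + ((x + ι d) * e + Y * ∂ (E (x + ι d)) ps) ∎
        where
        g = G (x + ι d) ps
        e = E (x + ι d) ps

      EG-step : ∀ y p ps → length ps ℕ.≤ k → (E 0# ⊛ G y) (p ∷ ps) ≈ E y (p ∷ ps)
      EG-step y p@(d , Y) ps l = begin
        ((λ I → E 0# (p ∷ I)) ⊛ G y) ps + (E 0# ⊛ (λ J → G y (p ∷ J))) ps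
          ≈⟨ +-cong first second ⟩
        (ι d * (G t ps + Y * E t ps) + (δ * E t ps + Y * (∂ (E δ) ⊛ G y) ps))
          + y * (E t ps + Y * (E δ ⊛ E y) ps)
          ≈⟨ solve 8 (λ a δ y Y g e u v →
               (a :* (g :+ Y :* e) :+ (δ :* e :+ Y :* u)) :+ y :* (e :+ Y :* v) :=
               a :* (g :+ Y :* e) :+ ((δ :+ y) :* e :+ Y :* (u :+ y :* v))) refl _ _ _ _ _ _ _ _ ⟩
        ι d * (G t ps + Y * E t ps) + ((δ + y) * E t ps + Y * ((∂ (E δ) ⊛ G y) ps + y * (E δ ⊛ E y) ps))
          ≈⟨ +-congˡ (+-cong (*-congʳ δ+y≈t) (*-congˡ (sym ∂E))) ⟩
        ι d * (G t ps + Y * E t ps) + (t * E t ps + Y * ∂ (E t) ps)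
          ≈⟨ E-∷ y d Y ps ⟨
        E y (p ∷ ps) ∎
        where
        δ = 0# + ι d
        t = y + ι d

        δ+y≈t : δ + y ≈ t
        δ+y≈t = solve 2 (λ d y → (con 0 :+ d) :+ y := y :+ d) refl (ι d) y

        ∂E : ∂ (E t) ps ≈ (∂ (E δ) ⊛ G y) ps + y * (E δ ⊛ E y) ps
        ∂E = begin
          ∂ (E t) ps                                ≈⟨ *-congˡ (trans (EₓG δ y ps l) (E-cong ps δ+y≈t)) ⟨
          ∂ (E δ ⊛ G y) ps                          ≈⟨ ∂-⊛ (E δ) (G y) ps ⟩
          (∂ (E δ) ⊛ G y) ps + (E δ ⊛ ∂ (G y)) ps   ≈⟨ +-congˡ (⊛-cong (λ _ → refl) (∂G y) ps) ⟩
          (∂ (E δ) ⊛ G y) ps + (E δ ⊛ (λ J → y * E y J)) ps ≈⟨ +-congˡ (⊛-*ʳ y (E δ) (E y) ps) ⟩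
          (∂ (E δ) ⊛ G y) ps + y * (E δ ⊛ E y) ps   ∎

        first : ((λ I → E 0# (p ∷ I)) ⊛ G y) ps ≈
                ι d * (G t ps + Y * E t ps) + (δ * E t ps + Y * (∂ (E δ) ⊛ G y) ps)
        first = begin
          ((λ I → E 0# (p ∷ I)) ⊛ G y) ps
            ≈⟨ ⊛-cong (E-∷ 0# d Y) (λ _ → refl) ps ⟩
          ((λ I → ι d * (G δ I + Y * E δ I) + (δ * E δ I + Y * ∂ (E δ) I)) ⊛ G y) ps
            ≈⟨ trans (⊛-+ˡ _ _ (G y) ps) (+-cong
                 (trans (⊛-*ˡ (ι d) _ (G y) ps) (*-congˡ
                   (trans (⊛-+ˡ _ _ (G y) ps) (+-congˡ (⊛-*ˡ Y (E δ) (G y) ps)))))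
                 (trans (⊛-+ˡ _ _ (G y) ps) (+-cong (⊛-*ˡ δ (E δ) (G y) ps) (⊛-*ˡ Y (∂ (E δ)) (G y) ps)))) ⟩
          ι d * ((G δ ⊛ G y) ps + Y * (E δ ⊛ G y) ps) + (δ * (E δ ⊛ G y) ps + Y * (∂ (E δ) ⊛ G y) ps)
            ≈⟨ +-cong (*-congˡ (+-cong (trans (GG δ y ps l) (G-cong ps δ+y≈t)) (*-congˡ Et)))
                      (+-congʳ (*-congˡ Et)) ⟩
          ι d * (G t ps + Y * E t ps) + (δ * E t ps + Y * (∂ (E δ) ⊛ G y) ps) ∎
          where
          Et : (E δ ⊛ G y) ps ≈ E t ps
          Et = trans (EₓG δ y ps l) (E-cong ps δ+y≈t)

        second : (E 0# ⊛ (λ J → G y (p ∷ J))) ps ≈ y * (E t ps + Y * (E δ ⊛ E y) ps)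
        second = begin
          (E 0# ⊛ (λ J → y * (G t J + Y * E t J))) ps
            ≈⟨ trans (⊛-*ʳ y (E 0#) _ ps) (*-congˡ (trans (⊛-+ʳ (E 0#) _ _ ps) (+-congˡ (⊛-*ʳ Y (E 0#) (E t) ps)))) ⟩
          y * ((E 0# ⊛ G t) ps + Y * (E 0# ⊛ E t) ps)
            ≈⟨ *-congˡ (+-cong (EG t ps l) (*-congˡ (sym (trans (EₓE δ y ps l)
                 (⊛-cong (λ _ → refl) (λ J → E-cong J δ+y≈t) ps))))) ⟩
          y * (E t ps + Y * (E δ ⊛ E y) ps) ∎

    both : ∀ k → (∀ x y ps → length ps ℕ.≤ k → (G x ⊛ G y) ps ≈ G (x + y) ps) ×
                 (∀ y ps → length ps ℕ.≤ k → (E 0# ⊛ G y) ps ≈ E y ps)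
    both k = GG k , EG k
      where
      GG : ∀ k x y ps → length ps ℕ.≤ k → (G x ⊛ G y) ps ≈ G (x + y) ps
      EG : ∀ k y ps → length ps ℕ.≤ k → (E 0# ⊛ G y) ps ≈ E y ps
      GG k       x y []       _ = *-identityˡ _
      GG (suc k) x y (p ∷ ps) (ℕ.s≤s l) = Step.GG-step k (GG k) (EG k) x y p ps l
      EG k       y []       _ = *-identityʳ _
      EG (suc k) y (p ∷ ps) (ℕ.s≤s l) = Step.EG-step k (GG k) (EG k) y p ps l

  -- The Abel–Hurwitz identity.
  G-⊛-G : ∀ x y ps → (G x ⊛ G y) ps ≈ G (x + y) ps
  G-⊛-G x y ps = proj₁ (both (length ps)) x y ps ℕ.≤-refl

  E-⊛-G : ∀ x y ps → (E x ⊛ G y) ps ≈ E (x + y) ps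
  E-⊛-G x y ps = let GG , EG = both (length ps) in Step.EₓG (length ps) GG EG x y ps ℕ.≤-refl

  ∑-cong : ∀ (xs : List A) {f g : A → Carrier} → (∀ x → f x ≈ g x) → ∑ xs f ≈ ∑ xs g
  ∑-cong []       eq = refl
  ∑-cong (x ∷ xs) eq = +-cong (eq x) (∑-cong xs eq)

  ∑-++ : ∀ (xs ys : List A) (f : A → Carrier) → ∑ (xs ++ ys) f ≈ ∑ xs f + ∑ ys f
  ∑-++ []       ys f = sym (+-identityˡ _)
  ∑-++ (x ∷ xs) ys f = trans (+-congˡ (∑-++ xs ys f)) (sym (+-assoc _ _ _))

  ∑-map : ∀ (g : A → B) xs (f : B → Carrier) → ∑ (map g xs) f ≈ ∑ xs (f ∘ g)
  ∑-map g []       f = refl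
  ∑-map g (x ∷ xs) f = +-congˡ (∑-map g xs f)

  ∑-+ : ∀ (xs : List A) (f g : A → Carrier) → ∑ xs (λ x → f x + g x) ≈ ∑ xs f + ∑ xs g
  ∑-+ []       f g = sym (+-identityˡ _)
  ∑-+ (x ∷ xs) f g = trans (+-congˡ (∑-+ xs f g)) (interchange _ _ _ _)

  ∑-* : ∀ y (xs : List A) (f : A → Carrier) → ∑ xs (λ x → y * f x) ≈ y * ∑ xs f
  ∑-* y []       f = sym (zeroʳ _)
  ∑-* y (x ∷ xs) f = trans (+-congˡ (∑-* y xs f)) (sym (distribˡ _ _ _))

  ∑-0 : ∀ (xs : List A) → ∑ xs (λ _ → 0#) ≈ 0#
  ∑-0 []       = refl
  ∑-0 (x ∷ xs) = trans (+-identityˡ _) (∑-0 xs)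

  ∑-swap : ∀ (xs : List A) (ys : List B) (f : A → B → Carrier) →
           ∑ xs (λ x → ∑ ys (f x)) ≈ ∑ ys (λ y → ∑ xs (λ x → f x y))
  ∑-swap []       ys f = sym (∑-0 ys)
  ∑-swap (x ∷ xs) ys f = trans (+-congˡ (∑-swap xs ys f)) (sym (∑-+ ys _ _))

  ∑-cartesianProductWith : ∀ {C : Set} (g : A → B → C) xs ys (f : C → Carrier) →
    ∑ (cartesianProductWith g xs ys) f ≈ ∑ xs (λ x → ∑ ys (λ y → f (g x y)))
  ∑-cartesianProductWith g []       ys f = refl
  ∑-cartesianProductWith g (x ∷ xs) ys f =
    trans (∑-++ (map (g x) ys) _ f) (+-cong (∑-map (g x) ys f) (∑-cartesianProductWith g xs ys f))

  ∑-distribute : ∀ (xs : List A) (h : A → List Item → List Item → Carrier) ps →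
    ∑ xs (λ x → distribute (h x) ps) ≈ distribute (λ I J → ∑ xs (λ x → h x I J)) ps
  ∑-distribute []       h ps = sym (distribute-0 ps)
  ∑-distribute (x ∷ xs) h ps =
    trans (+-congˡ (∑-distribute xs h ps)) (sym (distribute-+ _ _ ps))

  ∑-⊛ˡ : ∀ (xs : List A) (f : A → SetFun) g ps →
         ((λ I → ∑ xs (λ x → f x I)) ⊛ g) ps ≈ ∑ xs (λ x → (f x ⊛ g) ps)
  ∑-⊛ˡ xs f g ps = trans
    (distribute-cong ps λ _ → trans (*-comm _ _) (trans (sym (∑-* _ xs _)) (∑-cong xs λ _ → *-comm _ _)))
    (sym (∑-distribute xs (λ x I J → f x I * g J) ps))

  ∑-⊛ʳ : ∀ (xs : List A) f (g : A → SetFun) ps →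
         (f ⊛ (λ I → ∑ xs (λ x → g x I))) ps ≈ ∑ xs (λ x → (f ⊛ g x) ps)
  ∑-⊛ʳ xs f g ps = trans (⊛-comm _ _ ps)
    (trans (∑-⊛ˡ xs g f ps) (∑-cong xs λ x → ⊛-comm (g x) f ps))

  δ : ℕ → ℕ → Carrier
  δ zero    zero    = 1#
  δ (suc m) (suc n) = δ m n
  δ _       _       = 0#

  δ-subst : ∀ m n (f : ℕ → Carrier) → δ m n * f n ≈ δ m n * f m
  δ-subst zero    zero    f = refl
  δ-subst zero    (suc n) f = trans (zeroˡ _) (sym (zeroˡ _))
  δ-subst (suc m) zero    f = trans (zeroˡ _) (sym (zeroˡ _))
  δ-subst (suc m) (suc n) f = δ-subst m n (f ∘ suc)

  anti : (ℕ → ℕ → Carrier) → ℕ → Carrier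
  anti h zero    = h 0 0
  anti h (suc n) = h 0 (suc n) + anti (h ∘ suc) n

  anti-cong : ∀ {h h′} n → (∀ i j → i ℕ.+ j ≡ n → h i j ≈ h′ i j) → anti h n ≈ anti h′ n
  anti-cong zero    eq = eq 0 0 ≡.refl
  anti-cong (suc n) eq = +-cong (eq 0 (suc n) ≡.refl) (anti-cong n λ i j e → eq (suc i) j (≡.cong suc e))

  anti-+ : ∀ h h′ n → anti (λ i j → h i j + h′ i j) n ≈ anti h n + anti h′ n
  anti-+ h h′ zero    = refl
  anti-+ h h′ (suc n) = trans (+-congˡ (anti-+ _ _ n)) (interchange _ _ _ _)

  anti-* : ∀ x h n → anti (λ i j → x * h i j) n ≈ x * anti h n
  anti-* x h zero    = refl
  anti-* x h (suc n) = trans (+-congˡ (anti-* x _ n)) (sym (distribˡ _ _ _))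

  anti-0 : ∀ n → anti (λ _ _ → 0#) n ≈ 0#
  anti-0 zero    = refl
  anti-0 (suc n) = trans (+-identityˡ _) (anti-0 n)

  anti-suc : ∀ h n → anti h (suc n) ≈ anti (λ i j → h i (suc j)) n + h (suc n) 0
  anti-suc h zero    = refl
  anti-suc h (suc n) = trans (+-congˡ (anti-suc (h ∘ suc) n)) (sym (+-assoc _ _ _))

  anti-comm : ∀ h n → anti h n ≈ anti (flip h) n
  anti-comm h zero    = refl
  anti-comm h (suc n) = trans (+-comm _ _)
    (trans (+-congʳ (anti-comm (h ∘ suc) n)) (sym (anti-suc (flip h) n)))

  anti-assoc : ∀ (h : ℕ → ℕ → ℕ → Carrier) n →
    anti (λ i m → anti (λ j k → h i j k) m) n ≈ anti (λ m k → anti (λ i j → h i j k) m) n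
  anti-assoc h zero    = refl
  anti-assoc h (suc n) = begin
    (h 0 0 (suc n) + anti (λ j k → h 0 (suc j) k) n) + anti (λ i m → anti (λ j k → h (suc i) j k) m) n
      ≈⟨ +-assoc _ _ _ ⟩
    h 0 0 (suc n) + (anti (λ j k → h 0 (suc j) k) n + anti (λ i m → anti (λ j k → h (suc i) j k) m) n)
      ≈⟨ +-congˡ (+-congˡ (anti-assoc (h ∘ suc) n)) ⟩
    h 0 0 (suc n) + (anti (λ j k → h 0 (suc j) k) n + anti (λ m k → anti (λ i j → h (suc i) j k) m) n)
      ≈⟨ +-congˡ (anti-+ _ _ n) ⟨
    h 0 0 (suc n) + anti (λ m k → h 0 (suc m) k + anti (λ i j → h (suc i) j k) m) n ∎

  anti-distribute : ∀ (h : ℕ → ℕ → List Item → List Item → Carrier) n ps →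
    anti (λ i j → distribute (h i j) ps) n ≈ distribute (λ I J → anti (λ i j → h i j I J) n) ps
  anti-distribute h zero    ps = refl
  anti-distribute h (suc n) ps =
    trans (+-congˡ (anti-distribute (h ∘ suc) n ps)) (sym (distribute-+ _ _ ps))

  anti-δ : ∀ (h : ℕ → Carrier) n → anti (λ i j → δ 0 i * h j) n ≈ h n
  anti-δ h zero    = *-identityˡ _
  anti-δ h (suc n) = trans (+-cong (*-identityˡ _)
    (trans (anti-cong n λ _ _ _ → zeroˡ _) (anti-0 n))) (+-identityʳ _)

  anti-δδ : ∀ u v n → anti (λ i j → δ u i * δ v j) n ≈ δ (u ℕ.+ v) n
  anti-δδ zero    v n       = anti-δ (δ v) n
  anti-δδ (suc u) v zero    = zeroˡ _
  anti-δδ (suc u) v (suc n) = trans (+-congʳ (zeroˡ _)) (trans (+-identityˡ _) (anti-δδ u v n))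

  tailWeight : Carrier → ℕ → Carrier
  tailWeight Y zero    = 1#
  tailWeight Y (suc _) = Y

  anti-tailWeight : ∀ Y n → anti (λ _ t → tailWeight Y t) n ≈ 1# + ι n * Y
  anti-tailWeight Y zero    = sym (trans (+-congˡ (zeroˡ _)) (+-identityʳ _))
  anti-tailWeight Y (suc n) = trans (+-congˡ (anti-tailWeight Y n))
    (solve 2 (λ Y n → Y :+ (con 1 :+ n :* Y) := con 1 :+ (con 1 :+ n) :* Y) refl Y (ι n))

  ⊛-antiʳ : ∀ f (g : ℕ → ℕ → SetFun) n ps →
           (f ⊛ (λ I → anti (λ i j → g i j I) n)) ps ≈ anti (λ i j → (f ⊛ g i j) ps) n
  ⊛-antiʳ f g zero    ps = refl
  ⊛-antiʳ f g (suc n) ps = trans (⊛-+ʳ f _ _ ps) (+-congˡ (⊛-antiʳ f (g ∘ suc) n ps))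

  ⊛-antiˡ : ∀ (f : ℕ → ℕ → SetFun) g n ps →
           ((λ I → anti (λ i j → f i j I) n) ⊛ g) ps ≈ anti (λ i j → (f i j ⊛ g) ps) n
  ⊛-antiˡ f g zero    ps = refl
  ⊛-antiˡ f g (suc n) ps = trans (⊛-+ˡ _ _ g ps) (+-congˡ (⊛-antiˡ (f ∘ suc) g n ps))

  -- F m is G 1 restricted to the sets that can factor a cycle of length m.
  F : ℕ → SetFun
  F m I = δ (suc (degree I)) m * G 1# I

  Φ : List (List A) → SetFun
  Φ = foldr (λ b f → F (length b) ⊛ f) unit

  Φ-++ : ∀ (bs bs′ : List (List A)) ps → Φ (bs ++ bs′) ps ≈ (Φ bs ⊛ Φ bs′) ps
  Φ-++ []       bs′ ps = sym (⊛-identityˡ _ ps)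
  Φ-++ (b ∷ bs) bs′ ps = trans (⊛-cong (λ _ → refl) (Φ-++ bs bs′) ps) (sym (⊛-assoc _ _ _ ps))

  private
    ∑-cuts : ∀ k (f : Cut A → Carrier) (g : ℕ → List (Piece A) → List A → Carrier) (K : ℕ → ℕ → Carrier) →
      (∀ is e as t → f ((is , e) ∷ as , t) ≈ g (length is) as t) →
      (∀ i xs → ∑ (cuts k xs) (λ (as , t) → g i as t) ≈ K i (length xs)) →
      ∀ x xs → ∑ (cuts (suc k) (x ∷ xs)) f ≈ anti K (length xs)
    ∑-cuts k f g K fg gK x xs = begin
      ∑ (map (newPiece x) (cuts k xs) ++ map (extend x) (cuts (suc k) xs)) f
        ≈⟨ ∑-++ (map (newPiece x) (cuts k xs)) _ f ⟩
      ∑ (map (newPiece x) (cuts k xs)) f + ∑ (map (extend x) (cuts (suc k) xs)) f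
        ≈⟨ +-cong (trans (∑-map (newPiece x) (cuts k xs) f)
                     (trans (∑-cong (cuts k xs) λ (as , t) → fg [] x as t) (gK 0 xs)))
                  (∑-map (extend x) (cuts (suc k) xs) f) ⟩
      K 0 (length xs) + ∑ (cuts (suc k) xs) (f ∘ extend x)
        ≈⟨ rest xs ⟩
      anti K (length xs) ∎
      where
      rest : ∀ ys → K 0 (length ys) + ∑ (cuts (suc k) ys) (f ∘ extend x) ≈ anti K (length ys)
      rest []       = +-identityʳ _
      rest (y ∷ ys) = +-congˡ (∑-cuts k (f ∘ extend x) (g ∘ suc) (K ∘ suc)
        (λ is → fg (x ∷ is)) (gK ∘ suc) y ys)

    C : ℕ → ℕ → SetFun
    C k q I = δ (k ℕ.+ degree I) q * G (ι k) I

    F⊛C : ∀ k m ps → anti (λ i q → (F (suc i) ⊛ C k q) ps) m ≈ C (suc k) (suc m) ps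
    F⊛C k m ps = begin
      anti (λ i q → (F (suc i) ⊛ C k q) ps) m
        ≈⟨ anti-distribute _ m ps ⟩
      distribute (λ I J → anti (λ i q → F (suc i) I * C k q J) m) ps
        ≈⟨ distribute-cong ps (λ {I} {J} i → begin
             anti (λ i q → (δ (degree I) i * G 1# I) * (δ (k ℕ.+ degree J) q * G (ι k) J)) m
               ≈⟨ anti-cong m (λ _ _ _ → solve 4 (λ a x b y → (a :* x) :* (b :* y) := (x :* y) :* (a :* b)) refl _ _ _ _) ⟩
             anti (λ i q → (G 1# I * G (ι k) J) * (δ (degree I) i * δ (k ℕ.+ degree J) q)) m
               ≈⟨ trans (anti-* _ _ m) (*-congˡ (anti-δδ (degree I) _ m)) ⟩
             (G 1# I * G (ι k) J) * δ (degree I ℕ.+ (k ℕ.+ degree J)) m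
               ≡⟨ ≡.cong (λ e → (G 1# I * G (ι k) J) * δ e m) (≡.trans (x∙yz≈y∙xz (degree I) k (degree J))
                    (≡.cong (k ℕ.+_) (degree-interleaving i))) ⟩
             (G 1# I * G (ι k) J) * δ (k ℕ.+ degree ps) m
               ≈⟨ *-comm _ _ ⟩
             δ (k ℕ.+ degree ps) m * (G 1# I * G (ι k) J) ∎) ⟩
      distribute (λ I J → δ (k ℕ.+ degree ps) m * (G 1# I * G (ι k) J)) ps
        ≈⟨ distribute-* _ _ ps ⟩
      δ (k ℕ.+ degree ps) m * (G 1# ⊛ G (ι k)) ps
        ≈⟨ *-congˡ (G-⊛-G 1# (ι k) ps) ⟩
      δ (k ℕ.+ degree ps) m * G (1# + ι k) ps ∎
      where open import Algebra.Properties.CommutativeSemigroup ℕ.+-commutativeSemigroup using (x∙yz≈y∙xz)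

    C-zero : ∀ q ps → C 0 q ps ≈ δ 0 q * unit ps
    C-zero q []       = refl
    C-zero q (p ∷ ps) = trans (*-congˡ (zeroˡ _)) (trans (zeroʳ _) (sym (zeroʳ _)))

    ∑-cuts-Φ : ∀ k (H : ℕ → SetFun) (xs : List A) ps →
      ∑ (cuts k xs) (λ (as , t) → (Φ (map pieceBlock as) ⊛ H (length t)) ps) ≈
      anti (λ q t → (C k q ⊛ H t) ps) (length xs)
    ∑-cuts-Φ zero H xs ps = begin
      (unit ⊛ H (length xs)) ps + 0#   ≈⟨ +-identityʳ _ ⟩
      (unit ⊛ H (length xs)) ps        ≈⟨ anti-δ (λ t → (unit ⊛ H t) ps) (length xs) ⟨
      anti (λ q t → δ 0 q * (unit ⊛ H t) ps) (length xs)
        ≈⟨ anti-cong (length xs) (λ q t _ → trans (sym (⊛-*ˡ (δ 0 q) unit (H t) ps))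
             (⊛-cong (λ I → sym (C-zero q I)) (λ _ → refl) ps)) ⟩
      anti (λ q t → (C 0 q ⊛ H t) ps) (length xs) ∎
    ∑-cuts-Φ (suc k) H [] ps =
      sym (trans (⊛-cong (λ _ → zeroˡ _) (λ _ → refl) ps)
        (trans (distribute-* 0# (λ _ J → H 0 J) ps) (zeroˡ _)))
    ∑-cuts-Φ (suc k) H (x ∷ xs) ps = begin
      ∑ (cuts (suc k) (x ∷ xs)) (λ (as , t) → (Φ (map pieceBlock as) ⊛ H (length t)) ps)
        ≈⟨ ∑-cuts k _ (λ i as t → (F (suc i) ⊛ (Φ (map pieceBlock as) ⊛ H (length t))) ps) _
             (λ is e as t → trans (⊛-assoc _ _ _ ps)
               (reflexive (≡.cong (λ m → (F m ⊛ (Φ (map pieceBlock as) ⊛ H (length t))) ps) (length-snoc is e))))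
             (λ i ys → trans (sym (∑-⊛ʳ (cuts k ys) (F (suc i)) _ ps))
               (⊛-cong (λ _ → refl) (∑-cuts-Φ k H ys) ps)) x xs ⟩
      anti (λ i m → (F (suc i) ⊛ (λ S → anti (λ q t → (C k q ⊛ H t) S) m)) ps) (length xs)
        ≈⟨ anti-cong (length xs) (λ i m _ → trans (⊛-antiʳ _ _ m ps)
             (anti-cong m λ q t _ → sym (⊛-assoc _ _ _ ps))) ⟩
      anti (λ i m → anti (λ q t → ((F (suc i) ⊛ C k q) ⊛ H t) ps) m) (length xs)
        ≈⟨ anti-assoc _ (length xs) ⟩
      anti (λ m t → anti (λ i q → ((F (suc i) ⊛ C k q) ⊛ H t) ps) m) (length xs)
        ≈⟨ anti-cong (length xs) (λ m t _ → trans (sym (⊛-antiˡ _ _ m ps))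
             (⊛-cong (F⊛C k m) (λ _ → refl) ps)) ⟩
      anti (λ m t → (C (suc k) (suc m) ⊛ H t) ps) (length xs)
        ≈⟨ +-identityˡ _ ⟨
      0# + anti (λ m t → (C (suc k) (suc m) ⊛ H t) ps) (length xs)
        ≈⟨ +-congʳ (sym (trans (⊛-cong (λ _ → zeroˡ _) (λ _ → refl) ps)
             (trans (distribute-* 0# (λ _ J → H (suc (length xs)) J) ps) (zeroˡ _)))) ⟩
      anti (λ q t → (C (suc k) q ⊛ H t) ps) (suc (length xs)) ∎
      where
      length-snoc : ∀ (is : List A) e → length (is ++ e ∷ []) ≡ suc (length is)
      length-snoc is e = ≡.trans (length-++ is) (ℕ.+-comm (length is) 1)

  F-∷ : ∀ k Y (xs : List A) ps →
    F (length xs) ((k , Y) ∷ ps) ≈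
    ∑ (cuts (suc k) xs) (λ cut → tailWeight Y (length (proj₂ cut)) * Φ (cutBlocks cut) ps)
  F-∷ k Y []       ps = zeroˡ _
  F-∷ k Y (x ∷ xs) ps = sym (begin
    ∑ (cuts (suc k) (x ∷ xs)) (λ cut → tailWeight Y (length (proj₂ cut)) * Φ (cutBlocks cut) ps)
      ≈⟨ ∑-cuts k _ (λ i as t → (Φ (map pieceBlock as) ⊛ H i (length t)) ps) _
           (λ is e as t → trans (sym (⊛-*ˡ _ _ _ ps)) (trans (⊛-comm _ _ ps) (reflexive (≡.cong
             (λ m → (Φ (map pieceBlock as) ⊛ (λ I → tailWeight Y (length t) * F m I)) ps)
             (≡.trans (length-++ is) (ℕ.+-suc (length is) (length t)))))))
           (λ i ys → ∑-cuts-Φ k (H i) ys ps) x xs ⟩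
    anti (λ i m → anti (λ q t → (C k q ⊛ H i t) ps) m) N
      ≈⟨ anti-cong N (λ i m _ → anti-distribute _ m ps) ⟩
    anti (λ i m → distribute (λ J I → anti (λ q t → C k q J * H i t I) m) ps) N
      ≈⟨ anti-distribute _ N ps ⟩
    distribute (λ J I → anti (λ i m → anti (λ q t → C k q J * H i t I) m) N) ps
      ≈⟨ distribute-cong ps (λ {J} {I} i → trans (scalar (k ℕ.+ degree J) (degree I) _ _)
           (reflexive (≡.cong (λ e → δ e N * (G (ι k) J * ((1# + ι (degree I) * Y) * G 1# I)))
             (≡.trans (ℕ.+-assoc k _ _) (≡.cong (k ℕ.+_) (degree-interleaving i)))))) ⟩
    distribute (λ J I → δ (k ℕ.+ degree ps) N * (G (ι k) J * ((1# + ι (degree I) * Y) * G 1# I))) ps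
      ≈⟨ distribute-* _ _ ps ⟩
    δ (k ℕ.+ degree ps) N * (G (ι k) ⊛ (λ I → (1# + ι (degree I) * Y) * G 1# I)) ps
      ≈⟨ *-congˡ (begin
           (G (ι k) ⊛ (λ I → (1# + ι (degree I) * Y) * G 1# I)) ps
             ≈⟨ ⊛-cong (λ _ → refl) (λ I → trans
                  (solve 3 (λ d Y g → (con 1 :+ d :* Y) :* g := g :+ Y :* (d :* g)) refl _ _ _)
                  (+-congˡ (*-congˡ (trans (∂G 1# I) (*-identityˡ _))))) ps ⟩
           (G (ι k) ⊛ (λ I → G 1# I + Y * E 1# I)) ps
             ≈⟨ ⊛-comm (G (ι k)) _ ps ⟩
           ((λ I → G 1# I + Y * E 1# I) ⊛ G (ι k)) ps
             ≈⟨ trans (⊛-+ˡ _ _ _ ps) (+-congˡ (⊛-*ˡ Y _ _ ps)) ⟩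
           (G 1# ⊛ G (ι k)) ps + Y * (E 1# ⊛ G (ι k)) ps
             ≈⟨ +-cong (G-⊛-G 1# (ι k) ps) (*-congˡ (E-⊛-G 1# (ι k) ps)) ⟩
           P 1# ((k , Y) ∷ ps)
             ≈⟨ *-identityˡ _ ⟨
           G 1# ((k , Y) ∷ ps) ∎) ⟩
    F (suc N) ((k , Y) ∷ ps) ∎)
    where
    N = length xs

    H : ℕ → ℕ → SetFun
    H i t I = tailWeight Y t * F (suc (i ℕ.+ t)) I

    scalar : ∀ v u a b →
      anti (λ i m → anti (λ q t → (δ v q * a) * (tailWeight Y t * (δ u (i ℕ.+ t) * b))) m) N ≈
      δ (v ℕ.+ u) N * (a * ((1# + ι u * Y) * b))
    scalar v u a b = begin
      anti (λ i m → anti (λ q t → (δ v q * a) * (tailWeight Y t * (δ u (i ℕ.+ t) * b))) m) N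
        ≈⟨ anti-cong N (λ i m _ → trans (anti-comm _ m) (anti-cong m λ t q _ →
             solve 5 (λ x a w y b → (x :* a) :* (w :* (y :* b)) := x :* ((a :* b) :* (w :* y))) refl _ _ _ _ _)) ⟩
      anti (λ i m → anti (λ t q → δ v q * ((a * b) * (tailWeight Y t * δ u (i ℕ.+ t)))) m) N
        ≈⟨ trans (anti-assoc _ N) (anti-comm _ N) ⟩
      anti (λ q m → anti (λ i t → δ v q * ((a * b) * (tailWeight Y t * δ u (i ℕ.+ t)))) m) N
        ≈⟨ anti-cong N (λ q m _ → trans (anti-* _ _ m) (*-congˡ (trans (anti-* _ _ m) (*-congˡ (begin
             anti (λ i t → tailWeight Y t * δ u (i ℕ.+ t)) m
               ≈⟨ anti-cong m (λ i t e → trans (*-comm _ _) (*-congʳ (reflexive (≡.cong (δ u) e)))) ⟩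
             anti (λ i t → δ u m * tailWeight Y t) m
               ≈⟨ trans (anti-* _ _ m) (*-congˡ (anti-tailWeight Y m)) ⟩
             δ u m * (1# + ι m * Y)
               ≈⟨ δ-subst u m (λ e → 1# + ι e * Y) ⟩
             δ u m * (1# + ι u * Y) ∎))))) ⟩
      anti (λ q m → δ v q * ((a * b) * (δ u m * (1# + ι u * Y)))) N
        ≈⟨ anti-cong N (λ _ _ _ → solve 5 (λ x a b y w → x :* ((a :* b) :* (y :* w)) := (a :* (w :* b)) :* (x :* y))
             refl _ _ _ _ _) ⟩
      anti (λ q m → (a * ((1# + ι u * Y) * b)) * (δ v q * δ u m)) N
        ≈⟨ trans (anti-* _ _ N) (*-congˡ (anti-δδ v u N)) ⟩
      (a * ((1# + ι u * Y) * b)) * δ (v ℕ.+ u) N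
        ≈⟨ *-comm _ _ ⟩
      δ (v ℕ.+ u) N * (a * ((1# + ι u * Y) * b)) ∎

  if-yes : ∀ {x y} (d : Dec Hyp₁) → Hyp₁ → (if does d then x else y) ≈ x
  if-yes (yes _) p = refl
  if-yes (no ¬p) p = contradiction p ¬p

  if-no : ∀ {x y} (d : Dec Hyp₁) → ¬ Hyp₁ → (if does d then x else y) ≈ y
  if-no (yes p) ¬p = contradiction p ¬p
  if-no (no _)  ¬p = refl

  if-cong : ∀ {x y} (d : Dec Hyp₁) (e : Dec Hyp₂) → (Hyp₁ → Hyp₂) → (Hyp₂ → Hyp₁) →
            (if does d then x else y) ≈ (if does e then x else y)
  if-cong (yes p) e f g = sym (if-yes e (f p))
  if-cong (no ¬p) e f g = sym (if-no e (¬p ∘ g))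

  ⟦_⟧ : Dec Hyp₁ → Carrier
  ⟦ d ⟧ = if does d then 1# else 0#

  ⟦⟧-yes : ∀ (d : Dec Hyp₁) → Hyp₁ → ⟦ d ⟧ ≈ 1#
  ⟦⟧-yes d = if-yes d

  ⟦⟧-no : ∀ (d : Dec Hyp₁) → ¬ Hyp₁ → ⟦ d ⟧ ≈ 0#
  ⟦⟧-no d = if-no d

  ⟦⟧-cong : ∀ (d : Dec Hyp₁) (e : Dec Hyp₂) → (Hyp₁ → Hyp₂) → (Hyp₂ → Hyp₁) → ⟦ d ⟧ ≈ ⟦ e ⟧
  ⟦⟧-cong d e = if-cong d e

  ⟦⟧-× : ∀ (s : Dec Hyp) (d : Dec Hyp₁) (e : Dec Hyp₂) {x y x′} → (Hyp → Hyp₁) → (Hyp₁ → Hyp → Hyp₂) → (Hyp₁ → Hyp₂ → Hyp) →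
         (Hyp → x ≈ y * x′) → ⟦ s ⟧ * x ≈ ⟦ d ⟧ * (y * (⟦ e ⟧ * x′))
  ⟦⟧-× (yes s) (yes p) e       f g h eq = trans (*-congˡ (eq s)) (*-congˡ (*-congˡ
    (sym (trans (*-congʳ (⟦⟧-yes e (g p s))) (*-identityˡ _)))))
  ⟦⟧-× (yes s) (no ¬p) e       f g h eq = contradiction (f s) ¬p
  ⟦⟧-× (no ¬s) (yes p) (yes q) f g h eq = contradiction (h p q) ¬s
  ⟦⟧-× (no ¬s) (yes p) (no ¬q) f g h eq =
    trans (zeroˡ _) (sym (trans (*-identityˡ _) (trans (*-congˡ (zeroˡ _)) (zeroʳ _))))
  ⟦⟧-× (no ¬s) (no ¬p) e       f g h eq = trans (zeroˡ _) (sym (zeroˡ _))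

  ∑-cong-∈ : ∀ (xs : List A) {f g : A → Carrier} → (∀ {x} → x ∈ xs → f x ≈ g x) → ∑ xs f ≈ ∑ xs g
  ∑-cong-∈ []       eq = refl
  ∑-cong-∈ (x ∷ xs) eq = +-cong (eq (here ≡.refl)) (∑-cong-∈ xs (eq ∘ there))

  ∑-filter : ∀ {P : A → Set} (P? : Decidable P) xs (f : A → Carrier) →
             ∑ (filter P? xs) f ≈ ∑ xs (λ x → ⟦ P? x ⟧ * f x)
  ∑-filter P? []       f = refl
  ∑-filter P? (x ∷ xs) f with P? x
  ... | yes _ = +-cong (sym (*-identityˡ _)) (∑-filter P? xs f)
  ... | no  _ = trans (∑-filter P? xs f) (sym (trans (+-congʳ (zeroˡ _)) (+-identityˡ _)))

  -- The key e distinguishes the indices of the list.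
  ∑-single : ∀ {P : A → Set} (P? : Decidable P) (e : A → B) xs (f : A → Carrier) {x} →
             x ∈ xs → P x → (∀ {y} → y ∈ xs → P y → e y ≡ e x) → Unique (map e xs) →
             ∑ xs (λ y → ⟦ P? y ⟧ * f y) ≈ f x
  ∑-single P? e (x ∷ xs) f (here ≡.refl) Px same (x≢ ∷ _) = begin
    ⟦ P? x ⟧ * f x + ∑ xs (λ y → ⟦ P? y ⟧ * f y)
      ≈⟨ +-cong (trans (*-congʳ (⟦⟧-yes (P? x) Px)) (*-identityˡ _))
           (trans (∑-cong-∈ xs λ {y} y∈ → trans (*-congʳ (⟦⟧-no (P? y) λ Py →
              All.lookup x≢ (∈-map⁺ e y∈) (≡.sym (same (there y∈) Py)))) (zeroˡ _)) (∑-0 xs)) ⟩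
    f x + 0# ≈⟨ +-identityʳ _ ⟩
    f x ∎
  ∑-single P? e (y ∷ xs) f {x} (there x∈) Px same (y≢ ∷ u) = begin
    ⟦ P? y ⟧ * f y + ∑ xs (λ y → ⟦ P? y ⟧ * f y)
      ≈⟨ +-cong (trans (*-congʳ (⟦⟧-no (P? y) λ Py → All.lookup y≢ (∈-map⁺ e x∈) (same (here ≡.refl) Py))) (zeroˡ _))
           (∑-single P? e xs f x∈ Px (same ∘ there) u) ⟩
    0# + f x ≈⟨ +-identityˡ _ ⟩
    f x ∎

  infix 4 _≗?_

  _≗?_ : (z w : Permutation′ n) → Dec (∀ t → z ⟨$⟩ʳ t ≡ w ⟨$⟩ʳ t)
  z ≗? w = all? λ t → z ⟨$⟩ʳ t ≟ w ⟨$⟩ʳ t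

  ∑-permutations : ∀ {n} (w : Permutation′ n) (h : Permutation′ n → Carrier) →
    (∀ {z z′} → (∀ t → z ⟨$⟩ʳ t ≡ z′ ⟨$⟩ʳ t) → h z ≈ h z′) →
    ∑ (permutations n) (λ z → ⟦ z ≗? w ⟧ * h z) ≈ h w
  ∑-permutations {zero}  w h resp =
    trans (+-identityʳ _) (trans (*-congʳ (⟦⟧-yes (Perm.id ≗? w) λ ())) (trans (*-identityˡ _) (resp λ ())))
  ∑-permutations {suc n} w h resp = begin
    ∑ (permutations (suc n)) (λ z → ⟦ z ≗? w ⟧ * h z)
      ≈⟨ ∑-cartesianProductWith (insert zero) (allFin (suc n)) (permutations n) _ ⟩
    ∑ (allFin (suc n)) (λ j → ∑ (permutations n) (λ z → ⟦ insert zero j z ≗? w ⟧ * h (insert zero j z)))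
      ≈⟨ ∑-cong (allFin (suc n)) (λ j → begin
           ∑ (permutations n) (λ z → ⟦ insert zero j z ≗? w ⟧ * h (insert zero j z))
             ≈⟨ ∑-cong (permutations n) (λ z → trans
                  (⟦⟧-× (insert zero j z ≗? w) (j ≟ j₀) (z ≗? w′) {y = 1#} head (λ { ≡.refl → tail z }) (λ { ≡.refl → join z })
                    (λ _ → sym (*-identityˡ _)))
                  (*-congˡ (*-identityˡ _))) ⟩
           ∑ (permutations n) (λ z → ⟦ j ≟ j₀ ⟧ * (⟦ z ≗? w′ ⟧ * h (insert zero j z)))
             ≈⟨ ∑-* ⟦ j ≟ j₀ ⟧ (permutations n) _ ⟩
           ⟦ j ≟ j₀ ⟧ * ∑ (permutations n) (λ z → ⟦ z ≗? w′ ⟧ * h (insert zero j z))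
             ≈⟨ *-congˡ (∑-permutations w′ (h ∘ insert zero j) λ {z} {z′} eq → resp (insert-cong j {z} {z′} eq)) ⟩
           ⟦ j ≟ j₀ ⟧ * h (insert zero j w′) ∎) ⟩
    ∑ (allFin (suc n)) (λ j → ⟦ j ≟ j₀ ⟧ * h (insert zero j w′))
      ≈⟨ ∑-single (_≟ j₀) id (allFin (suc n)) (λ j → h (insert zero j w′)) (∈-allFin j₀) ≡.refl (λ _ eq → eq)
           (≡.subst Unique (≡.sym (map-id (allFin (suc n)))) (Unique.allFin⁺ (suc n))) ⟩
    h (insert zero j₀ w′)
      ≈⟨ resp (join w′ λ _ → ≡.refl) ⟩
    h w ∎
    where
    j₀ = w ⟨$⟩ʳ zero
    w′ = remove zero w

    insert-cong : ∀ j {z z′ : Permutation′ n} → (∀ t → z ⟨$⟩ʳ t ≡ z′ ⟨$⟩ʳ t) →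
                  ∀ t → insert zero j z ⟨$⟩ʳ t ≡ insert zero j z′ ⟨$⟩ʳ t
    insert-cong j eq zero    = ≡.refl
    insert-cong j eq (suc t) = ≡.cong (punchIn j) (eq t)

    head : ∀ {j} {z : Permutation′ n} → (∀ t → insert zero j z ⟨$⟩ʳ t ≡ w ⟨$⟩ʳ t) → j ≡ j₀
    head eq = eq zero

    tail : ∀ (z : Permutation′ n) → (∀ t → insert zero j₀ z ⟨$⟩ʳ t ≡ w ⟨$⟩ʳ t) → ∀ t → z ⟨$⟩ʳ t ≡ w′ ⟨$⟩ʳ t
    tail z eq t = punchIn-injective j₀ _ _ (≡.trans (eq (suc t)) (punchIn-permute w zero t))

    join : ∀ (z : Permutation′ n) → (∀ t → z ⟨$⟩ʳ t ≡ w′ ⟨$⟩ʳ t) → ∀ t → insert zero j₀ z ⟨$⟩ʳ t ≡ w ⟨$⟩ʳ t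
    join z eq zero    = ≡.refl
    join z eq (suc t) = ≡.trans (≡.cong (punchIn j₀) (eq t)) (≡.sym (punchIn-permute w zero t))

  ∑-vectors-∷ʳ : ∀ (xs : List A) r (f : Vec A (suc r) → Carrier) →
    ∑ (vectors xs (suc r)) f ≈ ∑ xs (λ x → ∑ (vectors xs r) (λ v → f (v ∷ʳ x)))
  ∑-vectors-∷ʳ xs zero    f = ∑-cartesianProductWith _∷_ xs ([] ∷ []) f
  ∑-vectors-∷ʳ xs (suc r) f = begin
    ∑ (vectors xs (suc (suc r))) f
      ≈⟨ ∑-cartesianProductWith _∷_ xs (vectors xs (suc r)) f ⟩
    ∑ xs (λ y → ∑ (vectors xs (suc r)) (λ v → f (y ∷ v)))
      ≈⟨ ∑-cong xs (λ y → ∑-vectors-∷ʳ xs r (f ∘ (y ∷_))) ⟩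
    ∑ xs (λ y → ∑ xs (λ x → ∑ (vectors xs r) (λ v → f (y ∷ (v ∷ʳ x)))))
      ≈⟨ ∑-swap xs xs _ ⟩
    ∑ xs (λ x → ∑ xs (λ y → ∑ (vectors xs r) (λ v → f (y ∷ (v ∷ʳ x)))))
      ≈⟨ ∑-cong xs (λ x → sym (∑-cartesianProductWith _∷_ xs (vectors xs r) (λ v → f (v ∷ʳ x)))) ⟩
    ∑ xs (λ x → ∑ (vectors xs (suc r)) (λ v → f (v ∷ʳ x))) ∎

  abstract
    factors? : ∀ (d : Vec ℕ r) (zs : Vec (Permutation′ n) r) w → Dec (Factors d zs w)
    factors? {r} d zs w =
      all? (λ i → isCycle? (suc (lookup d i)) (lookup zs i)) ×-dec
      all? (λ t → product zs r ⟨$⟩ʳ t ≟ w t)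

  factors-cong : ∀ (d : Vec ℕ r) (zs : Vec (Permutation′ n) r) {u w} → (∀ t → u t ≡ w t) → Factors d zs u → Factors d zs w
  factors-cong d zs eq (cycles , prod) = cycles , λ t → ≡.trans (prod t) (eq t)

  stepWeight : Carrier → ℕ → (Fin n → Fin n) → (Fin n → Fin n) → Carrier
  stepWeight Y a u w = if does (intervalStep? a u w) then 1# else Y

  stepWeight-yes : ∀ {Y a} {u w : Fin n → Fin n} → IntervalStep a u w → stepWeight Y a u w ≈ 1#
  stepWeight-yes {a = a} {u} {w} = if-yes (intervalStep? a u w)

  stepWeight-no : ∀ {Y a} {u w : Fin n → Fin n} → ¬ IntervalStep a u w → stepWeight Y a u w ≈ Y
  stepWeight-no {a = a} {u} {w} = if-no (intervalStep? a u w)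

  stepWeight-cong : ∀ {Y a} {u u′ w w′ : Fin n → Fin n} → (∀ t → u t ≡ u′ t) → (∀ t → w t ≡ w′ t) →
                    stepWeight Y a u w ≈ stepWeight Y a u′ w′
  stepWeight-cong {Y = Y} {a} {u} {u′} {w} {w′} u≗ w≗ = if-cong (intervalStep? a u w) (intervalStep? a u′ w′)
    (intervalStep-cong u≗ w≗) (intervalStep-cong (λ t → ≡.sym (u≗ t)) (λ t → ≡.sym (w≗ t)))

  factorWeight : Vec ℕ r → Vec Carrier r → Vec (Permutation′ n) r → Fin r → Carrier
  factorWeight d Y zs j = stepWeight (lookup Y j) (suc (lookup d j))
    (product zs (toℕ j) ⟨$⟩ʳ_) (product zs (suc (toℕ j)) ⟨$⟩ʳ_)

  totalWeight : Vec ℕ r → Vec Carrier r → Vec (Permutation′ n) r → Carrier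
  totalWeight d Y zs = ∏ (factorWeight d Y zs)

  totalWeight-∷ʳ : ∀ (d : Vec ℕ r) Y (zs : Vec (Permutation′ n) r) k y z →
    totalWeight (d ∷ʳ k) (Y ∷ʳ y) (zs ∷ʳ z) ≈
    totalWeight d Y zs * stepWeight y (suc k) (product zs r ⟨$⟩ʳ_) (product (zs ∷ʳ z) (suc r) ⟨$⟩ʳ_)
  totalWeight-∷ʳ {r} {n} d Y zs k y z = trans (sum-init-last extended)
    (*-cong (sum-cong-≋ {r} {extended ∘ inject₁} {factorWeight d Y zs} λ j → reflexive (init j)) (reflexive last))
    where
    extended : Fin (suc r) → Carrier
    extended = factorWeight (d ∷ʳ k) (Y ∷ʳ y) (zs ∷ʳ z)

    weight : Carrier → ℕ → Permutation′ n → Permutation′ n → Carrier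
    weight Y k u w = stepWeight Y (suc k) (u ⟨$⟩ʳ_) (w ⟨$⟩ʳ_)

    weight-≡ : ∀ {Y Y′ k k′} {u u′ w w′ : Permutation′ n} → Y ≡ Y′ → k ≡ k′ → u ≡ u′ → w ≡ w′ → weight Y k u w ≡ weight Y′ k′ u′ w′
    weight-≡ ≡.refl ≡.refl ≡.refl ≡.refl = ≡.refl

    init : ∀ j → factorWeight (d ∷ʳ k) (Y ∷ʳ y) (zs ∷ʳ z) (inject₁ j) ≡ factorWeight d Y zs j
    init j rewrite Fin.toℕ-inject₁ j = weight-≡ (lookup-∷ʳ-inject₁ Y y j) (lookup-∷ʳ-inject₁ d k j)
      (product-∷ʳ zs z (ℕ.<⇒≤ (Fin.toℕ<n j))) (product-∷ʳ zs z (Fin.toℕ<n j))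

    last : factorWeight (d ∷ʳ k) (Y ∷ʳ y) (zs ∷ʳ z) (fromℕ r) ≡ weight y k (product zs r) (product (zs ∷ʳ z) (suc r))
    last rewrite Fin.toℕ-fromℕ r = weight-≡ {w = product (zs ∷ʳ z) (suc r)}
      (lookup-∷ʳ-fromℕ Y y) (lookup-∷ʳ-fromℕ d k) (product-∷ʳ zs z (ℕ.≤-refl {r})) ≡.refl

  weightedCount : Vec ℕ r → Vec Carrier r → (Fin n → Fin n) → Carrier
  weightedCount {r} {n} d Y w = ∑ (vectors (permutations n) r) (λ zs → ⟦ factors? d zs w ⟧ * totalWeight d Y zs)

  weightedCount-cong : ∀ (d : Vec ℕ r) Y {u w : Fin n → Fin n} → (∀ t → u t ≡ w t) → weightedCount d Y u ≈ weightedCount d Y w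
  weightedCount-cong {r} {n} d Y {u} {w} eq = ∑-cong (vectors (permutations n) r) λ zs → *-congʳ
    (⟦⟧-cong (factors? d zs u) (factors? d zs w) (factors-cong d zs eq) (factors-cong d zs λ t → ≡.sym (eq t)))

  lastTerm : Vec ℕ r → Vec Carrier r → ℕ → Carrier → (Fin n → Fin n) → Permutation′ n → Carrier
  lastTerm d Y k y w z = ⟦ isCycle? (suc k) z ⟧ *
    (stepWeight y (suc k) (λ t → w (z ⟨$⟩ˡ t)) w * weightedCount d Y (λ t → w (z ⟨$⟩ˡ t)))

  lastTerm-cong : ∀ (d : Vec ℕ r) Y k y (w : Fin n → Fin n) {z z′} → (∀ t → z ⟨$⟩ʳ t ≡ z′ ⟨$⟩ʳ t) →
                  lastTerm d Y k y w z ≈ lastTerm d Y k y w z′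
  lastTerm-cong d Y k y w {z} {z′} eq = *-cong
    (⟦⟧-cong (isCycle? (suc k) z) (isCycle? (suc k) z′) (isCycle-cong {z = z} {z′} eq)
      (isCycle-cong {z = z′} {z} λ t → ≡.sym (eq t)))
    (*-cong (stepWeight-cong (λ t → ≡.cong w (eq⁻¹ t)) (λ _ → ≡.refl)) (weightedCount-cong d Y λ t → ≡.cong w (eq⁻¹ t)))
    where
    eq⁻¹ : ∀ t → z ⟨$⟩ˡ t ≡ z′ ⟨$⟩ˡ t
    eq⁻¹ t = ≡.trans (≡.cong (z ⟨$⟩ˡ_) (≡.trans (≡.sym (inverseʳ z′)) (≡.sym (eq _)))) (inverseˡ z)

  weightedCount-∷ʳ : ∀ (d : Vec ℕ r) Y k y (w : Fin n → Fin n) →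
    weightedCount (d ∷ʳ k) (Y ∷ʳ y) w ≈ ∑ (permutations n) (lastTerm d Y k y w)
  weightedCount-∷ʳ {r} {n} d Y k y w = begin
    ∑ (vectors (permutations n) (suc r)) _
      ≈⟨ ∑-vectors-∷ʳ (permutations n) r _ ⟩
    ∑ (permutations n) (λ z → ∑ (vectors (permutations n) r) (λ zs →
      ⟦ factors? (d ∷ʳ k) (zs ∷ʳ z) w ⟧ * totalWeight (d ∷ʳ k) (Y ∷ʳ y) (zs ∷ʳ z)))
      ≈⟨ ∑-cong (permutations n) (λ z → begin
           ∑ (vectors (permutations n) r) (λ zs →
             ⟦ factors? (d ∷ʳ k) (zs ∷ʳ z) w ⟧ * totalWeight (d ∷ʳ k) (Y ∷ʳ y) (zs ∷ʳ z))
             ≈⟨ ∑-cong (vectors (permutations n) r) (λ zs → ⟦⟧-×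
                  (factors? (d ∷ʳ k) (zs ∷ʳ z) w) (isCycle? (suc k) z) (factors? d zs (u z))
                  (λ fs → proj₁ (factors-∷ʳ⁻ d zs z fs))
                  (λ _ fs → proj₂ (factors-∷ʳ⁻ d zs z fs) (uz≗w z))
                  (λ cyc fs → factors-∷ʳ⁺ d zs z cyc fs (uz≗w z))
                  (λ fs → trans (totalWeight-∷ʳ d Y zs k y z) (trans (*-comm _ _) (*-congʳ (stepWeight-cong
                    (proj₂ (proj₂ (factors-∷ʳ⁻ d zs z fs) {u z} (uz≗w z))) (proj₂ fs)))))) ⟩
           ∑ (vectors (permutations n) r) (λ zs → ⟦ isCycle? (suc k) z ⟧ *
             (stepWeight y (suc k) (u z) w * (⟦ factors? d zs (u z) ⟧ * totalWeight d Y zs)))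
             ≈⟨ trans (∑-* _ (vectors (permutations n) r) _) (*-congˡ (∑-* _ (vectors (permutations n) r) _)) ⟩
           lastTerm d Y k y w z ∎) ⟩
    ∑ (permutations n) (lastTerm d Y k y w) ∎
    where
    u : Permutation′ n → Fin n → Fin n
    u z t = w (z ⟨$⟩ˡ t)

    uz≗w : ∀ z t → u z (z ⟨$⟩ʳ t) ≡ w t
    uz≗w z t = ≡.cong w (inverseˡ z)

  Φ-∷ : ∀ k Y (bs : List (List A)) ps →
    Φ bs ((k , Y) ∷ ps) ≈
    ∑ (moves (suc k) bs) (λ (cut , bs′) → tailWeight Y (length (proj₂ cut)) * Φ bs′ ps)
  Φ-∷ k Y []       ps = refl
  Φ-∷ k Y (b ∷ bs) ps = begin
    ((λ I → F (length b) ((k , Y) ∷ I)) ⊛ Φ bs) ps + (F (length b) ⊛ (λ I → Φ bs ((k , Y) ∷ I))) ps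
      ≈⟨ +-cong
           (trans (⊛-cong (F-∷ k Y b) (λ _ → refl) ps) (trans (∑-⊛ˡ (cuts (suc k) b) _ (Φ bs) ps)
             (∑-cong (cuts (suc k) b) λ cut → trans (⊛-*ˡ _ _ _ ps) (*-congˡ (sym (Φ-++ (cutBlocks cut) bs ps))))))
           (trans (⊛-cong (λ _ → refl) (Φ-∷ k Y bs) ps) (trans (∑-⊛ʳ (moves (suc k) bs) (F (length b)) _ ps)
             (∑-cong (moves (suc k) bs) λ _ → ⊛-*ʳ _ (F (length b)) _ ps))) ⟩
    ∑ (cuts (suc k) b) (λ cut → tailWeight Y (length (proj₂ cut)) * Φ (cutBlocks cut ++ bs) ps) +
    ∑ (moves (suc k) bs) (λ (cut , bs′) → tailWeight Y (length (proj₂ cut)) * Φ (b ∷ bs′) ps)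
      ≈⟨ +-cong (∑-map _ (cuts (suc k) b) _) (∑-map _ (moves (suc k) bs) _) ⟨
    _ ≈⟨ ∑-++ (map (λ cut → cut , cutBlocks cut ++ bs) (cuts (suc k) b)) _ _ ⟨
    ∑ (moves (suc k) (b ∷ bs)) (λ (cut , bs′) → tailWeight Y (length (proj₂ cut)) * Φ bs′ ps) ∎

  δ-≢ : ∀ {i j} → i ≢ j → δ i j ≈ 0#
  δ-≢ {zero}  {zero}  i≢j = contradiction ≡.refl i≢j
  δ-≢ {zero}  {suc j} i≢j = refl
  δ-≢ {suc i} {zero}  i≢j = refl
  δ-≢ {suc i} {suc j} i≢j = δ-≢ (i≢j ∘ ≡.cong suc)

  δ-refl : ∀ i → δ i i ≈ 1#
  δ-refl zero    = refl
  δ-refl (suc i) = δ-refl i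

  Φ-singletons : ∀ {bs : List (List (Fin n))} → All (λ b → length b ≡ 1) bs → Φ bs [] ≈ 1#
  Φ-singletons []       = refl
  Φ-singletons {bs = b ∷ bs} (eq ∷ eqs) = trans
    (*-cong (trans (*-identityʳ _) (reflexive (≡.cong (δ 1) eq))) (Φ-singletons eqs)) (*-identityˡ _)

  Φ-others : ∀ {bs : List (List (Fin n))} → ¬ All (λ b → length b ≡ 1) bs → Φ bs [] ≈ 0#
  Φ-others {bs = []}     ¬all = contradiction [] ¬all
  Φ-others {bs = b ∷ bs} ¬all with length b ℕ.≟ 1
  ... | yes eq = trans (*-congˡ (Φ-others (¬all ∘ (eq ∷_)))) (zeroʳ _)
  ... | no  ≢1 = trans (*-congʳ (trans (*-identityʳ _) (δ-≢ (≢1 ∘ ≡.sym)))) (zeroˡ _)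

  zip-∷ʳ : ∀ (d : Vec ℕ r) (Y : Vec Carrier r) k y → zip (d ∷ʳ k) (Y ∷ʳ y) ≡ zip d Y ∷ʳ (k , y)
  zip-∷ʳ []      []      k y = ≡.refl
  zip-∷ʳ (_ ∷ d) (_ ∷ Y) k y = ≡.cong (_ ∷_) (zip-∷ʳ d Y k y)

  items : Vec ℕ r → Vec Carrier r → List Item
  items d Y = fromLast (zip d Y)

  items-∷ʳ : ∀ (d : Vec ℕ r) Y k y → items (d ∷ʳ k) (Y ∷ʳ y) ≡ (k , y) ∷ items d Y
  items-∷ʳ d Y k y = ≡.trans (≡.cong fromLast (zip-∷ʳ d Y k y)) (fromLast-∷ʳ (zip d Y) (k , y))

  count-[] : ∀ {w : Fin n → Fin n} {bs} → Decomposition w bs → weightedCount [] [] w ≈ Φ bs []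
  count-[] {n} {w} {bs} D = trans (+-identityʳ _) (trans (*-identityʳ _) (compare (All.all? (λ b → length b ℕ.≟ 1) bs)))
    where
    open Decomposition D

    compare : Dec (All (λ b → length b ≡ 1) bs) → ⟦ factors? [] [] w ⟧ ≈ Φ bs []
    compare (yes ones) = trans (⟦⟧-yes (factors? [] [] w) ((λ ()) , fixed)) (sym (Φ-singletons ones))
      where
      fix-in : ∀ b → length b ≡ 1 → Cyclic w b → ∀ {t} → t ∈ b → t ≡ w t
      fix-in (x ∷ []) _ (p , _) (here ≡.refl) = ≡.sym p

      fixed : ∀ t → t ≡ w t
      fixed t = let b , t∈ , b∈ = blockOf D t in fix-in b (All.lookup ones b∈) (All.lookup cyclic b∈) t∈
    compare (no ¬ones) = trans (⟦⟧-no (factors? [] [] w) λ (_ , fixed) → ¬ones (All.tabulate λ {b} b∈ →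
        one fixed b (All.lookup sorted b∈) (All.lookup cyclic b∈))) (sym (Φ-others ¬ones))
      where
      one : (∀ t → t ≡ w t) → ∀ b → Sorted b → Cyclic w b → length b ≡ 1
      one fixed (x ∷ [])     _               _       = ≡.refl
      one fixed (x ∷ y ∷ ys) ((x<y ∷ _) ∷ _) (p , _) = contradiction (≡.trans (fixed x) p) (Fin.<⇒≢ x<y)

  module LastFactor {r} (d : Vec ℕ r) (Y : Vec Carrier r) (k : ℕ) (y : Carrier) {w : Fin n → Fin n} {bs}
    (D : Decomposition w bs) (rank : suc k ℕ.+ sum (fromLast d) ℕ.+ length bs ≡ n)
    (IH : ∀ {u : Fin n → Fin n} {bs′} → Decomposition u bs′ → sum (fromLast d) ℕ.+ length bs′ ≡ n →
          weightedCount d Y u ≈ Φ bs′ (items d Y)) where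

    private
      mvs = moves (2 ℕ.+ k) bs

      Move : Set
      Move = Cut (Fin n) × List (List (Fin n))

      cycleOf : Move → Permutation′ n
      cycleOf mv = cycle (ends (proj₁ mv))

      term : Permutation′ n → Carrier
      term = lastTerm d Y (suc k) y w

    ends-≡ : ∀ {z : Permutation′ n} {mv mv′} → mv ∈ mvs → mv′ ∈ mvs →
      (∀ t → z ⟨$⟩ʳ t ≡ cycleOf mv ⟨$⟩ʳ t) → (∀ t → z ⟨$⟩ʳ t ≡ cycleOf mv′ ⟨$⟩ʳ t) →
      ends (proj₁ mv) ≡ ends (proj₁ mv′)
    ends-≡ mv∈ mv∈′ z≗ z≗′ =
      let s , l = moves-lengths {k = suc k} D mv∈
          s′ , l′ = moves-lengths {k = suc k} D mv∈′
      in cycle-injective (two l) (two l′) s s′ (λ t → ≡.trans (≡.sym (z≗ t)) (z≗′ t))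
      where
      two : ∀ {l} → l ≡ 2 ℕ.+ k → 2 ℕ.≤ l
      two ≡.refl = ℕ.s≤s (ℕ.s≤s ℕ.z≤n)

    term-zero : ∀ z → ¬ (∃ λ mv → mv ∈ mvs × (∀ t → z ⟨$⟩ʳ t ≡ cycleOf mv ⟨$⟩ʳ t)) → term z ≈ 0#
    term-zero z ¬mv = by-cases (isCycle? (2 ℕ.+ k) z)
      where
      u : Fin n → Fin n
      u t = w (z ⟨$⟩ˡ t)

      by-cases : Dec (IsCycle (2 ℕ.+ k) z) → term z ≈ 0#
      by-cases (no ¬cyc) = trans (*-congʳ (⟦⟧-no (isCycle? (2 ℕ.+ k) z) ¬cyc)) (zeroˡ _)
      by-cases (yes cyc) = trans (*-congˡ (trans (*-congˡ none) (zeroʳ _))) (zeroʳ _)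
        where
        none : weightedCount d Y u ≈ 0#
        none = trans (∑-cong (vectors (permutations n) r) λ zs → trans (*-congʳ (⟦⟧-no (factors? d zs u) λ fs →
            ¬mv (minimal-cycle {u = u} {z = z} D cyc (factors⇒product d zs fs) (λ t → ≡.cong w (inverseˡ z)) rank)))
            (zeroˡ _)) (∑-0 (vectors (permutations n) r))

    term-indicator : ∀ z → ∑ mvs (λ mv → ⟦ z ≗? cycleOf mv ⟧ * term z) ≈ term z
    term-indicator z = by-cases (Any.any? (λ mv → z ≗? cycleOf mv) mvs)
      where
      by-cases : Dec (Any.Any (λ mv → ∀ t → z ⟨$⟩ʳ t ≡ cycleOf mv ⟨$⟩ʳ t) mvs) →
                 ∑ mvs (λ mv → ⟦ z ≗? cycleOf mv ⟧ * term z) ≈ term z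
      by-cases (yes any) with mv , mv∈ , z≗ ← find any =
        ∑-single (λ mv → z ≗? cycleOf mv) (ends ∘ proj₁) mvs (λ _ → term z) mv∈ z≗
          (λ mv∈′ z≗′ → ends-≡ {z} mv∈′ mv∈ z≗′ z≗) (moves-ends-unique (suc k) bs (Decomposition.unique D))
      by-cases (no ¬any) = trans
        (trans (∑-cong-∈ mvs λ {mv} mv∈ → trans (*-congʳ (⟦⟧-no (z ≗? cycleOf mv) λ z≗ → ¬any (lose mv∈ z≗))) (zeroˡ _))
          (∑-0 mvs))
        (sym (term-zero z λ (mv , mv∈ , z≗) → ¬any (lose mv∈ z≗)))

    term-move : ∀ {mv} → mv ∈ mvs →
      term (cycleOf mv) ≈ tailWeight y (length (proj₂ (proj₁ mv))) * Φ (proj₂ mv) (items d Y)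
    term-move {(as , tail) , bs′} mv∈ = trans (*-congʳ (⟦⟧-yes (isCycle? (2 ℕ.+ k) z)
        (cycle-isCycle (ends cut) (proj₂ (moves-lengths {k = suc k} D mv∈))
          (sorted⇒unique (proj₁ (moves-lengths {k = suc k} D mv∈))))))
      (trans (*-identityˡ _) (*-cong (weight tail ≡.refl) (IH D′ rank′)))
      where
      cut = as , tail

      z : Permutation′ n
      z = cycle (ends cut)

      u : Fin n → Fin n
      u t = w (z ⟨$⟩ˡ t)

      refined = refine {u = u} {z = z} (suc k) D mv∈ (λ t → ≡.cong w (inverseˡ z)) (λ _ → ≡.refl)

      D′ : Decomposition u bs′
      D′ = proj₁ refined

      rank′ : sum (fromLast d) ℕ.+ length bs′ ≡ n
      rank′ = ≡.trans (≡.cong (sum (fromLast d) ℕ.+_) (proj₂ refined))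
        (≡.trans (≡.sym (ℕ.+-assoc (sum (fromLast d)) (suc k) (length bs)))
          (≡.trans (≡.cong (ℕ._+ length bs) (ℕ.+-comm (sum (fromLast d)) (suc k))) rank))

      blocks  = decomposition-blocks D
      blocks′ = decomposition-blocks D′

      facts : MoveFacts k tail (toPartition blocks′) (toPartition blocks)
      facts = moveFacts k blocks blocks′ mv∈

      weight : ∀ t → tail ≡ t → stepWeight y (2 ℕ.+ k) u w ≈ tailWeight y (length t)
      weight []      eq = stepWeight-yes (toPartition blocks′ , toPartition blocks ,
        σ-toPartition blocks′ (Decomposition.cyclic D′) , σ-toPartition blocks (Decomposition.cyclic D) , MoveFacts.interval facts eq)
      weight (g ∷ t) eq = stepWeight-no λ step → MoveFacts.not-interval facts eq
        (intervalStep-⊏ {π = toPartition blocks′} {toPartition blocks}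
          (σ-toPartition blocks′ (Decomposition.cyclic D′)) (σ-toPartition blocks (Decomposition.cyclic D)) step)

    count-step : weightedCount (d ∷ʳ suc k) (Y ∷ʳ y) w ≈ Φ bs ((suc k , y) ∷ items d Y)
    count-step = begin
      weightedCount (d ∷ʳ suc k) (Y ∷ʳ y) w
        ≈⟨ weightedCount-∷ʳ d Y (suc k) y w ⟩
      ∑ (permutations n) term
        ≈⟨ ∑-cong (permutations n) (λ z → sym (term-indicator z)) ⟩
      ∑ (permutations n) (λ z → ∑ mvs (λ mv → ⟦ z ≗? cycleOf mv ⟧ * term z))
        ≈⟨ ∑-swap (permutations n) mvs _ ⟩
      ∑ mvs (λ mv → ∑ (permutations n) (λ z → ⟦ z ≗? cycleOf mv ⟧ * term z))
        ≈⟨ ∑-cong mvs (λ mv → ∑-permutations (cycleOf mv) term λ {z} {z′} → lastTerm-cong d Y (suc k) y w {z} {z′}) ⟩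
      ∑ mvs (term ∘ cycleOf)
        ≈⟨ ∑-cong-∈ mvs term-move ⟩
      ∑ mvs (λ mv → tailWeight y (length (proj₂ (proj₁ mv))) * Φ (proj₂ mv) (items d Y))
        ≈⟨ Φ-∷ (suc k) y bs (items d Y) ⟨
      Φ bs ((suc k , y) ∷ items d Y) ∎

  count-Φ : ∀ (d : Vec ℕ r) Y {w : Fin n → Fin n} {bs} → Decomposition w bs → (∀ i → 1 ℕ.≤ lookup d i) →
            sum (fromLast d) ℕ.+ length bs ≡ n → weightedCount d Y w ≈ Φ bs (items d Y)
  count-Φ {zero} [] [] D 1≤ rank = count-[] D
  count-Φ {suc r} d Y {w} {bs} D 1≤ rank with Vec.initLast d | Vec.initLast Y
  ... | d′ , zero  , ≡.refl | _ = contradiction (≡.subst (1 ℕ.≤_) (lookup-∷ʳ-fromℕ d′ 0) (1≤ (fromℕ r))) λ ()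
  ... | d′ , suc k , ≡.refl | Y′ , y , ≡.refl = trans
    (LastFactor.count-step d′ Y′ k y D (≡.trans (≡.cong (λ ks → sum ks ℕ.+ length bs) (≡.sym (fromLast-∷ʳ d′ (suc k)))) rank)
      λ D′ → count-Φ d′ Y′ D′ λ i → ≡.subst (1 ℕ.≤_) (lookup-∷ʳ-inject₁ d′ (suc k) i) (1≤ (inject₁ i)))
    (reflexive (≡.cong (Φ bs) (≡.sym (items-∷ʳ d′ Y′ (suc k) y))))

  data WeightView {m} (a : Vec ℕ (suc m)) (X : Fin m → Carrier) (z : Vec (Permutation′ n) (suc m)) : Carrier → Set c where
    chain   : ∀ Π → Corresponds Π z → WeightView a X z (wtChain a X Π)
    noChain : ¬ (∃ λ Π → Corresponds Π z × IsChain a Π) → WeightView a X z 0#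

  weightView : ∀ {m} (a : Vec ℕ (suc m)) (X : Fin m → Carrier) (z : Vec (Permutation′ n) (suc m)) →
               WeightView a X z (wt a X z)
  weightView a X z with chainOf? a z
  ... | yes (Π , corr , _) = chain Π corr
  ... | no ¬exists         = noChain ¬exists

  wtChain-factors : ∀ {m} (a : Vec ℕ (suc m)) (X : Fin m → Carrier) (Π : Vec (SetPartition n) (suc (suc m))) →
                    ∃ λ (f : Fin m → Carrier) → ∏ f ≡ wtChain a X Π
  wtChain-factors a X Π = _ , ≡.refl

  wtChain-≈ : ∀ {m} (a : Vec ℕ (suc m)) (X : Fin m → Carrier) (Π : Vec (SetPartition n) (suc (suc m))) (f : Fin m → Carrier) →
    (∀ j → lookup Π (suc (inject₁ j)) ⊏[ lookup a (suc j) ] lookup Π (suc (suc j)) → f j ≈ 1#) →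
    (∀ j → ¬ lookup Π (suc (inject₁ j)) ⊏[ lookup a (suc j) ] lookup Π (suc (suc j)) → f j ≈ X j) →
    wtChain a X Π ≈ ∏ f
  wtChain-≈ a X Π f yes-case no-case = sum-cong-≋ factor
    where
    factor : ∀ j → proj₁ (wtChain-factors a X Π) j ≈ f j
    factor j with lookup Π (suc (inject₁ j)) ⊏[ lookup a (suc j) ]? lookup Π (suc (suc j))
    ... | yes p = sym (yes-case j p)
    ... | no ¬p = sym (no-case j ¬p)

  wt-totalWeight : ∀ {m} (a d : Vec ℕ (suc m)) (X : Fin m → Carrier) (z : Vec (Permutation′ n) (suc m)) →
    (∀ i → lookup a i ≡ suc (lookup d i)) → (∃ λ Π → Corresponds Π z × IsChain a Π) →
    wt a X z ≈ totalWeight d (1# ∷ Vec.tabulate X) z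
  wt-totalWeight {n} {m} a d X z a≡ exists = go (weightView a X z)
    where
    Y : Vec Carrier (suc m)
    Y = 1# ∷ Vec.tabulate X

    trivial : ∀ {Hyp : Set} (D : Dec Hyp) → (if does D then 1# else 1#) ≈ 1#
    trivial (yes _) = refl
    trivial (no _)  = refl

    first : factorWeight d Y z zero ≈ 1#
    first = trivial (intervalStep? (suc (lookup d zero)) (product z 0 ⟨$⟩ʳ_) (product z 1 ⟨$⟩ʳ_))

    go : ∀ {c} → WeightView a X z c → c ≈ totalWeight d Y z
    go (noChain ¬exists) = contradiction exists ¬exists
    go (chain Π corr)    = trans
      (wtChain-≈ a X Π (factorWeight d Y z ∘ suc)
        (λ j p → stepWeight-yes (lookup Π (suc (inject₁ j)) , lookup Π (suc (suc j)) , lower j , upper j ,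
          ≡.subst (λ l → lookup Π (suc (inject₁ j)) ⊏[ l ] lookup Π (suc (suc j))) (a≡ (suc j)) p))
        (λ j ¬p → trans (stepWeight-no λ step → ¬p
            (≡.subst (λ l → lookup Π (suc (inject₁ j)) ⊏[ l ] lookup Π (suc (suc j))) (≡.sym (a≡ (suc j)))
              (intervalStep-⊏ {π = lookup Π (suc (inject₁ j))} {lookup Π (suc (suc j))} (lower j) (upper j) step)))
          (reflexive (lookup∘tabulate X j))))
      (sym (trans (*-congʳ first) (*-identityˡ _)))
      where
      lower : ∀ j t → σ (lookup Π (suc (inject₁ j))) t ≡ product z (suc (toℕ j)) ⟨$⟩ʳ t
      lower j t = ≡.trans (corr (suc (inject₁ j)) t) (≡.cong (λ i → product z (suc i) ⟨$⟩ʳ t) (Fin.toℕ-inject₁ j))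

      upper : ∀ j t → σ (lookup Π (suc (suc j))) t ≡ product z (suc (suc (toℕ j))) ⟨$⟩ʳ t
      upper j = corr (suc (suc j))

  prefixSum : Vec ℕ r → ℕ → ℕ
  prefixSum d i = sum (List.take i (toList d))

  prefixSum-∷ʳ : ∀ (d : Vec ℕ r) k {i} → i ℕ.≤ r → prefixSum (d ∷ʳ k) i ≡ prefixSum d i
  prefixSum-∷ʳ d       k ℕ.z≤n     = ≡.refl
  prefixSum-∷ʳ (e ∷ d) k (ℕ.s≤s p) = ≡.cong (e ℕ.+_) (prefixSum-∷ʳ d k p)

  prefixSum-all : ∀ (d : Vec ℕ r) → prefixSum d r ≡ Vec.sum d
  prefixSum-all []      = ≡.refl
  prefixSum-all (e ∷ d) = ≡.cong (e ℕ.+_) (prefixSum-all d)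

  degree-items : ∀ (d : Vec ℕ r) Y → degree (items d Y) ≡ Vec.sum d
  degree-items {zero}  [] [] = ≡.refl
  degree-items {suc r} d Y with Vec.initLast d | Vec.initLast Y
  ... | d′ , k , ≡.refl | Y′ , y , ≡.refl = ≡.trans (≡.cong degree (items-∷ʳ d′ Y′ k y))
    (≡.trans (≡.cong (k ℕ.+_) (degree-items d′ Y′)) (≡.sym (sum-∷ʳ d′ k)))

  G-items : ∀ (d : Vec ℕ (suc r)) Y x → G x (items d Y) ≈ x * P x (items d Y)
  G-items d Y x with Vec.initLast d | Vec.initLast Y
  ... | d′ , k , ≡.refl | Y′ , y , ≡.refl rewrite items-∷ʳ d′ Y′ k y = refl

  ×ᵣ-≈ : ∀ k y → k ×ᵣ y ≈ ι k * y
  ×ᵣ-≈ zero    y = sym (zeroˡ y)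
  ×ᵣ-≈ (suc k) y = trans (+-cong (sym (*-identityˡ y)) (×ᵣ-≈ k y)) (sym (distribʳ y 1# (ι k)))

  linearFactor : ∀ {m} → Vec ℕ (suc m) → Vec Carrier (suc m) → Carrier → Fin m → Carrier
  linearFactor d Y x j =
    ((prefixSum d (suc (toℕ j)) ×ᵣ lookup Y (suc j)) + (x + ι (Vec.sum d))) - ι (prefixSum d (suc (toℕ j)))

  P-product : ∀ m (d : Vec ℕ (suc m)) Y x → P x (items d Y) ≈ ∏ (linearFactor d Y x)
  P-product zero (k ∷ []) (y ∷ []) x =
    trans (+-congˡ (trans (*-congˡ (zeroˡ _)) (zeroʳ y))) (+-identityʳ 1#)
  P-product (suc m) d Y x with Vec.initLast d | Vec.initLast Y
  ... | d′ , k , ≡.refl | Y′ , y , ≡.refl = begin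
    P x (items (d′ ∷ʳ k) (Y′ ∷ʳ y))
      ≡⟨ ≡.cong (P x) (items-∷ʳ d′ Y′ k y) ⟩
    G x′ ps + y * E x′ ps
      ≈⟨ +-congʳ (G-items d′ Y′ x′) ⟩
    x′ * P x′ ps + y * (ι (degree ps) * P x′ ps)
      ≈⟨ solve 4 (λ x y e p → x :* p :+ y :* (e :* p) := p :* (x :+ e :* y)) refl _ _ _ _ ⟩
    P x′ ps * (x′ + ι (degree ps) * y)
      ≈⟨ *-cong (P-product m d′ Y′ x′) (sym last) ⟩
    ∏ (linearFactor d′ Y′ x′) * linearFactor (d′ ∷ʳ k) (Y′ ∷ʳ y) x (fromℕ m)
      ≈⟨ *-congʳ (sum-cong-≋ {m} {linearFactor d′ Y′ x′} {linearFactor (d′ ∷ʳ k) (Y′ ∷ʳ y) x ∘ inject₁} λ j → sym (init j)) ⟩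
    ∏ (linearFactor (d′ ∷ʳ k) (Y′ ∷ʳ y) x ∘ inject₁) * linearFactor (d′ ∷ʳ k) (Y′ ∷ʳ y) x (fromℕ m)
      ≈⟨ sum-init-last (linearFactor (d′ ∷ʳ k) (Y′ ∷ʳ y) x) ⟨
    ∏ (linearFactor (d′ ∷ʳ k) (Y′ ∷ʳ y) x) ∎
    where
    ps = items d′ Y′
    x′ = x + ι k

    sum-ι : x + ι (Vec.sum (d′ ∷ʳ k)) ≈ x′ + ι (Vec.sum d′)
    sum-ι = trans (+-congˡ (trans (reflexive (≡.cong ι (sum-∷ʳ d′ k))) (ι-+ k (Vec.sum d′)))) (sym (+-assoc x _ _))

    init : ∀ j → linearFactor (d′ ∷ʳ k) (Y′ ∷ʳ y) x (inject₁ j) ≈ linearFactor d′ Y′ x′ j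
    init j = +-cong (+-cong (reflexive (≡.cong₂ _×ᵣ_ prefix (lookup-∷ʳ-inject₁ Y′ y (suc j)))) sum-ι)
                    (-‿cong (reflexive (≡.cong ι prefix)))
      where
      prefix : prefixSum (d′ ∷ʳ k) (suc (toℕ (inject₁ j))) ≡ prefixSum d′ (suc (toℕ j))
      prefix = ≡.trans (≡.cong (λ i → prefixSum (d′ ∷ʳ k) (suc i)) (Fin.toℕ-inject₁ j))
        (prefixSum-∷ʳ d′ k (ℕ.s≤s (ℕ.<⇒≤ (Fin.toℕ<n j))))

    last : linearFactor (d′ ∷ʳ k) (Y′ ∷ʳ y) x (fromℕ m) ≈ x′ + ι (degree ps) * y
    last = begin
      ((prefixSum (d′ ∷ʳ k) (suc (toℕ (fromℕ m))) ×ᵣ lookup (Y′ ∷ʳ y) (suc (fromℕ m))) + (x + ι (Vec.sum (d′ ∷ʳ k))))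
        - ι (prefixSum (d′ ∷ʳ k) (suc (toℕ (fromℕ m))))
        ≈⟨ +-cong (+-cong (trans (reflexive (≡.cong₂ _×ᵣ_ prefix (lookup-∷ʳ-fromℕ Y′ y))) (×ᵣ-≈ (degree ps) y)) sum-ι)
                  (-‿cong (reflexive (≡.cong ι prefix))) ⟩
      (ι (degree ps) * y + (x′ + ι (Vec.sum d′))) - ι (degree ps)
        ≡⟨ ≡.cong (λ s → (ι (degree ps) * y + (x′ + ι s)) - ι (degree ps)) (degree-items d′ Y′) ⟨
      (ι (degree ps) * y + (x′ + ι (degree ps))) - ι (degree ps)
        ≈⟨ +-congʳ (solve 3 (λ e y x → e :* y :+ (x :+ e) := (x :+ e :* y) :+ e) refl _ _ _) ⟩
      ((x′ + ι (degree ps) * y) + ι (degree ps)) - ι (degree ps)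
        ≈⟨ trans (+-assoc _ _ _) (trans (+-congˡ (-‿inverseʳ _)) (+-identityʳ _)) ⟩
      x′ + ι (degree ps) * y ∎
      where
      prefix : prefixSum (d′ ∷ʳ k) (suc (toℕ (fromℕ m))) ≡ degree ps
      prefix = ≡.trans (≡.cong (λ i → prefixSum (d′ ∷ʳ k) (suc i)) (Fin.toℕ-fromℕ m))
        (≡.trans (prefixSum-∷ʳ d′ k ℕ.≤-refl) (≡.trans (prefixSum-all d′) (≡.sym (degree-items d′ Y′))))

  count-next : ∀ n {m} (d : Vec ℕ (suc m)) Y → (∀ i → 1 ℕ.≤ lookup d i) → Vec.sum d ≡ n →
               weightedCount d Y (next {suc n}) ≈ ∏ (linearFactor d Y 1#)
  count-next n {m} d Y 1≤ total = begin
    weightedCount {n = suc n} d Y next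
      ≈⟨ count-Φ d Y (next-decomposition n) 1≤ (≡.trans (≡.cong₂ ℕ._+_ (≡.trans (sum-fromLast d) total) ≡.refl) (ℕ.+-comm n 1)) ⟩
    (F (length (allFin (suc n))) ⊛ unit) (items d Y)
      ≈⟨ ⊛-identityʳ _ (items d Y) ⟩
    δ (suc (degree (items d Y))) (length (allFin (suc n))) * G 1# (items d Y)
      ≈⟨ *-cong (trans (reflexive (≡.cong₂ (λ i j → δ (suc i) j) (≡.trans (degree-items d Y) total) (length-tabulate {n = suc n} id)))
                       (δ-refl n))
                (trans (G-items d Y 1#) (*-identityˡ _)) ⟩
    1# * P 1# (items d Y)
      ≈⟨ trans (*-identityˡ _) (P-product m d Y 1#) ⟩
    ∏ (linearFactor d Y 1#) ∎

open import Data.Nat.Base using (ℕ; suc; _∸_; _≤_)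
open import Data.Fin.Base using (Fin; toℕ)
open import Data.Vec.Base using (Vec; lookup; map; sum)
open import Relation.Binary.PropositionalEquality.Core using (_≡_)

module Specialization {n m : ℕ} (a : Vec ℕ (suc m))
  (2≤a : ∀ i → 2 ≤ lookup a i) (total : sum (map (_∸ 1) a) ≡ n) where

  open import Data.Fin.Base using (inject₁)
  open import Data.Fin.Permutation using (Permutation′)
  open import Data.List.Base as List using ()
  open import Data.List.Membership.Propositional.Properties using (∈-allFin)
  open import Data.List.Relation.Unary.Any using (here)
  open import Data.Nat.Base using (zero; _+_; s≤s; z≤n)
  import Data.Nat.ListAction as ListAction
  open import Data.Nat.Properties using (≤-trans; ≤-pred; +-comm; m+[n∸m]≡n)
  open import Data.Product.Base using (∃; _×_; _,_)
  open import Data.Vec.Base using ([]; _∷_; toList)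
  open import Data.Vec.Properties using (lookup-map)
  open import Relation.Binary.PropositionalEquality
  open Combinatorics

  d : Vec ℕ (suc m)
  d = map (_∸ 1) a

  lookup-d : ∀ i → lookup a i ≡ suc (lookup d i)
  lookup-d i = trans (sym (m+[n∸m]≡n (≤-trans (s≤s z≤n) (2≤a i)))) (cong suc (sym (lookup-map i (_∸ 1) a)))

  1≤d : ∀ i → 1 ≤ lookup d i
  1≤d i = ≤-pred (subst (2 ≤_) (lookup-d i) (2≤a i))

  b-prefix : ∀ i → b a i ≡ ListAction.sum (List.take i (toList d))
  b-prefix = go a
    where
    go : ∀ {r} (a : Vec ℕ r) i → b a i ≡ ListAction.sum (List.take i (toList (map (_∸ 1) a)))
    go a       zero    = refl
    go []      (suc i) = refl
    go (x ∷ a) (suc i) = cong ((x ∸ 1) +_) (go a i)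

  module _ (z : Vec (Permutation′ (suc n)) (suc m)) where

    factorization⇒factors : IsFactorization a z → Factors d z next
    factorization⇒factors (cycles , prod) = (λ i → subst (λ l → IsCycle l (lookup z i)) (lookup-d i) (cycles i)) , prod

    factors⇒factorization : Factors d z next → IsFactorization a z
    factors⇒factorization (cycles , prod) =
      (λ i → subst (λ l → IsCycle l (lookup z i)) (sym (lookup-d i)) (cycles i)) , prod

    factors⇒chain : Factors d z next → ∃ λ Π → Corresponds Π z × IsChain a Π
    factors⇒chain fs = C.chain , C.corresponds , C.noncrossing , C.bottom ,
      (λ s t → subst (λ π → s ∼[ π ] t) (sym C.top) (∼⁺ (decomposition-blocks D) (here refl) (∈-allFin s) (∈-allFin t))) ,
      λ i → subst (λ l → lookup C.chain (inject₁ i) ⊏̃[ l ] lookup C.chain (suc i)) (sym (lookup-d i)) (C.steps i)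
      where
      open import Data.Fin.Base using (suc)
      D = next-decomposition n
      module C = ChainTo (chain-exists d z D 1≤d fs
        (trans (cong (_+ 1) (trans (sum-fromLast d) total)) (+-comm n 1)) (one-block-noncrossing D))

theorem1 : ∀ {c ℓ} (R : CommutativeRing c ℓ) (n m : ℕ) (a : Vec ℕ (suc m)) →
    2 ≤ n →
    (∀ i → 2 ≤ lookup a i) →
    sum (map (_∸ 1) a) ≡ n ∸ 1 →
    let open Weights R in
    (X : Fin m → Carrier) →
    ∑ (𝓜 n a) (wt a X) ≈
    ∏ (λ j → let i = suc (toℕ j) in
    ((b a i ×ᵣ X j) + (n ×ᵣ 1#)) - (b a i ×ᵣ 1#))
theorem1 R (suc n) m a 2≤n 2≤a total X = begin
  ∑ (𝓜 (suc n) a) (wt a X)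
    ≈⟨ ∑-filter (isFactorization? a) zss (wt a X) ⟩
  ∑ zss (λ z → ⟦ isFactorization? a z ⟧ * wt a X z)
    ≈⟨ ∑-cong zss (λ z → trans (⟦⟧-× (isFactorization? a z) (yes tt) (factors? d z next) {y = 1#} (λ _ → tt)
         (λ _ → factorization⇒factors z) (λ _ → factors⇒factorization z)
         (λ fact → trans (wt-totalWeight a d X z lookup-d (factors⇒chain z (factorization⇒factors z fact))) (sym (*-identityˡ _))))
         (trans (*-identityˡ _) (*-identityˡ _))) ⟩
  weightedCount {n = suc n} d (1# ∷ Vec.tabulate X) next
    ≈⟨ count-next n d (1# ∷ Vec.tabulate X) 1≤d total ⟩
  ∏ (linearFactor d (1# ∷ Vec.tabulate X) 1#)
    ≈⟨ sum-cong-≋ {m} {linearFactor d (1# ∷ Vec.tabulate X) 1#} (λ j → +-cong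
         (+-cong (reflexive (≡.cong₂ _×ᵣ_ (≡.sym (b-prefix (suc (toℕ j)))) (lookup∘tabulate X j)))
                 (reflexive (≡.cong (λ s → 1# + ι s) total)))
         (-‿cong (reflexive (≡.cong ι (≡.sym (b-prefix (suc (toℕ j)))))))) ⟩
  ∏ (λ j → ((b a (suc (toℕ j)) ×ᵣ X j) + (suc n ×ᵣ 1#)) - (b a (suc (toℕ j)) ×ᵣ 1#)) ∎
  where
  open import Data.Unit.Base using (tt)
  open import Data.Vec.Base as Vec using (_∷_)
  open import Data.Vec.Properties using (lookup∘tabulate)
  import Relation.Binary.PropositionalEquality as ≡
  open import Relation.Nullary.Decidable using (yes)
  open CommutativeRing R
  open Weights R using (_×ᵣ_; ∑; ∏; wt)
  open import Algebra.Properties.CommutativeMonoid.Sum *-commutativeMonoid using (sum-cong-≋)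
  open import Relation.Binary.Reasoning.Setoid setoid
  open Enumeration R
  open Specialization {n} a 2≤a total

  zss = vectors (permutations (suc n)) (suc m)
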